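{- Let $P$ be a set of $n$ points in the Euclidean plane with at most $l$ of them collinear. Then $P$ determines at least $\dfrac{1}{122}n(n-l)$ lines each containing at most $3$ points of $P$.
   Context: A line is determined by $P$ if it contains at least two points of $P$. -}

module Defs where

open import Level using (0ℓ)
open import Algebra.Bundles using (CommutativeRing)
open import Data.Nat using (ℕ) renaming (_≤_ to _≤ℕ_)
open import Data.Fin using (Fin)
open import Data.Fin.Subset using (Subset; _∈_; ∣_∣)
open import Data.Product using (Σ; ∃; _×_; _,_; proj₁; proj₂)
open import Data.Sum using (_⊎_)
open import Relation.Nullary using (¬_)
open import Relation.Binary.PropositionalEquality using (_≡_)

-- The real numbers, axiomatised as a (Dedekind-)complete ordered field.
-- Any model is isomorphic to ℝ.
record RealNumbers : Set₁ where
  field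
    commRing : CommutativeRing 0ℓ 0ℓ
  open CommutativeRing commRing public
  infix 4 _<_ _≤_
  field
    _<_ : Carrier → Carrier → Set
  _≤_ : Carrier → Carrier → Set
  x ≤ y = (x < y) ⊎ (x ≈ y)
  field
    <-irrefl     : ∀ {x y} → x ≈ y → ¬ (x < y)
    <-trans      : ∀ {x y z} → x < y → y < z → x < z
    <-trichotomy : ∀ x y → (x < y) ⊎ ((x ≈ y) ⊎ (y < x))
    <-respˡ-≈    : ∀ {x y z} → x ≈ y → x < z → y < z
    <-respʳ-≈    : ∀ {x y z} → x ≈ y → z < x → z < y
    +-mono-<     : ∀ {x y} z → x < y → x + z < y + z
    *-pos        : ∀ {x y} → 0# < x → 0# < y → 0# < x * y
    0<1          : 0# < 1#
    inverse      : ∀ x → ¬ (x ≈ 0#) → ∃ λ y → x * y ≈ 1#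
    complete     : (S : Carrier → Set) → ∃ S →
                   (∃ λ b → ∀ x → S x → x ≤ b) →
                   ∃ λ s → (∀ x → S x → x ≤ s) ×
                           (∀ b → (∀ x → S x → x ≤ b) → s ≤ b)

module Plane (ℝ : RealNumbers) where
  open RealNumbers ℝ

  Point : Set
  Point = Carrier × Carrier

  record Line : Set where
    constructor line
    field
      a b c    : Carrier
      nondegen : ¬ ((a ≈ 0#) × (b ≈ 0#))

  OnLine : Point → Line → Set
  OnLine (x , y) (line a b c _) = a * x + b * y ≈ c

  Distinct : ∀ {n} → (Fin n → Point) → Set
  Distinct {n} P = ∀ i j → (proj₁ (P i) ≈ proj₁ (P j)) × (proj₂ (P i) ≈ proj₂ (P j)) → i ≡ j

  AtMostCollinear : ∀ {n} → (Fin n → Point) → ℕ → Set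
  AtMostCollinear {n} P l =
    ∀ (L : Line) (S : Subset n) → (∀ i → i ∈ S → OnLine (P i) L) → ∣ S ∣ ≤ℕ l

  AtMostOn : ∀ {n} → (Fin n → Point) → Line → ℕ → Set
  AtMostOn {n} P L k = ∀ (S : Subset n) → (∀ i → i ∈ S → OnLine (P i) L) → ∣ S ∣ ≤ℕ k

  Determined : ∀ {n} → (Fin n → Point) → Line → Set
  Determined {n} P L = Σ (Fin n) λ i → Σ (Fin n) λ j →
    ¬ (i ≡ j) × OnLine (P i) L × OnLine (P j) L

  DifferentLines : Line → Line → Set
  DifferentLines L M = ¬ (∀ p → (OnLine p L → OnLine p M) × (OnLine p M → OnLine p L))

{-# OPTIONS --safe #-}
module Submission where

-- Let d_L be the number of points on the spanned line L and S the number of lines with d_L ≤ 3.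
--
-- Melchior's inequality ∑ (d_L − 3) ≤ 0 for noncollinear points: for consecutive points a, b of L
-- take, among the other spanned lines through a or b, the first one met when L is turned about both
-- points. The point of {a, b} on it is one of its two ends, and this end determines L, a and b.
--
-- If some line L has d_L ≥ 2n/61, a line M ≠ L joins at most d_M − 1 pairs of a point on L and a
-- point off L, so d_L (n − d_L) ≤ ∑ (d_M − 1) ≤ 4S by Melchior.
--
-- Otherwise write the number of pairs of points as ∑_ν ∑_L (d_L − 1 − ν)⁺. The terms with ν < 28
-- are at most 32S by Melchior. For larger ν a Szemerédi–Trotter argument bounds the inner sum by
-- max (n, 9n² / (2ν²)): the segments between consecutive points on the lines with d_L > ν + 1 cross
-- at most once per pair of lines, whereas a plane straight-line graph has at most three edges per
-- vertex, so that a random sample of the points would have too many crossings.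

-- Euler's formula would need faces, hence topology. Both places where it is customary, Melchior's
-- inequality and the edge bound for plane graphs, are therefore injective charging arguments that
-- only compare slopes and heights. They need every line to be a graph over the first axis, so the
-- points are sheared until their first coordinates differ.
--
-- The constant 122 comes from the case of a line with many points: its threshold 2n/61 turns the
-- bound 4S into 4 · 61/2 = 122. In the other case the sum of 9/(2ν²) over ν ≥ 28 is at most 9/(2 ·
-- 27) = 1/6. With N ≤ 2n/61 values of ν in use this gives n² ≤ n + 64S + 2(Nn + n²/6), which leaves
-- room to spare below 122.
--
-- All counting takes place in ℕ, where subtraction truncates. Hence subtracted terms stand on the
-- other side of the inequalities, and probabilities are cleared of denominators.

open import Defs

-- Finite sums, indicators and charging.

module Sums where

  open import Data.Bool using (if_then_else_)
  open import Data.Nat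
  open import Data.Nat.Properties
  open import Data.List using (List; []; _∷_; _++_; map; filter; length; cartesianProduct)
  open import Data.List.Membership.Propositional using (_∈_)
  open import Data.List.Relation.Unary.Any using (here; there)
  open import Data.List.Relation.Unary.All as All using (All; []; _∷_)
  open import Data.List.Relation.Unary.AllPairs using ([]; _∷_)
  open import Data.List.Relation.Unary.Unique.Propositional using (Unique)
  open import Data.Product using (∃; _×_; _,_; proj₁; proj₂)
  open import Data.Empty using (⊥-elim)
  open import Relation.Nullary using (¬_; Dec; yes; no; does)
  open import Relation.Unary using (Decidable)
  open import Relation.Binary.PropositionalEquality
  open import Data.Nat.Solver using (module +-*-Solver)

  𝟙 : {A : Set} → Dec A → ℕ
  𝟙 d = if does d then 1 else 0

  private variable A B : Set

  𝟙-yes : (d : Dec A) → A → 𝟙 d ≡ 1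
  𝟙-yes (yes _) _ = refl
  𝟙-yes (no ¬a) a = ⊥-elim (¬a a)

  𝟙-no : (d : Dec A) → ¬ A → 𝟙 d ≡ 0
  𝟙-no (yes a) ¬a = ⊥-elim (¬a a)
  𝟙-no (no _) _ = refl

  𝟙-mono : (d : Dec A) (e : Dec B) → (A → B) → 𝟙 d ≤ 𝟙 e
  𝟙-mono (yes a) e f = ≤-reflexive (sym (𝟙-yes e (f a)))
  𝟙-mono (no _) e f = z≤n

  𝟙-bound : (d : Dec A) {k : ℕ} → (A → 1 ≤ k) → 𝟙 d ≤ k
  𝟙-bound (yes a) f = f a
  𝟙-bound (no _) f = z≤n

  𝟙-idem : (d : Dec A) → 𝟙 d * 𝟙 d ≡ 𝟙 d
  𝟙-idem (yes _) = refl
  𝟙-idem (no _) = refl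

  ∑ : {A : Set} → List A → (A → ℕ) → ℕ
  ∑ [] f = 0
  ∑ (x ∷ xs) f = f x + ∑ xs f

  syntax ∑ xs (λ x → e) = ∑[ x ∈ xs ] e
  infix 5 ∑

  private
    interchange : ∀ a b c d → (a + b) + (c + d) ≡ (a + c) + (b + d)
    interchange = solve 4 (λ a b c d → (a :+ b) :+ (c :+ d) := (a :+ c) :+ (b :+ d)) refl
      where open +-*-Solver

  module _ {A : Set} where

    ∑-mono-∈ : ∀ (xs : List A) {f g} → (∀ x → x ∈ xs → f x ≤ g x) → ∑ xs f ≤ ∑ xs g
    ∑-mono-∈ [] h = z≤n
    ∑-mono-∈ (x ∷ xs) h = +-mono-≤ (h x (here refl)) (∑-mono-∈ xs (λ y m → h y (there m)))

    ∑-mono : ∀ (xs : List A) {f g} → (∀ x → f x ≤ g x) → ∑ xs f ≤ ∑ xs g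
    ∑-mono xs h = ∑-mono-∈ xs (λ x _ → h x)

    ∑-cong-∈ : ∀ (xs : List A) {f g} → (∀ x → x ∈ xs → f x ≡ g x) → ∑ xs f ≡ ∑ xs g
    ∑-cong-∈ [] h = refl
    ∑-cong-∈ (x ∷ xs) h = cong₂ _+_ (h x (here refl)) (∑-cong-∈ xs (λ y m → h y (there m)))

    ∑-cong : ∀ (xs : List A) {f g} → (∀ x → f x ≡ g x) → ∑ xs f ≡ ∑ xs g
    ∑-cong xs h = ∑-cong-∈ xs (λ x _ → h x)

    ∑-const : ∀ (xs : List A) k → ∑ xs (λ _ → k) ≡ length xs * k
    ∑-const [] k = refl
    ∑-const (x ∷ xs) k = cong (k +_) (∑-const xs k)

    ∑-zero : ∀ (xs : List A) {f} → (∀ x → f x ≡ 0) → ∑ xs f ≡ 0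
    ∑-zero xs h = trans (∑-cong xs h) (trans (∑-const xs 0) (*-zeroʳ (length xs)))

    ∑-+ : ∀ (xs : List A) f g → ∑ xs (λ x → f x + g x) ≡ ∑ xs f + ∑ xs g
    ∑-+ [] f g = refl
    ∑-+ (x ∷ xs) f g = trans (cong (f x + g x +_) (∑-+ xs f g)) (interchange (f x) (g x) _ _)

    ∑-*ˡ : ∀ (xs : List A) k f → ∑ xs (λ x → k * f x) ≡ k * ∑ xs f
    ∑-*ˡ [] k f = sym (*-zeroʳ k)
    ∑-*ˡ (x ∷ xs) k f = trans (cong (k * f x +_) (∑-*ˡ xs k f)) (sym (*-distribˡ-+ k (f x) _))

    ∑-*ʳ : ∀ (xs : List A) k f → ∑ xs (λ x → f x * k) ≡ ∑ xs f * k
    ∑-*ʳ xs k f = trans (∑-cong xs (λ x → *-comm (f x) k)) (trans (∑-*ˡ xs k f) (*-comm k _))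

    ∑-++ : ∀ (xs ys : List A) f → ∑ (xs ++ ys) f ≡ ∑ xs f + ∑ ys f
    ∑-++ [] ys f = refl
    ∑-++ (x ∷ xs) ys f = trans (cong (f x +_) (∑-++ xs ys f)) (sym (+-assoc (f x) _ _))

    ∑-map : ∀ {B : Set} (h : B → A) (xs : List B) f → ∑ (map h xs) f ≡ ∑ xs (λ x → f (h x))
    ∑-map h [] f = refl
    ∑-map h (x ∷ xs) f = cong (f (h x) +_) (∑-map h xs f)

    ∑-filter : ∀ {P : A → Set} (P? : Decidable P) xs f →
               ∑ (filter P? xs) f ≡ ∑ xs (λ x → 𝟙 (P? x) * f x)
    ∑-filter P? [] f = refl
    ∑-filter P? (x ∷ xs) f with P? x
    ... | yes _ = cong₂ _+_ (sym (+-identityʳ (f x))) (∑-filter P? xs f)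
    ... | no _ = ∑-filter P? xs f

    ∑-∈ : ∀ {xs : List A} {x} f → x ∈ xs → f x ≤ ∑ xs f
    ∑-∈ f (here refl) = m≤m+n _ _
    ∑-∈ {y ∷ _} f (there m) = ≤-trans (∑-∈ f m) (m≤n+m _ (f y))

    -- The bridge from geometric uniqueness (one meeting point, one crossing, one last point) to a
    -- numerical bound.
    ∑-at-most-one : ∀ {xs : List A} {P : A → Set} (P? : Decidable P) → Unique xs →
                    (∀ x y → x ∈ xs → y ∈ xs → P x → P y → x ≡ y) → ∑[ x ∈ xs ] 𝟙 (P? x) ≤ 1
    ∑-at-most-one P? [] h = z≤n
    ∑-at-most-one {x ∷ xs} P? (x∉ ∷ u) h with P? x
    ... | no _ = ∑-at-most-one P? u (λ a b ma mb → h a b (there ma) (there mb))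
    ... | yes px = s≤s (≤-reflexive (trans (∑-cong-∈ xs none) (trans (∑-const xs 0) (*-zeroʳ (length xs)))))
      where
      none : ∀ y → y ∈ xs → 𝟙 (P? y) ≡ 0
      none y m = 𝟙-no (P? y) (λ py → All.lookup x∉ m (h x y (here refl) (there m) px py))

  ∑-swap : ∀ {A B : Set} (xs : List A) (ys : List B) (f : A → B → ℕ) →
           ∑[ x ∈ xs ] (∑[ y ∈ ys ] f x y) ≡ ∑[ y ∈ ys ] (∑[ x ∈ xs ] f x y)
  ∑-swap [] ys f = sym (∑-zero ys (λ _ → refl))
  ∑-swap (x ∷ xs) ys f = trans (cong (∑ ys (f x) +_) (∑-swap xs ys f)) (sym (∑-+ ys (f x) _))

  ∑-× : ∀ {A B : Set} (xs : List A) (ys : List B) (f : A × B → ℕ) →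
        ∑ (cartesianProduct xs ys) f ≡ ∑[ x ∈ xs ] (∑[ y ∈ ys ] f (x , y))
  ∑-× [] ys f = refl
  ∑-× (x ∷ xs) ys f = trans (∑-++ (map (x ,_) ys) _ f) (cong₂ _+_ (∑-map (x ,_) ys f) (∑-× xs ys f))

  ∑-prod : ∀ {A B : Set} (xs : List A) (ys : List B) (f : A → ℕ) (g : B → ℕ) →
           ∑[ x ∈ xs ] (∑[ y ∈ ys ] (f x * g y)) ≡ ∑ xs f * ∑ ys g
  ∑-prod xs ys f g = trans (∑-cong xs (λ x → ∑-*ˡ ys (f x) g)) (∑-*ʳ xs (∑ ys g) f)

  module _ {A B : Set} (_≟_ : ∀ (y z : B) → Dec (y ≡ z)) {R : A → B → Set} where

    private
      transversal : ∀ {xs : List A} → Unique xs →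
                    (∀ x → x ∈ xs → ∃ (R x)) →
                    (∀ x x′ y → x ∈ xs → x′ ∈ xs → R x y → R x′ y → x ≡ x′) →
                    ∃ λ (zs : List B) → length zs ≡ length xs × Unique zs ×
                      (∀ z → z ∈ zs → ∃ λ x → x ∈ xs × R x z)
      transversal [] total inj = [] , refl , [] , λ _ ()
      transversal {x ∷ xs} (x∉ ∷ u) total inj
        with total x (here refl)
           | transversal u (λ a p → total a (there p))
               (λ a b y p q → inj a b y (there p) (there q))
      ... | z , r | zs , len , uz , back =
        z ∷ zs , cong suc len , All.tabulate fresh ∷ uz , back′
        where
        fresh : ∀ {z′} → z′ ∈ zs → z ≢ z′
        fresh {z′} q refl with back z′ q
        ... | x′ , p′ , r′ = All.lookup x∉ p′ (inj x x′ z (here refl) (there p′) r r′)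
        back′ : ∀ z′ → z′ ∈ z ∷ zs → ∃ λ x′ → x′ ∈ x ∷ xs × R x′ z′
        back′ z′ (here refl) = x , here refl , r
        back′ z′ (there q) with back z′ q
        ... | x′ , p′ , r′ = x′ , there p′ , r′

    -- Choose one target per item: as `R` is injective the chosen targets are distinct, and each has
    -- capacity at least one. The capacity is 1 for Melchior's inequality and the indicator of a
    -- sampled vertex for plane graphs.
    charging : ∀ {xs : List A} (ys : List B) (cap : B → ℕ) → Unique xs →
               (∀ x → x ∈ xs → ∃ (R x)) →
               (∀ x x′ y → x ∈ xs → x′ ∈ xs → R x y → R x′ y → x ≡ x′) →
               (∀ x y → x ∈ xs → R x y → y ∈ ys × 1 ≤ cap y) →
               length xs ≤ ∑ ys cap
    charging {xs} ys cap u total inj pos with transversal u total inj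
    ... | zs , len , uz , back = begin
      length xs                                ≡⟨ len ⟨
      length zs                                ≡⟨ trans (∑-const zs 1) (*-identityʳ _) ⟨
      ∑[ z ∈ zs ] 1                            ≤⟨ ∑-mono-∈ zs one ⟩
      ∑[ z ∈ zs ] (∑[ y ∈ ys ] 𝟙 (y ≟ z))      ≡⟨ ∑-swap zs ys _ ⟩
      ∑[ y ∈ ys ] (∑[ z ∈ zs ] 𝟙 (y ≟ z))      ≤⟨ ∑-mono ys few ⟩
      ∑ ys cap                                 ∎
      where
      open ≤-Reasoning
      one : ∀ z → z ∈ zs → 1 ≤ ∑[ y ∈ ys ] 𝟙 (y ≟ z)
      one z m with back z m
      ... | x , p , r = ≤-trans (≤-reflexive (sym (𝟙-yes (z ≟ z) refl)))
                          (∑-∈ (λ y → 𝟙 (y ≟ z)) (proj₁ (pos x z p r)))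
      -- A target of capacity zero is never chosen, and any other is chosen at most once.
      few : ∀ y → ∑[ z ∈ zs ] 𝟙 (y ≟ z) ≤ cap y
      few y with cap y in eq
      ... | suc k = ≤-trans (∑-at-most-one (y ≟_) uz (λ a b _ _ p q → trans (sym p) q)) (s≤s z≤n)
      ... | zero = ≤-reflexive (trans (∑-cong-∈ zs (λ z m → 𝟙-no (y ≟ z) (λ { refl → full z m eq })))
                     (trans (∑-const zs 0) (*-zeroʳ (length zs))))
        where
        full : ∀ z → z ∈ zs → cap z ≡ 0 → _
        full z m eq′ with back z m
        ... | x , p , r = n≮0 (subst (1 ≤_) eq′ (proj₂ (pos x z p r)))

-- Random subsets and the deletion method.

module Sampling where

  open import Data.Bool as Bool using (Bool; true; false)
  open import Data.Nat
  open import Data.Nat.Properties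
  open import Data.Fin as Fin using (Fin; zero; suc)
  open import Data.List using (List; []; _∷_; length)
  open import Data.Vec using (Vec; []; _∷_; lookup; _[_]≔_)
  open import Data.Vec.Properties using (lookup∘update′)
  open import Data.List.Membership.Propositional using (_∈_; find)
  open import Data.List.Relation.Unary.Any as Any using (here; there)
  open import Data.List.Relation.Unary.All as All using (All; []; _∷_)
  open import Data.List.Relation.Unary.AllPairs using ([]; _∷_)
  open import Data.List.Relation.Unary.Unique.Propositional using (Unique)
  open import Data.Product using (∃; _×_; _,_; proj₁; proj₂)
  open import Relation.Nullary using (¬_; Dec; yes; no)
  open import Relation.Binary.PropositionalEquality
  open import Data.Nat.Solver using (module +-*-Solver)
  open Sums

  private variable A B : Set

  ∑△ : List A → (A → A → ℕ) → ℕ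
  ∑△ [] g = 0
  ∑△ (x ∷ xs) g = ∑ xs (g x) + ∑△ xs g

  ∑△-mono-∈ : ∀ (xs : List A) {g h : A → A → ℕ} → (∀ x y → x ∈ xs → y ∈ xs → g x y ≤ h x y) → ∑△ xs g ≤ ∑△ xs h
  ∑△-mono-∈ [] le = z≤n
  ∑△-mono-∈ (x ∷ xs) le = +-mono-≤ (∑-mono-∈ xs (λ y q → le x y (here refl) (there q)))
    (∑△-mono-∈ xs (λ y z p q → le y z (there p) (there q)))

  ∑△-cong : ∀ (xs : List A) {g h : A → A → ℕ} → (∀ x y → g x y ≡ h x y) → ∑△ xs g ≡ ∑△ xs h
  ∑△-cong [] eq = refl
  ∑△-cong (x ∷ xs) eq = cong₂ _+_ (∑-cong xs (eq x)) (∑△-cong xs eq)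

  ∑△-*ˡ : ∀ (xs : List A) k g → ∑△ xs (λ x y → k * g x y) ≡ k * ∑△ xs g
  ∑△-*ˡ [] k g = sym (*-zeroʳ k)
  ∑△-*ˡ (x ∷ xs) k g = trans (cong₂ _+_ (∑-*ˡ xs k (g x)) (∑△-*ˡ xs k g)) (sym (*-distribˡ-+ k (∑ xs (g x)) _))

  -- The double sum meets every unordered pair twice; the diagonal is discarded.
  ∑△-half : ∀ (xs : List A) g → (∀ x y → g x y ≡ g y x) → 2 * ∑△ xs g ≤ ∑[ x ∈ xs ] (∑ xs (g x))
  ∑△-half [] g s = z≤n
  ∑△-half (x ∷ xs) g s = begin
    2 * (r + ∑△ xs g)                                 ≡⟨ *-distribˡ-+ 2 r _ ⟩
    2 * r + 2 * ∑△ xs g                               ≤⟨ +-monoʳ-≤ (2 * r) (∑△-half xs g s) ⟩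
    2 * r + inner                                     ≡⟨ solve 2 (λ r i → con 2 :* r :+ i := r :+ (r :+ i)) refl r inner ⟩
    r + (r + inner)                                   ≡⟨ cong (λ c → r + (c + inner)) (∑-cong xs (s x)) ⟩
    r + (∑ xs (λ y → g y x) + inner)                  ≡⟨ cong (r +_) (sym (∑-+ xs (λ y → g y x) _)) ⟩
    r + ∑ xs (λ y → g y x + ∑ xs (g y))               ≤⟨ +-monoˡ-≤ _ (m≤n+m r (g x x)) ⟩
    (g x x + r) + ∑ xs (λ y → g y x + ∑ xs (g y))     ∎
    where
    open ≤-Reasoning
    open +-*-Solver using (solve; _:+_; _:*_; _:=_; con)
    r inner : ℕ
    r = ∑ xs (g x)
    inner = ∑ xs (λ y → ∑ xs (g y))

  module _ {S : A → Set} (S? : ∀ x → Dec (S x)) {C : A → A → Set} (C? : ∀ x y → Dec (C x y))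
           (C-sym : ∀ x y → C x y → C y x) where

    -- Greedy deletion: an element of `S` is kept unless it conflicts with one kept from the rest of
    -- the list, and then this one pair, which lies in its row of `∑△`, pays for its loss.
    independent-part : ∀ xs → Unique xs → (∀ x → x ∈ xs → ¬ C x x) → ∃ λ K →
      Unique K × (∀ {x} → x ∈ K → x ∈ xs × S x) × (∀ {x y} → x ∈ K → y ∈ K → ¬ C x y) ×
      ∑[ x ∈ xs ] 𝟙 (S? x) ≤ length K + ∑△ xs (λ x y → 𝟙 (C? x y) * (𝟙 (S? x) * 𝟙 (S? y)))
    independent-part [] _ _ = [] , [] , (λ ()) , (λ ()) , z≤n
    independent-part (x ∷ xs) (x∉ ∷ u) irr
      with S? x | independent-part xs u (λ y p → irr y (there p))
    ... | no _ | K , uK , sub , ind , le =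
      K , uK , (λ p → there (proj₁ (sub p)) , proj₂ (sub p)) , ind ,
      ≤-trans le (+-monoʳ-≤ (length K) (m≤n+m _ (∑ xs _)))
    ... | yes sx | K , uK , sub , ind , le with Any.any? (C? x) K
    ...   | no free =
      x ∷ K ,
      All.tabulate (λ p e → All.lookup x∉ (proj₁ (sub p)) e) ∷ uK ,
      (λ { (here refl) → here refl , sx ; (there p) → there (proj₁ (sub p)) , proj₂ (sub p) }) ,
      (λ { (here refl) (here refl) → irr x (here refl)
         ; (here refl) (there q) c → free (Any.map (λ { refl → c }) q)
         ; (there p) (here refl) c → free (Any.map (λ { refl → C-sym _ _ c }) p)
         ; (there p) (there q) → ind p q }) ,
      s≤s (≤-trans le (+-monoʳ-≤ (length K) (m≤n+m _ (∑ xs _))))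
    ...   | yes hit with find hit
    ...     | y , p , c = K , uK , (λ p → there (proj₁ (sub p)) , proj₂ (sub p)) , ind , (begin
      suc (∑[ z ∈ xs ] 𝟙 (S? z))             ≤⟨ +-mono-≤ one le ⟩
      row + (length K + rest)                ≡⟨ solve 3 (λ r k s → r :+ (k :+ s) := k :+ (r :+ s)) refl row (length K) rest ⟩
      length K + (row + rest)                ∎)
      where
      open ≤-Reasoning
      open +-*-Solver using (solve; _:+_; _:=_)
      row rest : ℕ
      row = ∑ xs (λ z → 𝟙 (C? x z) * (1 * 𝟙 (S? z)))
      rest = ∑△ xs (λ x y → 𝟙 (C? x y) * (𝟙 (S? x) * 𝟙 (S? y)))
      one : 1 ≤ row
      one = ≤-trans (≤-reflexive (sym (cong₂ (λ u v → u * (1 * v)) (𝟙-yes (C? x y) c)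
              (𝟙-yes (S? y) (proj₂ (sub p)))))) (∑-∈ (λ z → 𝟙 (C? x z) * (1 * 𝟙 (S? z))) (proj₁ (sub p)))

  -- 𝔼 n g is (a + b)ⁿ times the expectation of g over random subsets of Fin n that contain each
  -- element independently with probability a / (a + b).
  module RandomSubset (a b : ℕ) where

    open +-*-Solver using (solve; _:+_; _:*_; _:=_; con)

    t : ℕ
    t = a + b

    𝔼 : ∀ n → (Vec Bool n → ℕ) → ℕ
    𝔼 zero g = g []
    𝔼 (suc n) g = a * 𝔼 n (λ Q → g (true ∷ Q)) + b * 𝔼 n (λ Q → g (false ∷ Q))

    𝔼-mono : ∀ n {g h} → (∀ Q → g Q ≤ h Q) → 𝔼 n g ≤ 𝔼 n h
    𝔼-mono zero le = le []
    𝔼-mono (suc n) le = +-mono-≤ (*-monoʳ-≤ a (𝔼-mono n (λ Q → le (true ∷ Q))))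
                                 (*-monoʳ-≤ b (𝔼-mono n (λ Q → le (false ∷ Q))))

    𝔼-cong : ∀ n {g h} → (∀ Q → g Q ≡ h Q) → 𝔼 n g ≡ 𝔼 n h
    𝔼-cong zero eq = eq []
    𝔼-cong (suc n) eq = cong₂ (λ u v → a * u + b * v) (𝔼-cong n (λ Q → eq (true ∷ Q)))
                                                      (𝔼-cong n (λ Q → eq (false ∷ Q)))

    𝔼-+ : ∀ n g h → 𝔼 n (λ Q → g Q + h Q) ≡ 𝔼 n g + 𝔼 n h
    𝔼-+ zero g h = refl
    𝔼-+ (suc n) g h = trans (cong₂ (λ u v → a * u + b * v) (𝔼-+ n _ _) (𝔼-+ n _ _))
      (solve 6 (λ a b p q r s → a :* (p :+ q) :+ b :* (r :+ s) := (a :* p :+ b :* r) :+ (a :* q :+ b :* s))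
        refl a b (𝔼 n (λ Q → g (true ∷ Q))) _ _ _)

    𝔼-*ˡ : ∀ n k g → 𝔼 n (λ Q → k * g Q) ≡ k * 𝔼 n g
    𝔼-*ˡ zero k g = refl
    𝔼-*ˡ (suc n) k g = trans (cong₂ (λ u v → a * u + b * v) (𝔼-*ˡ n k _) (𝔼-*ˡ n k _))
      (solve 5 (λ a b k p q → a :* (k :* p) :+ b :* (k :* q) := k :* (a :* p :+ b :* q))
        refl a b k (𝔼 n (λ Q → g (true ∷ Q))) _)

    𝔼-0 : ∀ n → 𝔼 n (λ _ → 0) ≡ 0
    𝔼-0 zero = refl
    𝔼-0 (suc n) = trans (cong₂ (λ u v → a * u + b * v) (𝔼-0 n) (𝔼-0 n))
                    (cong₂ _+_ (*-zeroʳ a) (*-zeroʳ b))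

    𝔼-1 : ∀ n → 𝔼 n (λ _ → 1) ≡ t ^ n
    𝔼-1 zero = refl
    𝔼-1 (suc n) = trans (cong₂ (λ u v → a * u + b * v) (𝔼-1 n) (𝔼-1 n)) (sym (*-distribʳ-+ (t ^ n) a b))

    𝔼-∑ : ∀ n (xs : List A) (g : A → Vec Bool n → ℕ) →
          𝔼 n (λ Q → ∑[ x ∈ xs ] g x Q) ≡ ∑[ x ∈ xs ] 𝔼 n (g x)
    𝔼-∑ n [] g = 𝔼-0 n
    𝔼-∑ n (x ∷ xs) g = trans (𝔼-+ n (g x) _) (cong (𝔼 n (g x) +_) (𝔼-∑ n xs g))

    𝔼-∑△ : ∀ n (xs : List A) (g : A → A → Vec Bool n → ℕ) →
           𝔼 n (λ Q → ∑△ xs (λ x y → g x y Q)) ≡ ∑△ xs (λ x y → 𝔼 n (g x y))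
    𝔼-∑△ n [] g = 𝔼-0 n
    𝔼-∑△ n (x ∷ xs) g = trans (𝔼-+ n _ _) (cong₂ _+_ (𝔼-∑ n xs (g x)) (𝔼-∑△ n xs g))

    Sampled? : ∀ {n} (Q : Vec Bool n) i → Dec (lookup Q i ≡ true)
    Sampled? Q i = lookup Q i Bool.≟ true

    ∏ : ∀ {n} → List (Fin n) → Vec Bool n → ℕ
    ∏ [] Q = 1
    ∏ (i ∷ is) Q = 𝟙 (Sampled? Q i) * ∏ is Q

    -- Independence: `g` ignores coordinate `i`, so the presence of `i` only contributes the factor
    -- `a` / `t`.
    𝔼-sampled : ∀ n (i : Fin n) g → (∀ Q v → g (Q [ i ]≔ v) ≡ g Q) →
                t * 𝔼 n (λ Q → 𝟙 (Sampled? Q i) * g Q) ≡ a * 𝔼 n g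
    𝔼-sampled (suc n) zero g indep = begin
      t * (a * 𝔼 n (λ Q → 1 * g (true ∷ Q)) + b * 𝔼 n (λ Q → 0))
        ≡⟨ cong₂ (λ u v → t * (a * u + b * v)) (𝔼-cong n (λ Q → *-identityˡ (g (true ∷ Q)))) (𝔼-0 n) ⟩
      t * (a * 𝔼 n (λ Q → g (true ∷ Q)) + b * 0)
        ≡⟨ solve 3 (λ a b e → (a :+ b) :* (a :* e :+ b :* con 0) := a :* (a :* e :+ b :* e)) refl a b (𝔼 n (λ Q → g (true ∷ Q))) ⟩
      a * (a * 𝔼 n (λ Q → g (true ∷ Q)) + b * 𝔼 n (λ Q → g (true ∷ Q)))
        ≡⟨ cong (λ u → a * (a * 𝔼 n (λ Q → g (true ∷ Q)) + b * u)) (𝔼-cong n (λ Q → sym (indep (true ∷ Q) false))) ⟩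
      a * (a * 𝔼 n (λ Q → g (true ∷ Q)) + b * 𝔼 n (λ Q → g (false ∷ Q))) ∎
      where open ≡-Reasoning
    𝔼-sampled (suc n) (suc i) g indep = begin
      t * (a * p + b * q)
        ≡⟨ solve 5 (λ t a b p q → t :* (a :* p :+ b :* q) := a :* (t :* p) :+ b :* (t :* q)) refl t a b p q ⟩
      a * (t * p) + b * (t * q)
        ≡⟨ cong₂ (λ u v → a * u + b * v) (𝔼-sampled n i _ (λ Q v → indep (true ∷ Q) v))
                                         (𝔼-sampled n i _ (λ Q v → indep (false ∷ Q) v)) ⟩
      a * (a * 𝔼 n (λ Q → g (true ∷ Q))) + b * (a * 𝔼 n (λ Q → g (false ∷ Q)))
        ≡⟨ solve 4 (λ a b p q → a :* (a :* p) :+ b :* (a :* q) := a :* (a :* p :+ b :* q)) refl a b (𝔼 n (λ Q → g (true ∷ Q))) _ ⟩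
      a * (a * 𝔼 n (λ Q → g (true ∷ Q)) + b * 𝔼 n (λ Q → g (false ∷ Q))) ∎
      where
      open ≡-Reasoning
      p q : ℕ
      p = 𝔼 n (λ Q → 𝟙 (Sampled? Q i) * g (true ∷ Q))
      q = 𝔼 n (λ Q → 𝟙 (Sampled? Q i) * g (false ∷ Q))

    ∏-update : ∀ {n} {i : Fin n} is → All (i ≢_) is → ∀ Q v → ∏ is (Q [ i ]≔ v) ≡ ∏ is Q
    ∏-update [] _ Q v = refl
    ∏-update {i = i} (j ∷ is) (i≢j ∷ h) Q v =
      cong₂ (λ c r → 𝟙 (c Bool.≟ true) * r) (lookup∘update′ (λ e → i≢j (sym e)) Q v) (∏-update is h Q v)

    -- The probability that k distinct elements all survive is (`a` / `t`)^k. A repeated index would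
    -- lower the exponent, hence `Unique`.
    𝔼-∏ : ∀ n {is : List (Fin n)} → Unique is → t ^ length is * 𝔼 n (∏ is) ≡ a ^ length is * t ^ n
    𝔼-∏ n [] = cong (1 *_) (𝔼-1 n)
    𝔼-∏ n {i ∷ is} (i∉ ∷ u) = begin
      t * t ^ k * 𝔼 n (∏ (i ∷ is))        ≡⟨ solve 3 (λ t s e → t :* s :* e := s :* (t :* e)) refl t (t ^ k) (𝔼 n (∏ (i ∷ is))) ⟩
      t ^ k * (t * 𝔼 n (∏ (i ∷ is)))      ≡⟨ cong (t ^ k *_) (𝔼-sampled n i (∏ is) (∏-update is i∉)) ⟩
      t ^ k * (a * 𝔼 n (∏ is))            ≡⟨ solve 3 (λ t a e → t :* (a :* e) := a :* (t :* e)) refl (t ^ k) a (𝔼 n (∏ is)) ⟩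
      a * (t ^ k * 𝔼 n (∏ is))            ≡⟨ cong (a *_) (𝔼-∏ n u) ⟩
      a * (a ^ k * t ^ n)                 ≡⟨ sym (*-assoc a (a ^ k) (t ^ n)) ⟩
      a * a ^ k * t ^ n                   ∎
      where
      open ≡-Reasoning
      k : ℕ
      k = length is

-- Arithmetic of the incidence bound.

module Arith where

  open import Data.Nat
  open import Data.Nat.Properties
  open import Data.Nat.Solver using (module +-*-Solver)
  open import Relation.Binary.PropositionalEquality
  open +-*-Solver using (solve; _:+_; _:*_; _:=_; con)
  open ≤-Reasoning

  -- Here and below `m` counts the rich lines, `I` their incidences, and `D` is their total excess
  -- over `ν + 1`. For `m ≤ 2 * ν` the quadratic term `m * m` is absorbed by the `2 * ν * m` that
  -- separates `2 * I` from `2 * D`.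
  few-lines : ∀ {n m ν D I} → D + suc ν * m ≡ I → 2 * I + m ≤ 2 * n + m * m → m ≤ 2 * ν → D ≤ n
  few-lines {n} {m} {ν} {D} refl h le = *-cancelˡ-≤ 2 (+-cancelʳ-≤ (2 * ν * m) (2 * D) (2 * n) (begin
    2 * D + 2 * ν * m                     ≤⟨ m≤m+n _ (3 * m) ⟩
    2 * D + 2 * ν * m + 3 * m             ≡⟨ solve 3 (λ D v m → con 2 :* D :+ con 2 :* v :* m :+ con 3 :* m
                                               := con 2 :* (D :+ (con 1 :+ v) :* m) :+ m) refl D ν m ⟩
    2 * (D + suc ν * m) + m               ≤⟨ h ⟩
    2 * n + m * m                         ≤⟨ +-monoʳ-≤ (2 * n) (*-monoˡ-≤ m le) ⟩
    2 * n + 2 * ν * m                     ∎))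

  -- With z = ν m and 3 n = z + r this is 2 ν² r ≤ 2 z r + r².
  unsampled : ∀ {n m ν D E X} → 2 * ν < m → ν * m ≤ 3 * n → D + ν * m ≤ E → E ≤ 3 * n + X →
              2 * X ≤ m * m → 2 * (ν * ν) * D ≤ 9 * (n * n)
  unsampled {n} {m} {ν} {D} {E} {X} big small hE hX hm = +-cancelʳ-≤ (2 * (ν * ν) * z) _ _ (begin
    2 * (ν * ν) * D + 2 * (ν * ν) * z     ≡⟨ solve 3 (λ v D z → con 2 :* (v :* v) :* D :+ con 2 :* (v :* v) :* z
                                               := con 2 :* (v :* v) :* (D :+ z)) refl ν D z ⟩
    2 * (ν * ν) * (D + z)                 ≤⟨ *-monoʳ-≤ (2 * (ν * ν)) (≤-trans hE hX) ⟩
    2 * (ν * ν) * (3 * n + X)             ≡⟨ cong (λ k → 2 * (ν * ν) * (k + X)) 3n ⟩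
    2 * (ν * ν) * (z + r + X)             ≡⟨ solve 4 (λ v z r X → con 2 :* (v :* v) :* (z :+ r :+ X)
                                               := (con 2 :* v :* v) :* r :+ con 2 :* (v :* v) :* z :+ v :* v :* (con 2 :* X))
                                               refl ν z r X ⟩
    2 * ν * ν * r + 2 * (ν * ν) * z + ν * ν * (2 * X)
      ≤⟨ +-mono-≤ (+-monoˡ-≤ _ (*-monoˡ-≤ r 2νν≤z)) (*-monoʳ-≤ (ν * ν) hm) ⟩
    z * r + 2 * (ν * ν) * z + ν * ν * (m * m)
      ≤⟨ m≤m+n _ (z * r + r * r) ⟩
    z * r + 2 * (ν * ν) * z + ν * ν * (m * m) + (z * r + r * r)
      ≡⟨ solve 4 (λ v m z r → z :* r :+ con 2 :* (v :* v) :* z :+ v :* v :* (m :* m) :+ (z :* r :+ r :* r)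
           := (v :* m) :* (v :* m) :+ con 2 :* (z :* r) :+ r :* r :+ con 2 :* (v :* v) :* z) refl ν m z r ⟩
    z * z + 2 * (z * r) + r * r + 2 * (ν * ν) * z
      ≡⟨ cong (_+ 2 * (ν * ν) * z) (solve 2 (λ z r → z :* z :+ con 2 :* (z :* r) :+ r :* r := (z :+ r) :* (z :+ r)) refl z r) ⟩
    (z + r) * (z + r) + 2 * (ν * ν) * z
      ≡⟨ cong (λ k → k * k + 2 * (ν * ν) * z) 3n ⟨
    3 * n * (3 * n) + 2 * (ν * ν) * z
      ≡⟨ cong (_+ 2 * (ν * ν) * z) (solve 1 (λ n → con 3 :* n :* (con 3 :* n) := con 9 :* (n :* n)) refl n) ⟩
    9 * (n * n) + 2 * (ν * ν) * z         ∎)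
    where
    z r : ℕ
    z = ν * m
    r = 3 * n ∸ z
    3n : 3 * n ≡ z + r
    3n = sym (m+[n∸m]≡n small)
    2νν≤z : 2 * ν * ν ≤ z
    2νν≤z = ≤-trans (≤-reflexive (*-comm (2 * ν) ν)) (*-monoʳ-≤ ν (<⇒≤ big))

  -- Sampling with probability p = 3n/z, where z = νm, gives E ≤ z + 9n²X/z². The vertex term 3n/p
  -- is exactly the z in `D + ν * m ≤ E` and cancels; `2 * X ≤ m * m` turns the rest into 9n²/(2ν²).
  sampled : ∀ {n m ν D E X} .{{_ : NonZero n}} .{{_ : NonZero m}} → D + ν * m ≤ E →
            E * (3 * n) * ((ν * m) * (ν * m)) ≤
              3 * n * ((ν * m) * (ν * m) * (ν * m)) + X * (3 * n * (3 * n) * (3 * n)) →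
            2 * X ≤ m * m → 2 * (ν * ν) * D ≤ 9 * (n * n)
  sampled {n} {m} {ν} {D} {E} {X} hE h hm =
    *-cancelˡ-≤ (3 * n * (m * m)) {{m*n≢0 (3 * n) (m * m) {{m*n≢0 3 n}} {{m*n≢0 m m}}}}
      (+-cancelʳ-≤ (2 * (3 * n) * (z * z * z)) _ _ (begin
    3 * n * (m * m) * (2 * (ν * ν) * D) + 2 * (3 * n) * (z * z * z)
      ≡⟨ solve 4 (λ n m v D → con 3 :* n :* (m :* m) :* (con 2 :* (v :* v) :* D)
                                :+ con 2 :* (con 3 :* n) :* ((v :* m) :* (v :* m) :* (v :* m))
           := con 2 :* ((D :+ v :* m) :* (con 3 :* n) :* ((v :* m) :* (v :* m)))) refl n m ν D ⟩
    2 * ((D + z) * (3 * n) * (z * z))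
      ≤⟨ *-monoʳ-≤ 2 (*-monoˡ-≤ (z * z) (*-monoˡ-≤ (3 * n) hE)) ⟩
    2 * (E * (3 * n) * (z * z))
      ≤⟨ *-monoʳ-≤ 2 h ⟩
    2 * (3 * n * (z * z * z) + X * (3 * n * (3 * n) * (3 * n)))
      ≡⟨ solve 3 (λ n z X → con 2 :* (con 3 :* n :* (z :* z :* z) :+ X :* (con 3 :* n :* (con 3 :* n) :* (con 3 :* n)))
           := con 3 :* n :* (con 9 :* (n :* n)) :* (con 2 :* X) :+ con 2 :* (con 3 :* n) :* (z :* z :* z)) refl n z X ⟩
    3 * n * (9 * (n * n)) * (2 * X) + 2 * (3 * n) * (z * z * z)
      ≤⟨ +-monoˡ-≤ _ (*-monoʳ-≤ (3 * n * (9 * (n * n))) hm) ⟩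
    3 * n * (9 * (n * n)) * (m * m) + 2 * (3 * n) * (z * z * z)
      ≡⟨ cong (_+ 2 * (3 * n) * (z * z * z)) (solve 2 (λ n m → con 3 :* n :* (con 9 :* (n :* n)) :* (m :* m)
           := con 3 :* n :* (m :* m) :* (con 9 :* (n :* n))) refl n m) ⟩
    3 * n * (m * m) * (9 * (n * n)) + 2 * (3 * n) * (z * z * z) ∎))
    where
    z : ℕ
    z = ν * m

-- Ordered field arithmetic and a ring solver.

module Field (ℝ : RealNumbers) where

  open import Data.Nat as ℕ using (ℕ; zero; suc)
  open import Data.Integer as ℤ using (ℤ; +_; -[1+_]; _⊖_)
  import Data.Integer.Properties as ℤₚ
  open import Data.Sign as Sign using (Sign)
  open import Data.Maybe using (Maybe; just; nothing)
  open import Data.Product using (∃; _×_; _,_; proj₁; proj₂)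
  open import Data.Sum using (_⊎_; inj₁; inj₂)
  open import Data.Empty using (⊥-elim)
  open import Data.List using (List; []; _∷_)
  open import Data.List.Membership.Propositional using (_∈_)
  open import Data.List.Relation.Unary.Any using (here; there)
  open import Relation.Unary using (Decidable)
  open import Relation.Nullary using (¬_; Dec; yes; no)
  import Relation.Binary.PropositionalEquality as ≡
  open import Algebra.Solver.Ring.AlmostCommutativeRing
  import Algebra.Solver.Ring

  open RealNumbers ℝ public hiding (zero)

  open import Algebra.Properties.Ring ring using (-‿distribˡ-*; -‿distribʳ-*; -0#≈0#)
  open import Algebra.Properties.AbelianGroup +-abelianGroup using (⁻¹-∙-comm; ⁻¹-involutive)
  open import Algebra.Properties.Monoid.Mult +-monoid using (×-homo-+) renaming (_×_ to _·_)
  open import Algebra.Properties.Semiring.Mult semiring using (×1-homo-*)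

  private
    open import Relation.Binary.Reasoning.Setoid setoid

    -- Integers serve as coefficients of the ring solver, because their equality computes and so
    -- allows cancellation.
    ι : ℤ → Carrier
    ι (+ n) = n · 1#
    ι -[1+ n ] = - (suc n · 1#)

    ι-neg : ∀ i → ι (ℤ.- i) ≈ - ι i
    ι-neg (+ zero) = sym -0#≈0#
    ι-neg (+ suc n) = refl
    ι-neg -[1+ n ] = sym (⁻¹-involutive _)

    cancel-1 : ∀ a b → a - b ≈ (1# + a) - (1# + b)
    cancel-1 a b = sym (begin
      (1# + a) + - (1# + b)      ≈⟨ +-cong (+-comm 1# a) (sym (⁻¹-∙-comm 1# b)) ⟩
      (a + 1#) + (- 1# + - b)    ≈⟨ +-assoc a 1# _ ⟩
      a + (1# + (- 1# + - b))    ≈⟨ +-congˡ (sym (+-assoc 1# (- 1#) (- b))) ⟩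
      a + ((1# + - 1#) + - b)    ≈⟨ +-congˡ (+-congʳ (-‿inverseʳ 1#)) ⟩
      a + (0# + - b)             ≈⟨ +-congˡ (+-identityˡ _) ⟩
      a + - b                    ∎)

    ι-⊖ : ∀ m n → ι (m ⊖ n) ≈ m · 1# - n · 1#
    ι-⊖ zero zero = sym (-‿inverseʳ 0#)
    ι-⊖ zero (suc n) = sym (+-identityˡ _)
    ι-⊖ (suc m) zero = sym (trans (+-congˡ -0#≈0#) (+-identityʳ _))
    ι-⊖ (suc m) (suc n) = begin
      ι (suc m ⊖ suc n)              ≡⟨ ≡.cong ι (ℤₚ.[1+m]⊖[1+n]≡m⊖n m n) ⟩
      ι (m ⊖ n)                      ≈⟨ ι-⊖ m n ⟩
      m · 1# - n · 1#                ≈⟨ cancel-1 _ _ ⟩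
      suc m · 1# - suc n · 1#        ∎

    ι-+ : ∀ i j → ι (i ℤ.+ j) ≈ ι i + ι j
    ι-+ (+ m) (+ n) = ×-homo-+ 1# m n
    ι-+ (+ m) -[1+ n ] = ι-⊖ m (suc n)
    ι-+ -[1+ m ] (+ n) = trans (ι-⊖ n (suc m)) (+-comm _ _)
    ι-+ -[1+ m ] -[1+ n ] = begin
      - (suc (suc (m ℕ.+ n)) · 1#)            ≡⟨ ≡.cong (λ k → - (k · 1#)) (≡.cong suc (≡.sym (ℕₚ.+-suc m n))) ⟩
      - ((suc m ℕ.+ suc n) · 1#)              ≈⟨ -‿cong (×-homo-+ 1# (suc m) (suc n)) ⟩
      - (suc m · 1# + suc n · 1#)             ≈⟨ sym (⁻¹-∙-comm _ _) ⟩
      - (suc m · 1#) + - (suc n · 1#)         ∎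
      where import Data.Nat.Properties as ℕₚ

    ι-* : ∀ i j → ι (i ℤ.* j) ≈ ι i * ι j
    ι-* (+ m) (+ n) = trans (reflexive (≡.cong ι (ℤₚ.+◃n≡+n (m ℕ.* n)))) (×1-homo-* m n)
    ι-* (+ m) -[1+ n ] = begin
      ι (Sign.- ℤ.◃ (m ℕ.* suc n))            ≡⟨ ≡.cong ι (ℤₚ.-◃n≡-n (m ℕ.* suc n)) ⟩
      ι (ℤ.- (+ (m ℕ.* suc n)))               ≈⟨ ι-neg (+ (m ℕ.* suc n)) ⟩
      - ((m ℕ.* suc n) · 1#)                  ≈⟨ -‿cong (×1-homo-* m (suc n)) ⟩
      - (m · 1# * suc n · 1#)                 ≈⟨ -‿distribʳ-* _ _ ⟩
      m · 1# * - (suc n · 1#)                 ∎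
    ι-* -[1+ m ] (+ n) = begin
      ι (Sign.- ℤ.◃ (suc m ℕ.* n))            ≡⟨ ≡.cong ι (ℤₚ.-◃n≡-n (suc m ℕ.* n)) ⟩
      ι (ℤ.- (+ (suc m ℕ.* n)))               ≈⟨ ι-neg (+ (suc m ℕ.* n)) ⟩
      - ((suc m ℕ.* n) · 1#)                  ≈⟨ -‿cong (×1-homo-* (suc m) n) ⟩
      - (suc m · 1# * n · 1#)                 ≈⟨ -‿distribˡ-* _ _ ⟩
      - (suc m · 1#) * n · 1#                 ∎
    ι-* -[1+ m ] -[1+ n ] = begin
      (suc m ℕ.* suc n) · 1#                  ≈⟨ ×1-homo-* (suc m) (suc n) ⟩
      a * b                                   ≈⟨ sym (⁻¹-involutive _) ⟩
      - (- (a * b))                           ≈⟨ -‿cong (-‿distribʳ-* a b) ⟩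
      - (a * - b)                             ≈⟨ -‿distribˡ-* a (- b) ⟩
      - a * - b                               ∎
      where
      a b : Carrier
      a = suc m · 1#
      b = suc n · 1#

    morphism : ℤ.+-*-rawRing -Raw-AlmostCommutative⟶ fromCommutativeRing commRing
    morphism = record
      { ⟦_⟧ = ι ; +-homo = ι-+ ; *-homo = ι-* ; -‿homo = ι-neg
      ; 0-homo = refl ; 1-homo = +-identityʳ 1# }

    ι-≟ : ∀ i j → Maybe (ι i ≈ ι j)
    ι-≟ i j with i ℤ.≟ j
    ... | yes p = just (reflexive (≡.cong ι p))
    ... | no _ = nothing

  module Solver = Algebra.Solver.Ring ℤ.+-*-rawRing (fromCommutativeRing commRing) morphism ι-≟
  open Solver using (solve; _:=_; _:+_; _:*_; _:-_; :-_; con)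


  <-asym : ∀ {a b} → a < b → ¬ (b < a)
  <-asym p q = <-irrefl refl (<-trans p q)

  _≈?_ : ∀ a b → Dec (a ≈ b)
  a ≈? b with <-trichotomy a b
  ... | inj₁ p = no (λ e → <-irrefl e p)
  ... | inj₂ (inj₁ e) = yes e
  ... | inj₂ (inj₂ p) = no (λ e → <-irrefl (sym e) p)

  _<?_ : ∀ a b → Dec (a < b)
  a <? b with <-trichotomy a b
  ... | inj₁ p = yes p
  ... | inj₂ (inj₁ e) = no (<-irrefl e)
  ... | inj₂ (inj₂ p) = no (<-asym p)

  ≮⇒≥ : ∀ {a b} → ¬ (a < b) → b ≤ a
  ≮⇒≥ {a} {b} h with <-trichotomy a b
  ... | inj₁ p = ⊥-elim (h p)
  ... | inj₂ (inj₁ e) = inj₂ (sym e)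
  ... | inj₂ (inj₂ p) = inj₁ p

  ≤⇒≯ : ∀ {a b} → a ≤ b → ¬ (b < a)
  ≤⇒≯ (inj₁ p) q = <-asym p q
  ≤⇒≯ (inj₂ e) q = <-irrefl (sym e) q

  ≤-<-trans : ∀ {a b c} → a ≤ b → b < c → a < c
  ≤-<-trans (inj₁ p) q = <-trans p q
  ≤-<-trans (inj₂ e) q = <-respˡ-≈ (sym e) q

  <-≤-trans : ∀ {a b c} → a < b → b ≤ c → a < c
  <-≤-trans p (inj₁ q) = <-trans p q
  <-≤-trans p (inj₂ e) = <-respʳ-≈ e p

  ≤-trans : ∀ {a b c} → a ≤ b → b ≤ c → a ≤ c
  ≤-trans p (inj₁ q) = inj₁ (≤-<-trans p q)
  ≤-trans (inj₁ p) (inj₂ e) = inj₁ (<-respʳ-≈ e p)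
  ≤-trans (inj₂ d) (inj₂ e) = inj₂ (trans d e)

  ≤-total : ∀ a b → (a ≤ b) ⊎ (b ≤ a)
  ≤-total a b with <-trichotomy a b
  ... | inj₁ p = inj₁ (inj₁ p)
  ... | inj₂ (inj₁ e) = inj₁ (inj₂ e)
  ... | inj₂ (inj₂ p) = inj₂ (inj₁ p)

  <⇒0< : ∀ {a b} → a < b → 0# < b - a
  <⇒0< {a} p = <-respˡ-≈ (-‿inverseʳ a) (+-mono-< (- a) p)

  0<⇒< : ∀ {a b} → 0# < b - a → a < b
  0<⇒< {a} {b} p = <-respʳ-≈ (solve 2 (λ a b → (b :- a) :+ a := b) refl a b)
                     (<-respˡ-≈ (+-identityˡ a) (+-mono-< a p))

  0<-+ : ∀ {a b} → 0# < a → 0# < b → 0# < a + b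
  0<-+ {a} {b} p q = <-trans q (<-respˡ-≈ (+-identityˡ b) (+-mono-< b p))

  ≤⇒0≤ : ∀ {a b} → a ≤ b → 0# ≤ b - a
  ≤⇒0≤ (inj₁ p) = inj₁ (<⇒0< p)
  ≤⇒0≤ {a} {b} (inj₂ e) = inj₂ (sym (trans (+-congˡ (-‿cong e)) (-‿inverseʳ b)))

  0≤-* : ∀ {a b} → 0# ≤ a → 0# ≤ b → 0# ≤ a * b
  0≤-* (inj₁ p) (inj₁ q) = inj₁ (*-pos p q)
  0≤-* {a} (inj₁ p) (inj₂ e) = inj₂ (sym (trans (*-congˡ (sym e)) (zeroʳ a)))
  0≤-* {b = b} (inj₂ e) q = inj₂ (sym (trans (*-congʳ (sym e)) (zeroˡ b)))

  0<-+≤ : ∀ {a b} → 0# < a → 0# ≤ b → 0# < a + b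
  0<-+≤ p (inj₁ q) = 0<-+ p q
  0<-+≤ {a} p (inj₂ e) = <-respʳ-≈ (trans (sym (+-identityʳ a)) (+-congˡ e)) p

  0<-cancelˡ : ∀ {a b} → 0# < a → 0# < a * b → 0# < b
  0<-cancelˡ {a} {b} p q with <-trichotomy 0# b
  ... | inj₁ r = r
  ... | inj₂ (inj₁ e) = ⊥-elim (<-irrefl (sym (trans (*-congˡ (sym e)) (zeroʳ a))) q)
  ... | inj₂ (inj₂ r) = ⊥-elim (<-irrefl
          (sym (solve 2 (λ a b → a :* b :+ a :* (con (+ 0) :- b) := con (+ 0)) refl a b))
          (0<-+ q (*-pos p (<⇒0< r))))

  0<-neg² : ∀ {a} → a < 0# → 0# < a * a
  0<-neg² {a} p = <-respʳ-≈ (solve 1 (λ a → (con (+ 0) :- a) :* (con (+ 0) :- a) := a :* a) refl a)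
                      (*-pos (<⇒0< p) (<⇒0< p))

  0<-square : ∀ {a} → ¬ (a ≈ 0#) → 0# < a * a
  0<-square {a} h with <-trichotomy 0# a
  ... | inj₁ p = *-pos p p
  ... | inj₂ (inj₁ e) = ⊥-elim (h (sym e))
  ... | inj₂ (inj₂ p) = 0<-neg² p

  -- Total, with a dummy value at zero, so that slopes and cotangents can be written without a side
  -- condition.
  inv : Carrier → Carrier
  inv a with a ≈? 0#
  ... | yes _ = 0#
  ... | no h = proj₁ (inverse a h)

  inv-inverse : ∀ {a} → ¬ (a ≈ 0#) → a * inv a ≈ 1#
  inv-inverse {a} h with a ≈? 0#
  ... | yes e = ⊥-elim (h e)
  ... | no h′ = proj₂ (inverse a h′)

  -- The source of all extremal choices: the next point on a line, the first line met in a rotation,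
  -- the next segment by slope, the first vertex of a wedge.
  minimum : ∀ {A : Set} {P : A → Set} (P? : Decidable P) (key : A → Carrier) (xs : List A) →
            (∀ a → a ∈ xs → ¬ P a) ⊎
            (∃ λ a → a ∈ xs × P a × (∀ b → b ∈ xs → P b → key a ≤ key b))
  minimum P? key [] = inj₁ (λ _ ())
  minimum P? key (a ∷ as) with P? a | minimum P? key as
  ... | no ¬p | inj₁ none = inj₁ (λ { _ (here ≡.refl) → ¬p ; b (there m) → none b m })
  ... | no ¬p | inj₂ (b , m , p , least) =
    inj₂ (b , there m , p , λ { _ (here ≡.refl) q → ⊥-elim (¬p q) ; c (there k) q → least c k q })
  ... | yes p | inj₁ none =
    inj₂ (a , here ≡.refl , p , λ { _ (here ≡.refl) _ → inj₂ refl ; c (there k) q → ⊥-elim (none c k q) })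
  ... | yes p | inj₂ (b , m , q , least) with ≤-total (key a) (key b)
  ...   | inj₁ le = inj₂ (a , here ≡.refl , p ,
            λ { _ (here ≡.refl) _ → inj₂ refl ; c (there k) r → ≤-trans le (least c k r) })
  ...   | inj₂ le = inj₂ (b , there m , q ,
            λ { _ (here ≡.refl) _ → le ; c (there k) r → least c k r })

-- Point sets in general direction and their spanned lines.

module Geometry (ℝ : RealNumbers) where

  open import Data.Nat as ℕ using (ℕ)
  open import Data.Fin as Fin using (Fin)
  import Data.Fin.Properties as Finₚ
  open import Data.Integer using (+_)
  open import Data.List using (List; allFin)
  open import Data.List.Membership.Propositional using (_∈_)
  open import Data.List.Membership.Propositional.Properties using (∈-allFin)
  import Data.List.Relation.Unary.Unique.Propositional.Properties as Uniqueₚ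
  open import Data.Product using (∃; _×_; _,_; proj₁; proj₂)
  open import Data.Sum using (_⊎_; inj₁; inj₂)
  open import Data.Empty using (⊥-elim)
  open import Relation.Nullary using (¬_; Dec; yes; no)
  open import Relation.Nullary.Decidable using (_×-dec_)
  open import Relation.Binary.PropositionalEquality as ≡ using (_≡_; _≢_)
  open Sums
  open Field ℝ
  open Solver using (solve; _:=_; _:+_; _:*_; _:-_; :-_; con)

  -- A point set without vertical spanned lines: each line is y = mx + c, and the order of points
  -- along it is that of first coordinates. By `join`, `two` and `line-inj` the `V` indices
  -- enumerate exactly the spanned lines, each once.
  record Arrangement : Set where
    field
      n V      : ℕ
      x y      : Fin n → Carrier
      x-inj    : ∀ {i j} → x i ≈ x j → i ≡ j
      m c      : Fin V → Carrier
      line-inj : ∀ {L M} → m L ≈ m M → c L ≈ c M → L ≡ M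

    f : Fin V → Carrier → Carrier
    f L t = m L * t + c L

    On : Fin V → Fin n → Set
    On L i = y i ≈ f L (x i)

    field
      join : ∀ i j → i ≢ j → ∃ λ L → On L i × On L j
      two  : ∀ L → ∃ λ i → ∃ λ j → i ≢ j × On L i × On L j

  module ArrangementProperties (𝒜 : Arrangement) where
    open Arrangement 𝒜 public

    Above Below : Fin V → Fin n → Set
    Above L i = f L (x i) < y i
    Below L i = y i < f L (x i)

    On? : ∀ L i → Dec (On L i)
    On? L i = y i ≈? f L (x i)

    side : ∀ L i → Below L i ⊎ (On L i ⊎ Above L i)
    side L i = <-trichotomy (y i) (f L (x i))

    x-apart : ∀ {i j} → i ≢ j → (x i < x j) ⊎ (x j < x i)
    x-apart {i} {j} ne with <-trichotomy (x i) (x j)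
    ... | inj₁ p = inj₁ p
    ... | inj₂ (inj₁ e) = ⊥-elim (ne (x-inj e))
    ... | inj₂ (inj₂ p) = inj₂ p

    x<⇒≢ : ∀ {i j} → x i < x j → i ≢ j
    x<⇒≢ p ≡.refl = <-irrefl refl p

    -- The difference of the two lines is affine and has risen from negative to positive between `s`
    -- and `t`, so it keeps rising.
    overtake-right : ∀ {L M s t u} → f L s < f M s → f M t < f L t → s < t → t ≤ u → f M u < f L u
    overtake-right {L} {M} {s} {t} {u} p q st tu = 0<⇒< (0<-cancelˡ (<⇒0< st) (<-respʳ-≈
      (solve 7 (λ a b a′ b′ s t u →
         (t :- s) :* ((a :* t :+ b) :- (a′ :* t :+ b′))
           :+ (u :- t) :* (((a :* t :+ b) :- (a′ :* t :+ b′)) :+ ((a′ :* s :+ b′) :- (a :* s :+ b)))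
         := (t :- s) :* ((a :* u :+ b) :- (a′ :* u :+ b′))) refl (m L) (c L) (m M) (c M) s t u)
      (0<-+≤ (*-pos (<⇒0< st) (<⇒0< q)) (0≤-* (≤⇒0≤ tu) (inj₁ (0<-+ (<⇒0< q) (<⇒0< p)))))))

    overtake-left : ∀ {L M s t u} → f L s < f M s → f M t < f L t → s < t → u ≤ s → f L u < f M u
    overtake-left {L} {M} {s} {t} {u} p q st us = 0<⇒< (0<-cancelˡ (<⇒0< st) (<-respʳ-≈
      (solve 7 (λ a b a′ b′ s t u →
         (t :- s) :* ((a′ :* s :+ b′) :- (a :* s :+ b))
           :+ (s :- u) :* (((a :* t :+ b) :- (a′ :* t :+ b′)) :+ ((a′ :* s :+ b′) :- (a :* s :+ b)))
         := (t :- s) :* ((a′ :* u :+ b′) :- (a :* u :+ b))) refl (m L) (c L) (m M) (c M) s t u)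
      (0<-+≤ (*-pos (<⇒0< st) (<⇒0< p)) (0≤-* (≤⇒0≤ us) (inj₁ (0<-+ (<⇒0< q) (<⇒0< p)))))))

    private
      spread : ∀ {L M s t} → f L s ≈ f M s → (m M - m L) * (t - s) ≈ f M t - f L t
      spread {L} {M} {s} {t} e = begin
        (m M - m L) * (t - s)
          ≈⟨ solve 6 (λ a b a′ b′ s t → (a′ :- a) :* (t :- s)
               := ((a′ :* t :+ b′) :- (a :* t :+ b)) :+ ((a :* s :+ b) :- (a′ :* s :+ b′)))
               refl (m L) (c L) (m M) (c M) s t ⟩
        (f M t - f L t) + (f L s - f M s)   ≈⟨ +-congˡ (trans (+-congʳ e) (-‿inverseʳ _)) ⟩
        (f M t - f L t) + 0#                ≈⟨ +-identityʳ _ ⟩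
        f M t - f L t                       ∎
        where open import Relation.Binary.Reasoning.Setoid setoid

    steeper-right : ∀ {L M s t} → f L s ≈ f M s → m L < m M → s < t → f L t < f M t
    steeper-right {L} {M} {s} {t} e p q = 0<⇒< (<-respʳ-≈ (spread {L} {M} e) (*-pos (<⇒0< p) (<⇒0< q)))

    steeper-left : ∀ {L M s t} → f L s ≈ f M s → m L < m M → t < s → f M t < f L t
    steeper-left {L} {M} {s} {t} e p q = 0<⇒< (<-respʳ-≈
      (trans (solve 4 (λ a a′ s t → (a′ :- a) :* (s :- t) := :- ((a′ :- a) :* (t :- s))) refl (m L) (m M) s t)
        (trans (-‿cong (spread {L} {M} e)) (solve 2 (λ a b → :- (a :- b) := b :- a) refl (f M t) (f L t))))
      (*-pos (<⇒0< p) (<⇒0< q)))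

    same-slope : ∀ {L M s} → f L s ≈ f M s → m L ≈ m M → L ≡ M
    same-slope {L} {M} {s} e p = line-inj p (begin
      c L                        ≈⟨ solve 3 (λ a b s → b := (a :* s :+ b) :- a :* s) refl (m L) (c L) s ⟩
      f L s - m L * s            ≈⟨ +-cong e (-‿cong (*-congʳ p)) ⟩
      f M s - m M * s            ≈⟨ solve 3 (λ a b s → (a :* s :+ b) :- a :* s := b) refl (m M) (c M) s ⟩
      c M                        ∎)
      where open import Relation.Binary.Reasoning.Setoid setoid

    meet : ∀ {L M i} → On L i → On M i → f L (x i) ≈ f M (x i)
    meet p q = trans (sym p) q

    private
      unique-join< : ∀ {L M i j} → x i < x j → On L i → On L j → On M i → On M j → L ≡ M
      unique-join< {L} {M} i<j Li Lj Mi Mj with <-trichotomy (m L) (m M)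
      ... | inj₁ p = ⊥-elim (<-irrefl (meet {L} {M} Lj Mj) (steeper-right {L} {M} (meet {L} {M} Li Mi) p i<j))
      ... | inj₂ (inj₁ e) = same-slope (meet {L} {M} Li Mi) e
      ... | inj₂ (inj₂ p) = ⊥-elim (<-irrefl (meet {M} {L} Mj Lj) (steeper-right {M} {L} (meet {M} {L} Mi Li) p i<j))

    unique-join : ∀ {L M i j} → i ≢ j → On L i → On L j → On M i → On M j → L ≡ M
    unique-join ne Li Lj Mi Mj with x-apart ne
    ... | inj₁ p = unique-join< p Li Lj Mi Mj
    ... | inj₂ p = unique-join< p Lj Li Mj Mi

    Succ : Fin V → Fin n → Fin n → Set
    Succ L i j = On L i × On L j × x i < x j × (∀ k → On L k → ¬ (x i < x k × x k < x j))

    Succ? : ∀ L i j → Dec (Succ L i j)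
    Succ? L i j = On? L i ×-dec On? L j ×-dec (x i <? x j) ×-dec between?
      where
      between? : Dec (∀ k → On L k → ¬ (x i < x k × x k < x j))
      between? with Finₚ.any? (λ k → On? L k ×-dec (x i <? x k) ×-dec (x k <? x j))
      ... | yes (k , p , q) = no (λ h → h k p q)
      ... | no h = yes (λ k p q → h (k , p , q))

    Succ-uniqueʳ : ∀ {L i j j′} → Succ L i j → Succ L i j′ → j ≡ j′
    Succ-uniqueʳ {j = j} {j′} (_ , q , r , s) (_ , q′ , r′ , s′) with <-trichotomy (x j) (x j′)
    ... | inj₁ p = ⊥-elim (s′ j q (r , p))
    ... | inj₂ (inj₁ e) = x-inj e
    ... | inj₂ (inj₂ p) = ⊥-elim (s j′ q′ (r′ , p))

    Succ-uniqueˡ : ∀ {L i i′ j} → Succ L i j → Succ L i′ j → i ≡ i′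
    Succ-uniqueˡ {i = i} {i′} (q , _ , r , s) (q′ , _ , r′ , s′) with <-trichotomy (x i) (x i′)
    ... | inj₁ p = ⊥-elim (s i′ q′ (p , r′))
    ... | inj₂ (inj₁ e) = x-inj e
    ... | inj₂ (inj₂ p) = ⊥-elim (s′ i q (p , r))

    Last : Fin V → Fin n → Set
    Last L i = On L i × (∀ k → On L k → x k ≤ x i)

    successor : ∀ L i → On L i → (∃ λ j → Succ L i j) ⊎ Last L i
    successor L i p with minimum (λ j → On? L j ×-dec (x i <? x j)) x (allFin n)
    ... | inj₁ none = inj₂ (p , λ k q → ≮⇒≥ (λ r → none k (∈-allFin k) (q , r)))
    ... | inj₂ (j , _ , (q , r) , least) =
      inj₁ (j , p , q , r , λ k u v → ≤⇒≯ (least k (∈-allFin k) (u , proj₁ v)) (proj₂ v))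

    Segment : Set
    Segment = Fin V × Fin n × Fin n

    IsSegment : Segment → Set
    IsSegment (L , i , j) = Succ L i j

    points : List (Fin n)
    points = allFin n

    lines : List (Fin V)
    lines = allFin V

    size : Fin V → ℕ
    size L = ∑[ i ∈ points ] 𝟙 (On? L i)

    -- Only the last point of `L` is not the left end of a segment.
    size≤1+segments : ∀ L → size L ℕ.≤ ℕ.suc (∑[ i ∈ points ] (∑[ j ∈ points ] 𝟙 (Succ? L i j)))
    size≤1+segments L = ℕₚ.≤-trans (∑-mono points step)
      (ℕₚ.≤-trans (ℕₚ.≤-reflexive (∑-+ points _ _)) (ℕₚ.+-monoˡ-≤ _ last≤1))
      where
      import Data.Nat.Properties as ℕₚ
      Last? : ∀ i → Dec (Last L i)
      Last? i = On? L i ×-dec all-left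
        where
        all-left : Dec (∀ k → On L k → x k ≤ x i)
        all-left with Finₚ.any? (λ k → On? L k ×-dec (x i <? x k))
        ... | yes (k , p , q) = no (λ h → ≤⇒≯ (h k p) q)
        ... | no h = yes (λ k p → ≮⇒≥ (λ q → h (k , p , q)))
      step : ∀ i → 𝟙 (On? L i) ℕ.≤ 𝟙 (Last? i) ℕ.+ (∑[ j ∈ points ] 𝟙 (Succ? L i j))
      step i = 𝟙-bound (On? L i) go
        where
        go : On L i → 1 ℕ.≤ 𝟙 (Last? i) ℕ.+ (∑[ j ∈ points ] 𝟙 (Succ? L i j))
        go p with successor L i p
        ... | inj₁ (j , s) = ℕₚ.≤-trans (ℕₚ.≤-reflexive (≡.sym (𝟙-yes (Succ? L i j) s)))
                (ℕₚ.≤-trans (∑-∈ (λ j → 𝟙 (Succ? L i j)) (∈-allFin j)) (ℕₚ.m≤n+m _ (𝟙 (Last? i))))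
        ... | inj₂ l = ℕₚ.≤-trans (ℕₚ.≤-reflexive (≡.sym (𝟙-yes (Last? i) l))) (ℕₚ.m≤m+n _ _)
      last≤1 : ∑[ i ∈ points ] 𝟙 (Last? i) ℕ.≤ 1
      last≤1 = ∑-at-most-one Last? (Uniqueₚ.allFin⁺ n) λ i j _ _ (p , h) (q , g) →
        x-inj (antisym (g i p) (h j q))
        where
        antisym : ∀ {a b} → a ≤ b → b ≤ a → a ≈ b
        antisym (inj₂ e) _ = e
        antisym (inj₁ p) q = ⊥-elim (≤⇒≯ q p)

-- Melchior's inequality by rotating lines.

module Melchior (ℝ : RealNumbers) where

  open import Data.Nat as ℕ using (ℕ)
  import Data.Nat.Properties as ℕₚ
  open import Data.Bool as Bool using (Bool; true; false)
  open import Data.Fin as Fin using (Fin)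
  open import Data.Integer using (+_)
  open import Data.List using (List; []; _∷_; filter; length; cartesianProduct)
  open import Data.List.Properties using (length-tabulate)
  open import Data.List.Membership.Propositional using (_∈_)
  open import Data.List.Membership.Propositional.Properties using (∈-allFin; ∈-filter⁻; ∈-cartesianProduct⁺)
  open import Data.List.Relation.Unary.Any using (here; there)
  open import Data.List.Relation.Unary.Unique.Propositional using (Unique)
  import Data.List.Relation.Unary.Unique.Propositional.Properties as Uniqueₚ
  open import Data.Product using (∃; _×_; _,_; proj₁; proj₂)
  import Data.Product.Properties as Productₚ
  open import Data.Sum using (_⊎_; inj₁; inj₂)
  open import Data.Empty using (⊥; ⊥-elim)
  open import Relation.Nullary using (¬_; yes; no)
  open import Relation.Nullary.Decidable using (_×-dec_; _⊎-dec_; ¬?)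
  open import Relation.Binary.PropositionalEquality as ≡ using (_≡_; _≢_)
  open Sums
  open Field ℝ
  open Solver using (solve; _:=_; _:+_; _:*_; _:-_; :-_; con)
  open Geometry ℝ

  module _ (𝒜 : Arrangement) where
    open ArrangementProperties 𝒜

    segments : List Segment
    segments = filter (λ { (L , i , j) → Succ? L i j })
                 (cartesianProduct lines (cartesianProduct points points))

    segments-unique : Unique segments
    segments-unique = Uniqueₚ.filter⁺ _ (Uniqueₚ.cartesianProduct⁺ (Uniqueₚ.allFin⁺ V)
      (Uniqueₚ.cartesianProduct⁺ (Uniqueₚ.allFin⁺ n) (Uniqueₚ.allFin⁺ n)))

    ∈segments⇒Succ : ∀ {e} → e ∈ segments → IsSegment e
    ∈segments⇒Succ p = proj₂ (∈-filter⁻ (λ { (L , i , j) → Succ? L i j })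
      {xs = cartesianProduct lines (cartesianProduct points points)} p)

    ∑-segments : ∀ (g : Segment → ℕ) → ∑ segments g ≡
      ∑[ L ∈ lines ] (∑[ i ∈ points ] (∑[ j ∈ points ] (𝟙 (Succ? L i j) ℕ.* g (L , i , j))))
    ∑-segments g = ≡.trans (∑-filter _ (cartesianProduct lines (cartesianProduct points points)) g)
      (≡.trans (∑-× lines _ _) (∑-cong lines (λ L → ∑-× points points _)))

    -- The cotangent of the angle from L to M in the affine frame in which L is horizontal.
    cot : Fin V → Fin V → Carrier
    cot L M = inv (m M - m L)

    private
      m-apart : ∀ {L M i} → M ≢ L → On L i → On M i → ¬ (m M - m L ≈ 0#)
      m-apart {L} {M} ne p q e = ne (same-slope {M} {L} (meet {M} {L} q p) (begin
        m M                ≈⟨ solve 2 (λ a b → a := (a :- b) :+ b) refl (m M) (m L) ⟩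
        (m M - m L) + m L  ≈⟨ +-congʳ e ⟩
        0# + m L           ≈⟨ +-identityˡ _ ⟩
        m L                ∎))
        where open import Relation.Binary.Reasoning.Setoid setoid

      height : Fin V → Fin n → Carrier
      height L k = y k - f L (x k)

      -- In the frame with `L` horizontal, a point of `M` at height h lies h · cot to the right of
      -- the point where `M` meets `L`. This turns comparisons of cotangents into comparisons of
      -- first coordinates.
      height*cot : ∀ {L M i k} → M ≢ L → On L i → On M i → On M k →
                   height L k * cot L M ≈ x k - x i
      height*cot {L} {M} {i} {k} ne p q r = begin
        (y k - f L (x k)) * κ                           ≈⟨ *-congʳ (+-congʳ r) ⟩
        (f M (x k) - f L (x k)) * κ
          ≈⟨ solve 7 (λ a b a′ b′ s t κ → ((a′ :* t :+ b′) :- (a :* t :+ b)) :* κ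
               := (t :- s) :* ((a′ :- a) :* κ) :+ ((a′ :* s :+ b′) :- (a :* s :+ b)) :* κ)
               refl (m L) (c L) (m M) (c M) (x i) (x k) κ ⟩
        (x k - x i) * ((m M - m L) * κ) + (f M (x i) - f L (x i)) * κ
          ≈⟨ +-cong (*-congˡ (inv-inverse (m-apart {L} {M} ne p q)))
                    (*-congʳ (trans (+-congʳ (meet {M} {L} q p)) (-‿inverseʳ _))) ⟩
        (x k - x i) * 1# + 0# * κ                       ≈⟨ +-cong (*-identityʳ _) (zeroˡ κ) ⟩
        (x k - x i) + 0#                                ≈⟨ +-identityʳ _ ⟩
        x k - x i                                       ∎
        where
        open import Relation.Binary.Reasoning.Setoid setoid
        κ : Carrier
        κ = cot L M

      Through : Fin V → Fin n → Fin n → Fin V → Set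
      Through L i j M = M ≢ L × (On M i ⊎ On M j)

      -- The largest cotangent belongs to the smallest angle in (0, π) from `L`, so `w` is the first
      -- line met when `L` turns about both points.
      Steepest : Fin V → Fin n → Fin n → Fin V → Set
      Steepest L i j w = ∀ M → Through L i j M → cot L M ≤ cot L w

      -- A point of w on the wrong side of L would span a steeper line with the other end of ij.
      apex-left : ∀ {L i j w} → On L i → On L j → x i < x j → w ≢ L → On w i → Steepest L i j w →
                  ∀ k → On w k → k ≢ i → Above L k
      apex-left {L} {i} {j} {w} Li Lj i<j ne wi top k wk k≢i with side L k
      ... | inj₂ (inj₂ above) = above
      ... | inj₂ (inj₁ on) = ⊥-elim (ne (unique-join k≢i wk wi on Li))
      ... | inj₁ below with join k j (λ { ≡.refl → <-irrefl Lj below })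
      ...   | M , Mk , Mj = ⊥-elim (≤⇒≯ (top M (M≢L , inj₂ Mj)) worse)
        where
        M≢L : M ≢ L
        M≢L ≡.refl = <-irrefl Mk below
        worse : cot L w < cot L M
        worse = 0<⇒< (0<-cancelˡ (<⇒0< below) (<-respʳ-≈ (begin
          x j - x i
            ≈⟨ solve 3 (λ i j k → j :- i := (k :- i) :- (k :- j)) refl (x i) (x j) (x k) ⟩
          (x k - x i) - (x k - x j)
            ≈⟨ +-cong (sym (height*cot ne Li wi wk)) (-‿cong (sym (height*cot M≢L Lj Mj Mk))) ⟩
          height L k * cot L w - height L k * cot L M
            ≈⟨ solve 4 (λ a b u v → (a :- b) :* u :- (a :- b) :* v := (b :- a) :* (v :- u))
                 refl (y k) (f L (x k)) (cot L w) (cot L M) ⟩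
          (f L (x k) - y k) * (cot L M - cot L w) ∎) (<⇒0< i<j)))
          where open import Relation.Binary.Reasoning.Setoid setoid

      -- Mirror image of `apex-left`: to reach the same positive height over `L`, a line from `i`
      -- runs further to the right than one from `j`, so its cotangent is larger.
      apex-right : ∀ {L i j w} → On L i → On L j → x i < x j → w ≢ L → On w j → Steepest L i j w →
                   ∀ k → On w k → k ≢ j → Below L k
      apex-right {L} {i} {j} {w} Li Lj i<j ne wj top k wk k≢j with side L k
      ... | inj₁ below = below
      ... | inj₂ (inj₁ on) = ⊥-elim (ne (unique-join k≢j wk wj on Lj))
      ... | inj₂ (inj₂ above) with join k i (λ { ≡.refl → <-irrefl (sym Li) above })
      ...   | M , Mk , Mi = ⊥-elim (≤⇒≯ (top M (M≢L , inj₁ Mi)) worse)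
        where
        M≢L : M ≢ L
        M≢L ≡.refl = <-irrefl (sym Mk) above
        worse : cot L w < cot L M
        worse = 0<⇒< (0<-cancelˡ (<⇒0< above) (<-respʳ-≈ (begin
          x j - x i
            ≈⟨ solve 3 (λ i j k → j :- i := (k :- i) :- (k :- j)) refl (x i) (x j) (x k) ⟩
          (x k - x i) - (x k - x j)
            ≈⟨ +-cong (sym (height*cot M≢L Li Mi Mk)) (-‿cong (sym (height*cot ne Lj wj wk))) ⟩
          height L k * cot L M - height L k * cot L w
            ≈⟨ solve 3 (λ h u v → h :* v :- h :* u := h :* (v :- u))
                 refl (height L k) (cot L w) (cot L M) ⟩
          (y k - f L (x k)) * (cot L M - cot L w) ∎) (<⇒0< i<j)))
          where open import Relation.Binary.Reasoning.Setoid setoid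

      End : Bool → Fin V → Fin n → Set
      End true w z = On w z × (∀ k → On w k → k ≢ z → x z < x k)
      End false w z = On w z × (∀ k → On w k → k ≢ z → x k < x z)

      End-On : ∀ s {w z} → End s w z → On w z
      End-On true = proj₁
      End-On false = proj₁

      End-unique : ∀ s {w z z′} → End s w z → End s w z′ → z ≡ z′
      End-unique s {z = z} {z′} p q with z Fin.≟ z′
      ... | yes e = e
      End-unique true (p , h) (q , g) | no ne = ⊥-elim (<-asym (h _ q (λ e → ne (≡.sym e))) (g _ p ne))
      End-unique false (p , h) (q , g) | no ne = ⊥-elim (<-asym (h _ q (λ e → ne (≡.sym e))) (g _ p ne))

      Apex : Segment → Fin V → Fin n → Set
      Apex (L , i , j) w z = (z ≡ i × (∀ k → On w k → k ≢ z → Above L k))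
                           ⊎ (z ≡ j × (∀ k → On w k → k ≢ z → Below L k))

      Apex-On : ∀ {L i j w z} → Succ L i j → Apex (L , i , j) w z → On L z
      Apex-On (p , _) (inj₁ (≡.refl , _)) = p
      Apex-On (_ , p , _) (inj₂ (≡.refl , _)) = p

      -- A target is one of the two ends of a line. These 2V targets, and one more per line since
      -- `size` exceeds the number of segments by one, give the 3V of Melchior's inequality.
      Charge : Segment → Fin V × Bool → Set
      Charge (L , i , j) (w , s) =
        w ≢ L × Steepest L i j w × (∃ λ z → End s w z × Apex (L , i , j) w z)

      -- The line `w` crosses `L` only in `z`, so its points above `L` all lie on one side of `z`:
      -- to the right if `w` has the larger slope, to the left otherwise.
      end-above : ∀ {L w z} → w ≢ L → On L z → On w z → (∀ k → On w k → k ≢ z → Above L k) →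
                  ∃ λ s → End s w z
      end-above {L} {w} {z} ne Lz wz h with <-trichotomy (m L) (m w)
      ... | inj₂ (inj₁ e) = ⊥-elim (ne (≡.sym (same-slope {L} {w} (meet {L} {w} Lz wz) e)))
      ... | inj₁ p = true , wz , λ k wk k≢z → case k wk k≢z (x-apart k≢z)
        where
        case : ∀ k → On w k → k ≢ z → (x k < x z) ⊎ (x z < x k) → x z < x k
        case k wk k≢z (inj₂ q) = q
        case k wk k≢z (inj₁ q) = ⊥-elim (<-asym (h k wk k≢z)
          (<-respˡ-≈ (sym wk) (steeper-left {L} {w} (meet {L} {w} Lz wz) p q)))
      ... | inj₂ (inj₂ p) = false , wz , λ k wk k≢z → case k wk k≢z (x-apart k≢z)
        where
        case : ∀ k → On w k → k ≢ z → (x k < x z) ⊎ (x z < x k) → x k < x z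
        case k wk k≢z (inj₁ q) = q
        case k wk k≢z (inj₂ q) = ⊥-elim (<-asym (h k wk k≢z)
          (<-respˡ-≈ (sym wk) (steeper-right {w} {L} (meet {w} {L} wz Lz) p q)))

      end-below : ∀ {L w z} → w ≢ L → On L z → On w z → (∀ k → On w k → k ≢ z → Below L k) →
                  ∃ λ s → End s w z
      end-below {L} {w} {z} ne Lz wz h with <-trichotomy (m L) (m w)
      ... | inj₂ (inj₁ e) = ⊥-elim (ne (≡.sym (same-slope {L} {w} (meet {L} {w} Lz wz) e)))
      ... | inj₁ p = false , wz , λ k wk k≢z → case k wk k≢z (x-apart k≢z)
        where
        case : ∀ k → On w k → k ≢ z → (x k < x z) ⊎ (x z < x k) → x k < x z
        case k wk k≢z (inj₁ q) = q
        case k wk k≢z (inj₂ q) = ⊥-elim (<-asym (h k wk k≢z)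
          (<-respʳ-≈ (sym wk) (steeper-right {L} {w} (meet {L} {w} Lz wz) p q)))
      ... | inj₂ (inj₂ p) = true , wz , λ k wk k≢z → case k wk k≢z (x-apart k≢z)
        where
        case : ∀ k → On w k → k ≢ z → (x k < x z) ⊎ (x z < x k) → x z < x k
        case k wk k≢z (inj₂ q) = q
        case k wk k≢z (inj₁ q) = ⊥-elim (<-asym (h k wk k≢z)
          (<-respʳ-≈ (sym wk) (steeper-left {w} {L} (meet {w} {L} wz Lz) p q)))

      other : ∀ w z → ∃ λ k → On w k × k ≢ z
      other w z with two w
      ... | i , j , ne , p , q with i Fin.≟ z
      ...   | yes ≡.refl = j , q , λ e → ne (≡.sym e)
      ...   | no i≢z = i , p , i≢z

      -- Both lines being steepest would make a product of two nonnegative numbers equal to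
      -- − (1 / (m M − m L))².
      rotation : ∀ {L M w z} → M ≢ L → w ≢ L → w ≢ M → On L z → On M z → On w z →
                 cot L M ≤ cot L w → cot M L ≤ cot M w → ⊥
      rotation {L} {M} {w} {z} ML wL wM Lz Mz wz h g = ≤⇒≯ nonneg neg
        where
        open import Relation.Binary.Reasoning.Setoid setoid
        p p′ r r′ : Carrier
        p = cot L w
        p′ = cot M w
        r = cot L M
        r′ = cot M L
        ep : (m w - m L) * p ≈ 1#
        ep = inv-inverse (m-apart {L} {w} wL Lz wz)
        ep′ : (m w - m M) * p′ ≈ 1#
        ep′ = inv-inverse (m-apart {M} {w} wM Mz wz)
        er : (m M - m L) * r ≈ 1#
        er = inv-inverse (m-apart {L} {M} ML Lz Mz)
        er′ : (m L - m M) * r′ ≈ 1#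
        er′ = inv-inverse (m-apart {M} {L} (λ e → ML (≡.sym e)) Mz Lz)
        nonneg : 0# ≤ (p - r) * (p′ - r′)
        nonneg = 0≤-* (≤⇒0≤ h) (≤⇒0≤ g)
        r≉0 : ¬ (r ≈ 0#)
        r≉0 e = <-irrefl (sym (trans (sym er) (trans (*-congˡ e) (zeroʳ _)))) 0<1
        r′≈-r : r′ ≈ - r
        r′≈-r = begin
          r′                          ≈⟨ sym (*-identityˡ r′) ⟩
          1# * r′                     ≈⟨ *-congʳ (sym er) ⟩
          (m M - m L) * r * r′
            ≈⟨ solve 4 (λ a b r r′ → (a :- b) :* r :* r′ := :- (((b :- a) :* r′) :* r)) refl (m M) (m L) r r′ ⟩
          - ((m L - m M) * r′ * r)    ≈⟨ -‿cong (trans (*-congʳ er′) (*-identityˡ r)) ⟩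
          - r                         ∎
        expand : ∀ a b c p r → a * p ≈ 1# → b * r ≈ 1# → c ≈ a - b → p - r ≈ - (p * r * c)
        expand a b c p r ea eb ec = begin
          p - r                        ≈⟨ +-cong (sym (*-identityˡ p)) (-‿cong (sym (*-identityˡ r))) ⟩
          1# * p - 1# * r              ≈⟨ +-cong (*-congʳ (sym eb)) (-‿cong (*-congʳ (sym ea))) ⟩
          b * r * p - a * p * r        ≈⟨ solve 4 (λ a b p r → b :* r :* p :- a :* p :* r := :- (p :* r :* (a :- b))) refl a b p r ⟩
          - (p * r * (a - b))          ≈⟨ -‿cong (*-congˡ (sym ec)) ⟩
          - (p * r * c)                ∎
        product : (p - r) * (p′ - r′) ≈ - (r * r)
        product = begin
          (p - r) * (p′ - r′)
            ≈⟨ *-cong (expand _ _ (m w - m M) p r ep er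
                         (solve 3 (λ w l k → w :- k := (w :- l) :- (k :- l)) refl (m w) (m L) (m M)))
                      (expand _ _ (m w - m L) p′ r′ ep′ er′
                         (solve 3 (λ w l k → w :- l := (w :- k) :- (l :- k)) refl (m w) (m L) (m M))) ⟩
          - (p * r * (m w - m M)) * - (p′ * r′ * (m w - m L))
            ≈⟨ solve 6 (λ p r p′ r′ s s′ → :- (p :* r :* s′) :* :- (p′ :* r′ :* s)
                 := (s :* p) :* ((s′ :* p′) :* (r :* r′))) refl p r p′ r′ (m w - m L) (m w - m M) ⟩
          ((m w - m L) * p) * (((m w - m M) * p′) * (r * r′))
            ≈⟨ trans (*-congʳ ep) (trans (*-identityˡ _) (trans (*-congʳ ep′) (*-identityˡ _))) ⟩
          r * r′                       ≈⟨ *-congˡ r′≈-r ⟩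
          r * - r                      ≈⟨ solve 1 (λ r → r :* (:- r) := :- (r :* r)) refl r ⟩
          - (r * r)                    ∎
        neg : (p - r) * (p′ - r′) < 0#
        neg = 0<⇒< (<-respʳ-≈ (trans (solve 1 (λ s → s := con (+ 0) :- (:- s)) refl (r * r))
                (+-congˡ (-‿cong (sym product)))) (0<-square r≉0))

      -- The end of `w` determines the apex `z`. If `L` and `L′` differ, both pass through `z`, so
      -- each was a candidate in the rotation of the other, and `rotation` refutes this. If they
      -- agree, the side of `L` that holds the rest of `w` tells whether `z` is the left or the
      -- right end of the segment.
      Charge-injective : ∀ {e e′ t} → IsSegment e → IsSegment e′ → Charge e t → Charge e′ t → e ≡ e′
      Charge-injective {L , i , j} {L′ , i′ , j′} {w , s} S S′
          (wL , top , z , E , A) (wL′ , top′ , z′ , E′ , A′)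
        with End-unique s E E′
      ... | ≡.refl with L Fin.≟ L′
      Charge-injective {L , i , j} {_ , i′ , j′} {w , s} S S′
          (wL , top , z , E , A) (wL′ , top′ , z′ , E′ , A′) | ≡.refl | yes ≡.refl
        with A | A′
      ... | inj₁ (≡.refl , _) | inj₁ (≡.refl , _) = ≡.cong (λ k → L , i , k) (Succ-uniqueʳ {L} S S′)
      ... | inj₂ (≡.refl , _) | inj₂ (≡.refl , _) = ≡.cong (λ k → L , k , j) (Succ-uniqueˡ {L} S S′)
      ... | inj₁ (_ , h) | inj₂ (_ , g) with other w z
      ...   | k , p , ne = ⊥-elim (<-asym (h k p ne) (g k p ne))
      Charge-injective {L , i , j} {_ , i′ , j′} {w , s} S S′
          (wL , top , z , E , A) (wL′ , top′ , z′ , E′ , A′) | ≡.refl | yes ≡.refl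
          | inj₂ (_ , h) | inj₁ (_ , g) with other w z
      ...   | k , p , ne = ⊥-elim (<-asym (h k p ne) (g k p ne))
      Charge-injective {L , i , j} {L′ , i′ , j′} {w , s} S S′
          (wL , top , z , E , A) (wL′ , top′ , z′ , E′ , A′) | ≡.refl | no ne =
        ⊥-elim (rotation (λ e → ne (≡.sym e)) wL wL′ Lz L′z (End-On s E)
          (top L′ ((λ e → ne (≡.sym e)) , through A L′z)) (top′ L (ne , through A′ Lz)))
        where
        Lz : On L z
        Lz = Apex-On {L} {i} {j} {w} S A
        L′z : On L′ z
        L′z = Apex-On {L′} {i′} {j′} {w} S′ A′
        through : ∀ {K a b M} → Apex (K , a , b) w z → On M z → On M a ⊎ On M b
        through (inj₁ (≡.refl , _)) p = inj₁ p
        through (inj₂ (≡.refl , _)) p = inj₂ p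

    module _ (noncollinear : ∀ L → ∃ λ k → ¬ On L k) where

      private
        Charge-total : ∀ e → IsSegment e → ∃ (Charge e)
        Charge-total (L , i , j) (Li , Lj , i<j , _)
          with minimum (λ M → ¬? (M Fin.≟ L) ×-dec (On? M i ⊎-dec On? M j)) (λ M → - cot L M) lines
        ... | inj₁ none with noncollinear L
        ...   | k , off with join i k (λ { ≡.refl → off Li })
        ...     | M , Mi , Mk = ⊥-elim (none M (∈-allFin M) ((λ { ≡.refl → off Mk }) , inj₁ Mi))
        Charge-total (L , i , j) (Li , Lj , i<j , _) | inj₂ (w , _ , (ne , on) , least) = charge on
          where
          top : Steepest L i j w
          top M t = ≮⇒≥ (λ p → ≤⇒≯ (least M (∈-allFin M) t) (0<⇒< (<-respʳ-≈
            (solve 2 (λ a b → a :- b := :- b :- :- a) refl (cot L M) (cot L w)) (<⇒0< p))))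
          charge : On w i ⊎ On w j → ∃ (Charge (L , i , j))
          charge (inj₁ wi) with end-above ne Li wi (apex-left Li Lj i<j ne wi top)
          ... | s , E = (w , s) , ne , top , i , E , inj₁ (≡.refl , apex-left Li Lj i<j ne wi top)
          charge (inj₂ wj) with end-below ne Lj wj (apex-right Li Lj i<j ne wj top)
          ... | s , E = (w , s) , ne , top , j , E , inj₂ (≡.refl , apex-right Li Lj i<j ne wj top)

      melchior : ∑[ L ∈ lines ] size L ℕ.≤ 3 ℕ.* V
      melchior = begin
        ∑[ L ∈ lines ] size L                       ≤⟨ ∑-mono lines size≤1+segments ⟩
        ∑[ L ∈ lines ] (1 ℕ.+ count L)              ≡⟨ ∑-+ lines (λ _ → 1) count ⟩
        (∑[ L ∈ lines ] 1) ℕ.+ ∑ lines count        ≡⟨ ≡.cong₂ ℕ._+_ lines-1 count≡ ⟩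
        V ℕ.+ length segments                       ≤⟨ ℕₚ.+-monoʳ-≤ V charged ⟩
        V ℕ.+ 2 ℕ.* V                               ∎
        where
        open ℕₚ.≤-Reasoning
        count : Fin V → ℕ
        count L = ∑[ i ∈ points ] (∑[ j ∈ points ] 𝟙 (Succ? L i j))
        lines-1 : ∑[ L ∈ lines ] 1 ≡ V
        lines-1 = ≡.trans (∑-const lines 1) (≡.trans (ℕₚ.*-identityʳ _) (length-tabulate (λ (L : Fin V) → L)))
        count≡ : ∑ lines count ≡ length segments
        count≡ = ≡.sym (≡.trans (≡.sym (≡.trans (∑-const segments 1) (ℕₚ.*-identityʳ _)))
          (≡.trans (∑-segments (λ _ → 1)) (∑-cong lines (λ L → ∑-cong points (λ i → ∑-cong points (λ j →
            ℕₚ.*-identityʳ _))))))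
        ends : List (Fin V × Bool)
        ends = cartesianProduct lines (true ∷ false ∷ [])
        bool∈ : ∀ b → b ∈ true ∷ false ∷ []
        bool∈ true = here ≡.refl
        bool∈ false = there (here ≡.refl)
        charged : length segments ℕ.≤ 2 ℕ.* V
        charged = begin
          length segments
            ≤⟨ charging (Productₚ.≡-dec Fin._≟_ Bool._≟_) {R = Charge} ends (λ _ → 1) segments-unique
                 (λ e p → Charge-total e (∈segments⇒Succ p))
                 (λ e e′ t p p′ → Charge-injective (∈segments⇒Succ p) (∈segments⇒Succ p′))
                 (λ { e (w , s) _ _ → ∈-cartesianProduct⁺ (∈-allFin w) (bool∈ s) , ℕₚ.≤-refl }) ⟩
          ∑[ t ∈ ends ] 1             ≡⟨ ∑-× lines _ _ ⟩
          ∑[ L ∈ lines ] 2            ≡⟨ ∑-const lines 2 ⟩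
          length lines ℕ.* 2          ≡⟨ ≡.cong (ℕ._* 2) (length-tabulate (λ (L : Fin V) → L)) ⟩
          V ℕ.* 2                     ≡⟨ ℕₚ.*-comm V 2 ⟩
          2 ℕ.* V                     ∎

-- Plane straight-line graphs have at most three edges per vertex.

module Planar (ℝ : RealNumbers) where

  open import Data.Nat as ℕ using (ℕ)
  import Data.Nat.Properties as ℕₚ
  open import Data.Fin as Fin using (Fin; zero; suc)
  open import Data.List using (List; length; allFin; cartesianProduct)
  open import Data.List.Membership.Propositional using (_∈_)
  open import Data.List.Membership.Propositional.Properties using (∈-allFin; ∈-cartesianProduct⁺)
  open import Data.List.Relation.Unary.Unique.Propositional using (Unique)
  open import Data.Product using (∃; _×_; _,_; proj₁; proj₂; swap)
  import Data.Product.Properties as Productₚ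
  open import Data.Sum using (_⊎_; inj₁; inj₂)
  open import Data.Empty using (⊥; ⊥-elim)
  open import Relation.Nullary using (¬_; Dec; yes; no)
  open import Relation.Nullary.Decidable using (_×-dec_; _⊎-dec_; ¬?)
  open import Relation.Binary.PropositionalEquality as ≡ using (_≡_)
  open Sums
  open Field ℝ
  open Geometry ℝ

  module _ (𝒜 : Arrangement) where
    open ArrangementProperties 𝒜

    Separates : Fin V → Fin n → Fin n → Set
    Separates M i j = (Above M i × Below M j) ⊎ (Below M i × Above M j)

    Separates? : ∀ M i j → Dec (Separates M i j)
    Separates? M i j = ((f M (x i) <? y i) ×-dec (y j <? f M (x j)))
                 ⊎-dec ((y i <? f M (x i)) ×-dec (f M (x j) <? y j))

    -- Proper crossing: as separation is strict, segments that share an end do not cross.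
    Cross : Segment → Segment → Set
    Cross (L , i , j) (M , k , l) = Separates M i j × Separates L k l

    Cross? : ∀ e e′ → Dec (Cross e e′)
    Cross? (L , i , j) (M , k , l) = Separates? M i j ×-dec Separates? L k l

    Cross-sym : ∀ e e′ → Cross e e′ → Cross e′ e
    Cross-sym _ _ = swap

    Separates-¬On : ∀ {M i j} → Separates M i j → ¬ On M i × ¬ On M j
    Separates-¬On (inj₁ (a , b)) = (λ p → <-irrefl (sym p) a) , (λ p → <-irrefl p b)
    Separates-¬On (inj₂ (a , b)) = (λ p → <-irrefl p a) , (λ p → <-irrefl (sym p) b)

    Cross-irrefl : ∀ {e} → IsSegment e → ¬ Cross e e
    Cross-irrefl {L , i , j} (p , _) (s , _) = proj₁ (Separates-¬On {L} {i} {j} s) p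

    -- The lines change order between `s` and `t`, and both segments reach over this interval. An
    -- affine difference changes sign only once, so the order at the outer ends is the one at `s`
    -- and at `t`.
    overtaking⇒Cross : ∀ {L i j M k l s t} → IsSegment (L , i , j) → IsSegment (M , k , l) →
                       s < t → x i ≤ s → x k ≤ s → t ≤ x j → t ≤ x l →
                       f L s < f M s → f M t < f L t → Cross (L , i , j) (M , k , l)
    overtaking⇒Cross {L} {i} {j} {M} {k} {l} (Li , Lj , _) (Mk , Ml , _) st is ks tj tl p q =
      inj₂ ( <-respˡ-≈ (sym Li) (overtake-left {L} {M} p q st is)
           , <-respʳ-≈ (sym Lj) (overtake-right {L} {M} p q st tj)) ,
      inj₁ ( <-respʳ-≈ (sym Mk) (overtake-left {L} {M} p q st ks)
           , <-respˡ-≈ (sym Ml) (overtake-right {L} {M} p q st tl))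

    module _ {Q : Fin n → Set} (Q? : ∀ i → Dec (Q i)) {K : List Segment}
             (unique : Unique K)
             (segment : ∀ {e} → e ∈ K → IsSegment e)
             (ends : ∀ {L i j} → (L , i , j) ∈ K → Q i × Q j)
             (planar : ∀ {e e′} → e ∈ K → e′ ∈ K → ¬ Cross e e′) where

      private
        -- The two sides belong to the wedge, so the nearer of the right ends `j` and `l` lies in
        -- it: a wedge always contains a vertex.
        record InWedge (L M : Fin V) (v j l w : Fin n) : Set where
          constructor inWedge
          field
            sampled  : Q w
            right    : x v < x w
            before-j : x w ≤ x j
            before-l : x w ≤ x l
            over     : f L (x w) ≤ y w
            under    : y w ≤ f M (x w)

        InWedge? : ∀ L M v j l w → Dec (InWedge L M v j l w)
        InWedge? L M v j l w with Q? w ×-dec (x v <? x w) ×-dec (¬? (x j <? x w)) ×-dec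
                                  (¬? (x l <? x w)) ×-dec (¬? (y w <? f L (x w))) ×-dec ¬? (f M (x w) <? y w)
        ... | yes (a , b , c , d , e , g) = yes (inWedge a b (≮⇒≥ c) (≮⇒≥ d) (≮⇒≥ e) (≮⇒≥ g))
        ... | no h = no (λ { (inWedge a b c d e g) →
                h (a , b , ≤⇒≯ c , ≤⇒≯ d , ≤⇒≯ e , ≤⇒≯ g) })

        -- A vertical line sweeping rightwards from the apex `v` meets `w` first, and `next` says
        -- that no segment of `K` starting in `v` divides the wedge.
        record Wedge (L M : Fin V) (v j l w : Fin n) : Set where
          field
            lower∈  : (L , v , j) ∈ K
            upper∈  : (M , v , l) ∈ K
            steeper : m L < m M
            next    : ∀ {N k} → (N , v , k) ∈ K → m L < m N → m M ≤ m N
            inside  : InWedge L M v j l w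
            first   : ∀ {u} → InWedge L M v j l u → x w ≤ x u
          open InWedge inside public

          lower : Succ L v j
          lower = segment lower∈
          upper : Succ M v l
          upper = segment upper∈
          apex-meet : f L (x v) ≈ f M (x v)
          apex-meet = meet {L} {M} (proj₁ lower) (proj₁ upper)
          open-at : ∀ {u} → x v < x u → f L (x u) < f M (x u)
          open-at = steeper-right {L} {M} apex-meet steeper

        -- The last hypothesis encodes, here and in the wedge lemmas below, that just left of `w`
        -- the line `N` runs strictly above `L`: either `w` itself is above `L`, or `N` meets `L` in
        -- `w` with the smaller slope.
        above-slope : ∀ {L N v w} → On L v → On N v → On N w → x v < x w → f L (x w) ≤ y w →
                      (f L (x w) < y w) ⊎ (m N < m L) → m L < m N
        above-slope {L} {N} Lv Nv Nw v<w over at with <-trichotomy (m L) (m N)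
        ... | inj₁ p = p
        ... | inj₂ (inj₂ p) = ⊥-elim (≤⇒≯ over (<-respˡ-≈ (sym Nw) (steeper-right {N} {L} (meet {N} {L} Nv Lv) p v<w)))
        ... | inj₂ (inj₁ p) with same-slope {L} {N} (meet {L} {N} Lv Nv) p | at
        ...   | ≡.refl | inj₁ q = ⊥-elim (<-irrefl (sym Nw) q)
        ...   | ≡.refl | inj₂ q = ⊥-elim (<-irrefl refl q)

        below-slope : ∀ {M N v w} → On M v → On N v → On N w → x v < x w → y w ≤ f M (x w) →
                      (y w < f M (x w)) ⊎ (m M < m N) → m N < m M
        below-slope {M} {N} Mv Nv Nw v<w under at with <-trichotomy (m N) (m M)
        ... | inj₁ p = p
        ... | inj₂ (inj₂ p) = ⊥-elim (≤⇒≯ under (<-respʳ-≈ (sym Nw) (steeper-right {M} {N} (meet {M} {N} Mv Nv) p v<w)))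
        ... | inj₂ (inj₁ p) with same-slope {N} {M} (meet {N} {M} Nv Mv) p | at
        ...   | ≡.refl | inj₁ q = ⊥-elim (<-irrefl Nw q)
        ...   | ≡.refl | inj₂ q = ⊥-elim (<-irrefl refl q)

        -- Such a segment from the apex would have a slope strictly between those of `L` and `M`,
        -- against `next`.
        wedge-closed-apex : ∀ {L M v j l w N} → Wedge L M v j l w → (N , v , w) ∈ K →
                            (f L (x w) < y w) ⊎ (m N < m L) → (y w < f M (x w)) ⊎ (m M < m N) → ⊥
        wedge-closed-apex W g∈ atL atM with segment g∈
        ... | Nv , Nw , _ = ≤⇒≯ (next g∈ (above-slope (proj₁ lower) Nv Nw right over atL))
                                 (below-slope (proj₁ upper) Nv Nw right under atM)
          where open Wedge W

        -- A segment reaching w from within the wedge would either start in the wedge before w or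
        -- cross one of its sides.
        wedge-closed : ∀ {L M v j l w N v′} → Wedge L M v j l w → (N , v′ , w) ∈ K →
                       (f L (x w) < y w) ⊎ (m N < m L) → (y w < f M (x w)) ⊎ (m M < m N) → ⊥
        wedge-closed {L} {M} {v} {j} {l} {w} {N} {v′} W g∈ atL atM = go (<-trichotomy (x v) (x v′))
          where
          open Wedge W
          g : Succ N v′ w
          g = segment g∈
          Nw : On N w
          Nw = proj₁ (proj₂ g)
          v′<w : x v′ < x w
          v′<w = proj₁ (proj₂ (proj₂ g))

          escape-up : ∀ {t} → t < x w → x v ≤ t → x v′ ≤ t → ¬ (f M t < f N t)
          escape-up {t} tw vt v′t p = planar upper∈ g∈
            (overtaking⇒Cross {M} {v} {l} {N} {v′} {w} upper g tw vt v′t before-l (inj₂ refl) p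
              (<-respˡ-≈ Nw (strict under atM)))
            where
            strict : y w ≤ f M (x w) → (y w < f M (x w)) ⊎ (m M < m N) → y w < f M (x w)
            strict (inj₁ q) _ = q
            strict (inj₂ _) (inj₁ q) = q
            strict (inj₂ e) (inj₂ q) = ⊥-elim (<-asym p (steeper-left {M} {N} (meet {M} {N} e Nw) q tw))

          escape-down : ∀ {t} → t < x w → x v ≤ t → x v′ ≤ t → ¬ (f N t < f L t)
          escape-down {t} tw vt v′t p = planar g∈ lower∈
            (overtaking⇒Cross {N} {v′} {w} {L} {v} {j} g lower tw v′t vt (inj₂ refl) before-j p
              (<-respʳ-≈ Nw (strict over atL)))
            where
            strict : f L (x w) ≤ y w → (f L (x w) < y w) ⊎ (m N < m L) → f L (x w) < y w
            strict (inj₁ q) _ = q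
            strict (inj₂ _) (inj₁ q) = q
            strict (inj₂ e) (inj₂ q) = ⊥-elim (<-asym p (steeper-left {N} {L} (meet {N} {L} Nw (sym e)) q tw))

          go : (x v < x v′) ⊎ ((x v ≈ x v′) ⊎ (x v′ < x v)) → ⊥
          go (inj₁ p) with y v′ <? f L (x v′) | f M (x v′) <? y v′
          ... | yes q | _ = escape-down v′<w (inj₁ p) (inj₂ refl) (<-respˡ-≈ (proj₁ g) q)
          ... | no _ | yes q = escape-up v′<w (inj₁ p) (inj₂ refl) (<-respʳ-≈ (proj₁ g) q)
          ... | no q | no r = ≤⇒≯ (first (inWedge (proj₁ (ends g∈)) p (inj₁ (<-≤-trans v′<w before-j))
                  (inj₁ (<-≤-trans v′<w before-l)) (≮⇒≥ q) (≮⇒≥ r))) v′<w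
          -- A segment that starts left of the apex passes above or below `v`, and then crosses a
          -- side to reach `w`. It cannot pass through `v`, as its ends are consecutive points of
          -- `N`.
          go (inj₂ (inj₂ p)) with side N v
          ... | inj₁ q = escape-up right (inj₂ refl) (inj₁ p) (<-respˡ-≈ (proj₁ upper) q)
          ... | inj₂ (inj₁ q) = proj₂ (proj₂ (proj₂ g)) v q (p , right)
          ... | inj₂ (inj₂ q) = escape-down right (inj₂ refl) (inj₁ p) (<-respʳ-≈ (proj₁ lower) q)
          go (inj₂ (inj₁ e)) = wedge-closed-apex W (≡.subst (λ u → (N , u , w) ∈ K) (≡.sym (x-inj e)) g∈) atL atM

        Strict : Fin V → Fin V → Fin n → Set
        Strict L M w = (f L (x w) < y w) × (y w < f M (x w))

        -- Every segment is charged to its left end if it is the steepest one there, and otherwise to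
        -- the first vertex of the wedge it forms with the next steeper segment.
        Charge : Segment → Fin n × Fin 3 → Set
        Charge (L , v , j) (w , zero) = w ≡ v × (∀ {N k} → (N , v , k) ∈ K → ¬ (m L < m N))
        Charge (L , v , j) (w , suc zero) =
          ∃ λ M → ∃ λ l → Wedge L M v j l w × (w ≡ j ⊎ Strict L M w)
        Charge (L , v , j) (w , suc (suc zero)) =
          ∃ λ M → ∃ λ l → Wedge L M v j l w × w ≡ l

        Charge-total : ∀ e → e ∈ K → ∃ (Charge e)
        Charge-total (L , v , j) e∈
          with minimum (λ { (M , u , l) → (u Fin.≟ v) ×-dec (m L <? m M) }) (λ e → m (proj₁ e)) K
        ... | inj₁ none = (v , zero) , ≡.refl , λ p q → none _ p (≡.refl , q)
        ... | inj₂ ((M , _ , l) , f∈ , (≡.refl , L<M) , least)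
          with minimum (InWedge? L M v j l) x points
        ...   | inj₁ none = ⊥-elim (nonempty (≤-total (x j) (x l)))
          where
          e′ : Succ L v j
          e′ = segment e∈
          f′ : Succ M v l
          f′ = segment f∈
          gap : ∀ {u} → x v < x u → f L (x u) < f M (x u)
          gap = steeper-right {L} {M} (meet {L} {M} (proj₁ e′) (proj₁ f′)) L<M
          nonempty : (x j ≤ x l) ⊎ (x l ≤ x j) → ⊥
          nonempty (inj₁ p) = none j (∈-allFin j) (inWedge (proj₂ (ends e∈)) v<j (inj₂ refl) p
              (inj₂ (sym Lj)) (inj₁ (<-respˡ-≈ (sym Lj) (gap v<j))))
            where
            Lj : On L j
            Lj = proj₁ (proj₂ e′)
            v<j : x v < x j
            v<j = proj₁ (proj₂ (proj₂ e′))
          nonempty (inj₂ p) = none l (∈-allFin l) (inWedge (proj₂ (ends f∈)) v<l p (inj₂ refl)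
              (inj₁ (<-respʳ-≈ (sym Ml) (gap v<l))) (inj₂ Ml))
            where
            Ml : On M l
            Ml = proj₁ (proj₂ f′)
            v<l : x v < x l
            v<l = proj₁ (proj₂ (proj₂ f′))
        ...   | inj₂ (w , _ , inside , first) = classify (InWedge.over inside) (InWedge.under inside)
          where
          W : Wedge L M v j l w
          W = record
            { lower∈ = e∈ ; upper∈ = f∈ ; steeper = L<M ; inside = inside
            ; next = λ p q → least _ p (≡.refl , q)
            ; first = λ {u} p → first u (∈-allFin u) p }
          open Wedge W using (right; before-j; before-l; lower; upper)
          -- Sides join consecutive points, so a vertex of the wedge on a side is the right end of
          -- that side.
          reach : ∀ {N k} → Succ N v k → x w ≤ x k → On N w → w ≡ k
          reach _ (inj₂ e) _ = x-inj e
          reach (_ , _ , _ , h) (inj₁ p) q = ⊥-elim (h w q (right , p))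
          classify : f L (x w) ≤ y w → y w ≤ f M (x w) → ∃ (Charge (L , v , j))
          classify (inj₂ e) _ = (w , suc zero) , M , l , W , inj₁ (reach lower before-j (sym e))
          classify (inj₁ _) (inj₂ e) = (w , suc (suc zero)) , M , l , W , reach upper before-l e
          classify (inj₁ p) (inj₁ q) = (w , suc zero) , M , l , W , inj₂ (p , q)

        same-lower : ∀ {L L′ v j j′} → (L , v , j) ∈ K → (L′ , v , j′) ∈ K → m L ≈ m L′ →
                     (L , v , j) ≡ (L′ , v , j′)
        same-lower {L} {L′} p q e
          with same-slope {L} {L′} (meet {L} {L′} (proj₁ (segment p)) (proj₁ (segment q))) e
        ... | ≡.refl = ≡.cong (λ k → L , _ , k) (Succ-uniqueʳ {L} (segment p) (segment q))

        same-upper : ∀ {L L′ v v′ w} → (L , v , w) ∈ K → (L′ , v′ , w) ∈ K → m L ≈ m L′ →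
                     (L , v , w) ≡ (L′ , v′ , w)
        same-upper {L} {L′} p q e
          with same-slope {L} {L′} (meet {L} {L′} (proj₁ (proj₂ (segment p))) (proj₁ (proj₂ (segment q)))) e
        ... | ≡.refl = ≡.cong (λ k → L , k , _) (Succ-uniqueˡ {L} (segment p) (segment q))

        -- Of two different lower sides that end in `w`, the one of smaller slope runs above the
        -- other left of `w`, hence enters `w` from within the other's wedge, against
        -- `wedge-closed`.
        charge₁-ends : ∀ {L M v l L′ M′ v′ l′ w} → Wedge L M v w l w → Wedge L′ M′ v′ w l′ w →
                       (L , v , w) ≡ (L′ , v′ , w)
        charge₁-ends {L} {L′ = L′} W W′ with <-trichotomy (m L) (m L′)
        ... | inj₁ p = ⊥-elim (wedge-closed W′ (Wedge.lower∈ W) (inj₂ p)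
                (inj₁ (<-respˡ-≈ (sym (proj₁ (proj₂ (Wedge.lower W′)))) (Wedge.open-at W′ (Wedge.right W′)))))
        ... | inj₂ (inj₁ e) = same-upper (Wedge.lower∈ W) (Wedge.lower∈ W′) e
        ... | inj₂ (inj₂ p) = ⊥-elim (wedge-closed W (Wedge.lower∈ W′) (inj₂ p)
                (inj₁ (<-respˡ-≈ (sym (proj₁ (proj₂ (Wedge.lower W)))) (Wedge.open-at W (Wedge.right W)))))

        -- Wedges at one apex lie between neighbouring slopes: with different lower sides, one of
        -- them would begin at or above the upper side of the other, which the last two hypotheses
        -- exclude.
        same-wedge : ∀ {L M v j l L′ M′ j′ l′ w w′} → Wedge L M v j l w → Wedge L′ M′ v j′ l′ w′ →
                     ¬ (m M ≤ m L′) → ¬ (m M′ ≤ m L) → (L , v , j) ≡ (L′ , v , j′)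
        same-wedge {L} {L′ = L′} W W′ h h′ with <-trichotomy (m L) (m L′)
        ... | inj₁ p = ⊥-elim (h (Wedge.next W (Wedge.lower∈ W′) p))
        ... | inj₂ (inj₁ e) = same-lower (Wedge.lower∈ W) (Wedge.lower∈ W′) e
        ... | inj₂ (inj₂ p) = ⊥-elim (h′ (Wedge.next W′ (Wedge.lower∈ W) p))

        -- Of two different upper sides that end in `w`, the one of larger slope would enter from
        -- within the other's wedge. So the upper sides coincide, and the apex and the lower side
        -- follow.
        charge₂-ends : ∀ {L M v j L′ M′ v′ j′ w} → Wedge L M v j w w → Wedge L′ M′ v′ j′ w w →
                       (L , v , j) ≡ (L′ , v′ , j′)
        charge₂-ends {L} {M} {L′ = L′} {M′} W W′ with <-trichotomy (m M) (m M′)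
        ... | inj₁ p = ⊥-elim (wedge-closed W (Wedge.upper∈ W′)
                (inj₁ (<-respʳ-≈ (sym (proj₁ (proj₂ (Wedge.upper W)))) (Wedge.open-at W (Wedge.right W)))) (inj₂ p))
        ... | inj₂ (inj₂ p) = ⊥-elim (wedge-closed W′ (Wedge.upper∈ W)
                (inj₁ (<-respʳ-≈ (sym (proj₁ (proj₂ (Wedge.upper W′)))) (Wedge.open-at W′ (Wedge.right W′)))) (inj₂ p))
        ... | inj₂ (inj₁ e) with same-upper (Wedge.upper∈ W) (Wedge.upper∈ W′) e
        ...   | ≡.refl = same-wedge W W′ (λ q → ≤⇒≯ q (Wedge.steeper W′)) (λ q → ≤⇒≯ q (Wedge.steeper W))

        -- If `v′` is below `L`, the upper side from `v′` must cross `L` to pass above `w`; if it is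
        -- above `M`, the lower side from `v′` must cross `M` to pass below `w`. Otherwise `v′` is a
        -- vertex of the first wedge earlier than `w`.
        nested : ∀ {L M v j l L′ M′ v′ j′ l′ w} → Wedge L M v j l w → Wedge L′ M′ v′ j′ l′ w →
                 Strict L M w → Strict L′ M′ w → ¬ (x v < x v′)
        nested {L} {M} {v} {j} {l} {L′} {M′} {v′} {j′} {l′} {w} W W′ (p , q) (p′ , q′) v<v′
          with y v′ <? f L (x v′) | f M (x v′) <? y v′
        ... | yes r | _ = planar B.upper∈ A.lower∈
                (overtaking⇒Cross {M′} {v′} {l′} {L} {v} {j} B.upper A.lower B.right (inj₂ refl) (inj₁ v<v′)
                  B.before-l A.before-j (<-respˡ-≈ (proj₁ B.upper) r) (<-trans p q′))
          where
          module A = Wedge W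
          module B = Wedge W′
        ... | no _ | yes r = planar A.upper∈ B.lower∈
                (overtaking⇒Cross {M} {v} {l} {L′} {v′} {j′} A.upper B.lower B.right (inj₁ v<v′) (inj₂ refl)
                  A.before-l B.before-j (<-respʳ-≈ (proj₁ B.lower) r) (<-trans p′ q))
          where
          module A = Wedge W
          module B = Wedge W′
        ... | no r | no s = ≤⇒≯ (A.first (inWedge (proj₁ (ends B.lower∈)) v<v′
                (inj₁ (<-≤-trans B.right A.before-j)) (inj₁ (<-≤-trans B.right A.before-l))
                (≮⇒≥ r) (≮⇒≥ s))) B.right
          where
          module A = Wedge W
          module B = Wedge W′

        stacked : ∀ {L M v j l L′ M′ j′ l′ w} → Wedge L M v j l w → Wedge L′ M′ v j′ l′ w →
                  Strict L M w → Strict L′ M′ w → ¬ (m M ≤ m L′)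
        stacked {L} {M} {L′ = L′} {w = w} W W′ (_ , q) (p′ , _) le = ≤⇒≯ (fM≤ le) (<-trans p′ q)
          where
          e : f M (x _) ≈ f L′ (x _)
          e = meet {M} {L′} (proj₁ (Wedge.upper W)) (proj₁ (Wedge.lower W′))
          fM≤ : m M ≤ m L′ → f M (x w) ≤ f L′ (x w)
          fM≤ (inj₁ r) = inj₁ (steeper-right {M} {L′} e r (Wedge.right W))
          fM≤ (inj₂ r) = inj₂ (reflexive (≡.cong (λ N → f N (x w)) (same-slope {M} {L′} e r)))

        charge₁-strict : ∀ {L M v j l L′ M′ v′ j′ l′ w} → Wedge L M v j l w → Wedge L′ M′ v′ j′ l′ w →
                         Strict L M w → Strict L′ M′ w → (L , v , j) ≡ (L′ , v′ , j′)
        charge₁-strict {v = v} {v′ = v′} W W′ s s′ with <-trichotomy (x v) (x v′)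
        ... | inj₁ p = ⊥-elim (nested W W′ s s′ p)
        ... | inj₂ (inj₂ p) = ⊥-elim (nested W′ W s′ s p)
        ... | inj₂ (inj₁ e) with x-inj e
        ...   | ≡.refl = same-wedge W W′ (stacked W W′ s s′) (stacked W′ W s′ s)

        Charge-injective : ∀ e e′ t → e ∈ K → e′ ∈ K → Charge e t → Charge e′ t → e ≡ e′
        Charge-injective (L , v , j) (L′ , _ , j′) (w , zero) p p′ (≡.refl , h) (≡.refl , h′)
          with <-trichotomy (m L) (m L′)
        ... | inj₁ q = ⊥-elim (h p′ q)
        ... | inj₂ (inj₁ e) = same-lower p p′ e
        ... | inj₂ (inj₂ q) = ⊥-elim (h′ p q)
        Charge-injective _ _ (w , suc zero) _ _ (_ , _ , W , inj₁ ≡.refl) (_ , _ , W′ , inj₁ ≡.refl) =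
          charge₁-ends W W′
        -- When `w` is strictly inside a wedge of which it is the first vertex, no segment of `K`
        -- has it as right end. So the two kinds of charge in this slot exclude each other.
        Charge-injective _ _ (w , suc zero) _ _ (_ , _ , W , inj₁ ≡.refl) (_ , _ , W′ , inj₂ (p , q)) =
          ⊥-elim (wedge-closed W′ (Wedge.lower∈ W) (inj₁ p) (inj₁ q))
        Charge-injective _ _ (w , suc zero) _ _ (_ , _ , W , inj₂ (p , q)) (_ , _ , W′ , inj₁ ≡.refl) =
          ⊥-elim (wedge-closed W (Wedge.lower∈ W′) (inj₁ p) (inj₁ q))
        Charge-injective _ _ (w , suc zero) _ _ (_ , _ , W , inj₂ s) (_ , _ , W′ , inj₂ s′) =
          charge₁-strict W W′ s s′
        Charge-injective _ _ (w , suc (suc zero)) _ _ (_ , _ , W , ≡.refl) (_ , _ , W′ , ≡.refl) =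
          charge₂-ends W W′

        Charge-sampled : ∀ e t → e ∈ K → Charge e t → Q (proj₁ t)
        Charge-sampled _ (w , zero) p (≡.refl , _) = proj₁ (ends p)
        Charge-sampled _ (w , suc zero) _ (_ , _ , W , _) = Wedge.sampled W
        Charge-sampled _ (w , suc (suc zero)) _ (_ , _ , W , _) = Wedge.sampled W

      -- The three slots of a vertex `w`: the steepest segment that starts there, a wedge that has
      -- `w` as end of its lower side or strictly inside, and a wedge that has `w` as end of its
      -- upper side.
      planar-bound : length K ℕ.≤ 3 ℕ.* (∑[ w ∈ points ] 𝟙 (Q? w))
      planar-bound = begin
        length K
          ≤⟨ charging (Productₚ.≡-dec Fin._≟_ Fin._≟_) {R = Charge} (cartesianProduct points (allFin 3))
               (λ t → 𝟙 (Q? (proj₁ t))) unique Charge-total Charge-injective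
               (λ { e (w , s) p c → ∈-cartesianProduct⁺ (∈-allFin w) (∈-allFin s) ,
                    ℕₚ.≤-reflexive (≡.sym (𝟙-yes (Q? w) (Charge-sampled e (w , s) p c))) }) ⟩
        ∑ (cartesianProduct points (allFin 3)) (λ t → 𝟙 (Q? (proj₁ t)))
          ≡⟨ ∑-× points (allFin 3) _ ⟩
        ∑[ w ∈ points ] (3 ℕ.* 𝟙 (Q? w))         ≡⟨ ∑-*ˡ points 3 _ ⟩
        3 ℕ.* (∑[ w ∈ points ] 𝟙 (Q? w))         ∎
        where open ℕₚ.≤-Reasoning

-- The crossing inequality by random sampling.

module Crossing (ℝ : RealNumbers) where

  open import Data.Bool as Bool using (true)
  open import Data.Nat
  open import Data.Nat.Properties
  open import Data.Nat.Solver using (module +-*-Solver)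
  open import Data.Fin as Fin using (Fin)
  open import Data.List using (List; []; _∷_; length)
  open import Data.List.Properties using (length-tabulate)
  open import Data.Vec using ([]; _∷_; lookup)
  open import Data.List.Membership.Propositional using (_∈_)
  open import Data.List.Relation.Unary.All as All using ([]; _∷_)
  open import Data.List.Relation.Unary.AllPairs using ([]; _∷_)
  open import Data.List.Relation.Unary.Unique.Propositional using (Unique)
  open import Data.Product using (_×_; _,_; proj₁; proj₂)
  open import Relation.Nullary using (¬_; Dec; yes; no)
  open import Relation.Nullary.Decidable using (_×-dec_)
  open import Relation.Binary.PropositionalEquality
  open Sums
  open Sampling
  private module F = Field ℝ
  open Geometry ℝ
  open Planar ℝ

  𝟙-× : {A B : Set} (d : Dec A) (e : Dec B) → 𝟙 (d ×-dec e) ≡ 𝟙 d * 𝟙 e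
  𝟙-× (yes _) (yes _) = refl
  𝟙-× (yes _) (no _) = refl
  𝟙-× (no _) _ = refl

  -- The probability for four endpoints is known only when they are distinct, as they are for
  -- crossing segments; this restricts the comparison to such pairs.
  𝟙-guard : {A : Set} (d : Dec A) {s u v : ℕ} → (A → s * u ≤ v) → s * (𝟙 d * u) ≤ v * 𝟙 d
  𝟙-guard (yes p) {s} {u} {v} h = ≤-trans (≤-reflexive (cong (s *_) (*-identityˡ u)))
    (≤-trans (h p) (≤-reflexive (sym (*-identityʳ v))))
  𝟙-guard (no _) {s} h = ≤-trans (≤-reflexive (*-zeroʳ s)) z≤n

  module _ (𝒜 : Arrangement) where
    open ArrangementProperties 𝒜

    endpoints : Segment → List (Fin n)
    endpoints (L , i , j) = i ∷ j ∷ []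

    four-endpoints : Segment → Segment → List (Fin n)
    four-endpoints (L , i , j) (M , k , l) = i ∷ j ∷ k ∷ l ∷ []

    module _ {es : List Segment} (unique : Unique es) (segment : ∀ {e} → e ∈ es → IsSegment e) where

      crossings : ℕ
      crossings = ∑△ es (λ e e′ → 𝟙 (Cross? 𝒜 e e′))

      endpoints-distinct : ∀ {e} → e ∈ es → Unique (endpoints e)
      endpoints-distinct p = (x<⇒≢ (proj₁ (proj₂ (proj₂ (segment p)))) ∷ []) ∷ [] ∷ []

      -- The ends of the first segment lie off the line of the second, whose own ends lie on it.
      four-distinct : ∀ {e e′} → e ∈ es → e′ ∈ es → Cross 𝒜 e e′ → Unique (four-endpoints e e′)
      four-distinct {L , i , j} {M , k , l} p q (s , _) =
        (x<⇒≢ i<j ∷ ne₁ ∷ ne₂ ∷ []) ∷ (ne₃ ∷ ne₄ ∷ []) ∷ (x<⇒≢ k<l ∷ []) ∷ [] ∷ []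
        where
        i<j : x i F.< x j
        i<j = proj₁ (proj₂ (proj₂ (segment p)))
        k<l : x k F.< x l
        k<l = proj₁ (proj₂ (proj₂ (segment q)))
        off : ¬ On M i × ¬ On M j
        off = Separates-¬On 𝒜 {M} {i} {j} s
        ne₁ : i ≢ k
        ne₁ refl = proj₁ off (proj₁ (segment q))
        ne₂ : i ≢ l
        ne₂ refl = proj₁ off (proj₁ (proj₂ (segment q)))
        ne₃ : j ≢ k
        ne₃ refl = proj₂ off (proj₁ (segment q))
        ne₄ : j ≢ l
        ne₄ refl = proj₂ off (proj₁ (proj₂ (segment q)))

      module _ (a b : ℕ) where
        open RandomSubset a b

        -- Deletion leaves pairwise noncrossing segments, to which `planar-bound` applies; each
        -- deleted segment is paid for by a crossing whose four endpoints are all sampled.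
        sampled-bound : ∀ Q → ∑[ e ∈ es ] ∏ (endpoints e) Q ≤
          3 * (∑[ w ∈ points ] ∏ (w ∷ []) Q) +
          ∑△ es (λ e e′ → 𝟙 (Cross? 𝒜 e e′) * ∏ (four-endpoints e e′) Q)
        sampled-bound Q with independent-part S? (Cross? 𝒜) (Cross-sym 𝒜) es unique
                               (λ e p → Cross-irrefl 𝒜 (segment p))
          where
          S? : ∀ (e : Segment) → Dec (lookup Q (proj₁ (proj₂ e)) ≡ true × lookup Q (proj₂ (proj₂ e)) ≡ true)
          S? (L , i , j) = Sampled? Q i ×-dec Sampled? Q j
        ... | K , uK , sub , planar , le = begin
          ∑[ e ∈ es ] ∏ (endpoints e) Q
            ≡⟨ ∑-cong es (λ { (L , i , j) → trans (cong (𝟙 (Sampled? Q i) *_) (*-identityʳ _))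
                                                  (sym (𝟙-× (Sampled? Q i) (Sampled? Q j))) }) ⟩
          _
            ≤⟨ le ⟩
          _
            ≤⟨ +-mono-≤ (planar-bound 𝒜 (Sampled? Q) uK (λ p → segment (proj₁ (sub p)))
                           (λ p → proj₂ (sub p)) planar)
                        (∑△-mono-∈ es (λ e e′ _ _ → ≤-reflexive (cong (𝟙 (Cross? 𝒜 e e′) *_) (regroup e e′)))) ⟩
          3 * (∑[ w ∈ points ] 𝟙 (Sampled? Q w)) +
          ∑△ es (λ e e′ → 𝟙 (Cross? 𝒜 e e′) * ∏ (four-endpoints e e′) Q)
            ≡⟨ cong (λ k → 3 * k + ∑△ es (λ e e′ → 𝟙 (Cross? 𝒜 e e′) * ∏ (four-endpoints e e′) Q)) (∑-cong points (λ w → sym (*-identityʳ _))) ⟩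
          3 * (∑[ w ∈ points ] ∏ (w ∷ []) Q) +
          ∑△ es (λ e e′ → 𝟙 (Cross? 𝒜 e e′) * ∏ (four-endpoints e e′) Q) ∎
          where
          open ≤-Reasoning
          open +-*-Solver using (solve; _:+_; _:*_; _:=_; con)
          regroup : ∀ (e e′ : Segment) →
            𝟙 (Sampled? Q (proj₁ (proj₂ e)) ×-dec Sampled? Q (proj₂ (proj₂ e))) *
            𝟙 (Sampled? Q (proj₁ (proj₂ e′)) ×-dec Sampled? Q (proj₂ (proj₂ e′))) ≡
            ∏ (four-endpoints e e′) Q
          regroup (L , i , j) (M , k , l) = trans
            (cong₂ _*_ (𝟙-× (Sampled? Q i) (Sampled? Q j)) (𝟙-× (Sampled? Q k) (Sampled? Q l)))
            (solve 4 (λ i j k l → (i :* j) :* (k :* l) := i :* (j :* (k :* (l :* con 1)))) refl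
              (𝟙 (Sampled? Q i)) (𝟙 (Sampled? Q j)) (𝟙 (Sampled? Q k)) (𝟙 (Sampled? Q l)))

        expected-bound : ∑[ e ∈ es ] 𝔼 n (∏ (endpoints e)) ≤
          3 * (∑[ w ∈ points ] 𝔼 n (∏ (w ∷ []))) +
          ∑△ es (λ e e′ → 𝟙 (Cross? 𝒜 e e′) * 𝔼 n (∏ (four-endpoints e e′)))
        expected-bound = begin
          ∑[ e ∈ es ] 𝔼 n (∏ (endpoints e))                 ≡⟨ 𝔼-∑ n es (λ e → ∏ (endpoints e)) ⟨
          𝔼 n (λ Q → ∑[ e ∈ es ] ∏ (endpoints e) Q)         ≤⟨ 𝔼-mono n sampled-bound ⟩
          _
            ≡⟨ 𝔼-+ n _ _ ⟩
          _
            ≡⟨ cong₂ _+_ (trans (𝔼-*ˡ n 3 (λ Q → ∑[ w ∈ points ] ∏ (w ∷ []) Q))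
                               (cong (3 *_) (𝔼-∑ n points (λ w → ∏ (w ∷ [])))))
                        (trans (𝔼-∑△ n es (λ e e′ Q → 𝟙 (Cross? 𝒜 e e′) * ∏ (four-endpoints e e′) Q))
                               (∑△-cong es (λ e e′ → 𝔼-*ˡ n (𝟙 (Cross? 𝒜 e e′)) (∏ (four-endpoints e e′))))) ⟩
          3 * (∑[ w ∈ points ] 𝔼 n (∏ (w ∷ []))) +
          ∑△ es (λ e e′ → 𝟙 (Cross? 𝒜 e e′) * 𝔼 n (∏ (four-endpoints e e′))) ∎
          where open ≤-Reasoning

      -- With p = `a` / (`a + b`) the expected values give p²E ≤ 3np + p⁴X. This is that inequality
      -- divided by p and multiplied by (`a + b`)³; the factor `a * T` cancelled in the proof is the
      -- division by p together with the total weight of all subsets.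
      crossing-inequality : ∀ a b .{{_ : NonZero a}} →
        length es * a * ((a + b) * (a + b)) ≤ 3 * n * ((a + b) * (a + b) * (a + b)) + crossings * (a * a * a)
      crossing-inequality a b = *-cancelˡ-≤ (a * T) {{m*n≢0 a T {{it}} {{m^n≢0 t n {{t≢0}}}}}} (begin
        a * T * (length es * a * (t * t))
          ≡⟨ solve 4 (λ a T k t → a :* T :* (k :* a :* (t :* t)) := k :* (t :* t :* (a :* a :* T))) refl a T (length es) t ⟩
        length es * (t * t * (a * a * T))
          ≡⟨ ∑-const es _ ⟨
        ∑[ e ∈ es ] (t * t * (a * a * T))
          ≡⟨ ∑-cong-∈ es (λ e p → trans (cong (t * t *_) (pair e (endpoints-distinct p)))
               (solve 2 (λ t e → t :* t :* (t :* t :* e) := t :* t :* t :* t :* e) refl t (𝔼 n (∏ (endpoints e))))) ⟩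
        ∑[ e ∈ es ] (t⁴ * 𝔼 n (∏ (endpoints e)))
          ≡⟨ ∑-*ˡ es t⁴ _ ⟩
        t⁴ * (∑[ e ∈ es ] 𝔼 n (∏ (endpoints e)))
          ≤⟨ *-monoʳ-≤ t⁴ (expected-bound a b) ⟩
        t⁴ * (3 * P + R)
          ≡⟨ *-distribˡ-+ t⁴ (3 * P) R ⟩
        t⁴ * (3 * P) + t⁴ * R
          ≤⟨ +-mono-≤ (≤-reflexive single) quad ⟩
        3 * (n * (t * t * t * (a * T))) + crossings * (a * a * a * a * T)
          ≡⟨ solve 5 (λ n t a T c → con 3 :* (n :* (t :* t :* t :* (a :* T))) :+ c :* (a :* a :* a :* a :* T)
               := a :* T :* (con 3 :* n :* (t :* t :* t) :+ c :* (a :* a :* a))) refl n t a T crossings ⟩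
        a * T * (3 * n * (t * t * t) + crossings * (a * a * a)) ∎)
        where
        open ≤-Reasoning
        open +-*-Solver using (solve; _:+_; _:*_; _:=_; con)
        open RandomSubset a b
        it : {A : Set} → {{A}} → A
        it {{x}} = x
        t≢0 : NonZero t
        t≢0 = >-nonZero (≤-trans (>-nonZero⁻¹ a) (m≤m+n a b))
        T t⁴ P R : ℕ
        T = t ^ n
        t⁴ = t * t * t * t
        P = ∑[ w ∈ points ] 𝔼 n (∏ (w ∷ []))
        R = ∑△ es (λ e e′ → 𝟙 (Cross? 𝒜 e e′) * 𝔼 n (∏ (four-endpoints e e′)))
        pair : ∀ e → Unique (endpoints e) → a * a * T ≡ t * t * 𝔼 n (∏ (endpoints e))
        pair e u = trans (solve 2 (λ a T → a :* a :* T := a :* (a :* con 1) :* T) refl a T)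
          (trans (sym (𝔼-∏ n u)) (cong (_* 𝔼 n (∏ (endpoints e)))
            (solve 1 (λ t → t :* (t :* con 1) := t :* t) refl t)))
        single : t⁴ * (3 * P) ≡ 3 * (n * (t * t * t * (a * T)))
        single = trans (solve 2 (λ t p → t :* t :* t :* t :* (con 3 :* p) := con 3 :* (t :* t :* t :* (t :* p))) refl t P)
          (cong (3 *_) (trans (cong (t * t * t *_) (trans (sym (∑-*ˡ points t _))
            (trans (∑-cong points (λ w → trans (cong (_* 𝔼 n (∏ (w ∷ []))) (sym (*-identityʳ t)))
                     (trans (𝔼-∏ n {w ∷ []} ([] ∷ [])) (cong (_* T) (*-identityʳ a)))))
              (trans (∑-const points (a * T)) (cong (_* (a * T)) (length-tabulate (λ (i : Fin n) → i)))))))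
            (solve 3 (λ t n e → t :* t :* t :* (n :* e) := n :* (t :* t :* t :* e)) refl t n (a * T))))
        four : ∀ e e′ → Unique (four-endpoints e e′) →
               t⁴ * 𝔼 n (∏ (four-endpoints e e′)) ≡ a * a * a * a * T
        four e e′ u = trans (cong (_* 𝔼 n (∏ (four-endpoints e e′)))
            (solve 1 (λ t → t :* t :* t :* t := t :* (t :* (t :* (t :* con 1)))) refl t))
          (trans (𝔼-∏ n u) (solve 2 (λ a T → a :* (a :* (a :* (a :* con 1))) :* T := a :* a :* a :* a :* T) refl a T))
        quad : t⁴ * R ≤ crossings * (a * a * a * a * T)
        quad = begin
          t⁴ * R
            ≡⟨ ∑△-*ˡ es t⁴ _ ⟨
          ∑△ es (λ e e′ → t⁴ * (𝟙 (Cross? 𝒜 e e′) * 𝔼 n (∏ (four-endpoints e e′))))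
            ≤⟨ ∑△-mono-∈ es each ⟩
          ∑△ es (λ e e′ → a * a * a * a * T * 𝟙 (Cross? 𝒜 e e′))
            ≡⟨ ∑△-*ˡ es (a * a * a * a * T) _ ⟩
          a * a * a * a * T * crossings
            ≡⟨ *-comm _ crossings ⟩
          crossings * (a * a * a * a * T) ∎
          where
          each : ∀ e e′ → e ∈ es → e′ ∈ es →
                 t⁴ * (𝟙 (Cross? 𝒜 e e′) * 𝔼 n (∏ (four-endpoints e e′))) ≤ a * a * a * a * T * 𝟙 (Cross? 𝒜 e e′)
          each e e′ p q = 𝟙-guard (Cross? 𝒜 e e′) {t⁴} (λ c → ≤-reflexive (four e e′ (four-distinct p q c)))

-- The Szemerédi-Trotter bound for lines with many points.

module Rich (ℝ : RealNumbers) where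

  open import Data.Nat
  open import Data.Nat.Properties
  open import Data.Nat.Solver using (module +-*-Solver)
  open import Data.Fin as Fin using (Fin)
  open import Data.List using (List; filter; length; cartesianProduct)
  open import Data.List.Properties using (length-tabulate)
  open import Data.List.Membership.Propositional using (_∈_)
  open import Data.List.Membership.Propositional.Properties using (∈-allFin; ∈-filter⁻)
  open import Data.List.Relation.Unary.Unique.Propositional using (Unique)
  import Data.List.Relation.Unary.Unique.Propositional.Properties as Uniqueₚ
  open import Data.Product using (_×_; _,_; proj₁)
  open import Data.Sum using (_⊎_; inj₁; inj₂)
  open import Data.Empty using (⊥; ⊥-elim)
  open import Relation.Nullary using (¬_; Dec; yes; no)
  open import Relation.Nullary.Decidable using (_×-dec_)
  open import Relation.Binary.PropositionalEquality
  open Sums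
  open Sampling
  open Arith
  private module F = Field ℝ
  open Geometry ℝ
  open Planar ℝ
  open Melchior ℝ
  open Crossing ℝ

  excess-split : ∀ {k s} (d : Dec (k < s)) → (s ∸ k) + k * 𝟙 d ≡ 𝟙 d * s
  excess-split {k} {s} (yes p) = trans (cong (s ∸ k +_) (*-identityʳ k))
    (trans (m∸n+n≡m (<⇒≤ p)) (sym (*-identityˡ s)))
  excess-split {k} (no p) = cong₂ _+_ (m≤n⇒m∸n≡0 (≮⇒≥ p)) (*-zeroʳ k)

  module _ (𝒜 : Arrangement) where
    open ArrangementProperties 𝒜

    private
      -- Consecutiveness puts `i′` at or to the right of `j`, and from `j` on the order of `L` and
      -- `M` no longer changes, so `M` cannot separate `i′` from `j′` as well.
      no-second-crossing : ∀ {L M i j i′ j′} → Succ L i j → Succ L i′ j′ →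
                           Separates 𝒜 M i j → Separates 𝒜 M i′ j′ → ¬ (x i F.< x i′)
      no-second-crossing {L} {M} {i} {j} {i′} {j′} (Li , Lj , i<j , h) (Li′ , Lj′ , i′<j′ , _) s s′ i<i′ =
        contradict s s′
        where
        j≤i′ : x j F.≤ x i′
        j≤i′ = F.≮⇒≥ (λ p → h i′ Li′ (i<i′ , p))
        j≤j′ : x j F.≤ x j′
        j≤j′ = F.≤-trans j≤i′ (inj₁ i′<j′)
        contradict : Separates 𝒜 M i j → Separates 𝒜 M i′ j′ → ⊥
        contradict (inj₁ (a , b)) = λ { (inj₁ (a′ , _)) → F.<-asym (after j≤i′) (F.<-respʳ-≈ Li′ a′)
                                      ; (inj₂ (_ , a′)) → F.<-asym (after j≤j′) (F.<-respʳ-≈ Lj′ a′) }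
          where
          after : ∀ {u} → x j F.≤ u → f L u F.< f M u
          after = overtake-right {M} {L} (F.<-respʳ-≈ Li a) (F.<-respˡ-≈ Lj b) i<j
        contradict (inj₂ (a , b)) = λ { (inj₁ (_ , a′)) → F.<-asym (after j≤j′) (F.<-respˡ-≈ Lj′ a′)
                                      ; (inj₂ (a′ , _)) → F.<-asym (after j≤i′) (F.<-respˡ-≈ Li′ a′) }
          where
          after : ∀ {u} → x j F.≤ u → f M u F.< f L u
          after = overtake-right {L} {M} (F.<-respˡ-≈ Li a) (F.<-respʳ-≈ Lj b) i<j

    one-crossing : ∀ L M → ∑[ i ∈ points ] (∑[ j ∈ points ] (𝟙 (Succ? L i j) * 𝟙 (Separates? 𝒜 M i j))) ≤ 1
    one-crossing L M = begin
      ∑[ i ∈ points ] (∑[ j ∈ points ] (𝟙 (Succ? L i j) * 𝟙 (Separates? 𝒜 M i j)))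
        ≡⟨ ∑-cong points (λ i → ∑-cong points (λ j → 𝟙-× (Succ? L i j) (Separates? 𝒜 M i j))) ⟨
      ∑[ i ∈ points ] (∑[ j ∈ points ] 𝟙 (Succ? L i j ×-dec Separates? 𝒜 M i j))
        ≡⟨ ∑-× points points (λ { (i , j) → 𝟙 (Succ? L i j ×-dec Separates? 𝒜 M i j) }) ⟨
      ∑ (cartesianProduct points points) (λ { (i , j) → 𝟙 (Succ? L i j ×-dec Separates? 𝒜 M i j) })
        ≤⟨ ∑-at-most-one (λ { (i , j) → Succ? L i j ×-dec Separates? 𝒜 M i j })
             (Uniqueₚ.cartesianProduct⁺ (Uniqueₚ.allFin⁺ n) (Uniqueₚ.allFin⁺ n))
             (λ { (i , j) (i′ , j′) _ _ (S , s) (S′ , s′) → same S S′ s s′ }) ⟩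
      1 ∎
      where
      open ≤-Reasoning
      same : ∀ {i j i′ j′} → Succ L i j → Succ L i′ j′ → Separates 𝒜 M i j → Separates 𝒜 M i′ j′ →
             (i , j) ≡ (i′ , j′)
      same {i} {j} {i′} S S′ s s′ with F.<-trichotomy (x i) (x i′)
      ... | inj₁ p = ⊥-elim (no-second-crossing {L} {M} S S′ s s′ p)
      ... | inj₂ (inj₂ p) = ⊥-elim (no-second-crossing {L} {M} S′ S s′ s p)
      ... | inj₂ (inj₁ e) with x-inj e
      ...   | refl = cong (i ,_) (Succ-uniqueʳ {L} S S′)

    -- Two different lines share at most one point. The indicators let the same inequality cover the
    -- diagonal, where all points of `L` are common.
    common≤ : ∀ L M → (∑[ i ∈ points ] (𝟙 (On? L i) * 𝟙 (On? M i))) + 𝟙 (L Fin.≟ M) ≤ 𝟙 (L Fin.≟ M) * size L + 1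
    common≤ L M with L Fin.≟ M
    ... | yes refl = +-monoˡ-≤ 1 (≤-reflexive (trans (∑-cong points (λ i → 𝟙-idem (On? L i))) (sym (*-identityˡ _))))
    ... | no ne = begin
      (∑[ i ∈ points ] (𝟙 (On? L i) * 𝟙 (On? M i))) + 0
        ≡⟨ +-identityʳ _ ⟩
      ∑[ i ∈ points ] (𝟙 (On? L i) * 𝟙 (On? M i))
        ≡⟨ ∑-cong points (λ i → 𝟙-× (On? L i) (On? M i)) ⟨
      ∑[ i ∈ points ] 𝟙 (On? L i ×-dec On? M i)
        ≤⟨ ∑-at-most-one (λ i → On? L i ×-dec On? M i) (Uniqueₚ.allFin⁺ n) same ⟩
      1 ∎
      where
      open ≤-Reasoning
      same : ∀ i j → i ∈ points → j ∈ points → On L i × On M i → On L j × On M j → i ≡ j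
      same i j _ _ (p , q) (p′ , q′) with i Fin.≟ j
      ... | yes e = e
      ... | no i≢j = ⊥-elim (ne (unique-join i≢j p p′ q q′))

    excess : ℕ → ℕ
    excess ν = ∑[ L ∈ lines ] (size L ∸ suc ν)

    module _ (ν : ℕ) where

      Rich? : ∀ L → Dec (suc ν < size L)
      Rich? L = suc ν <? size L

      rich : ℕ
      rich = ∑[ L ∈ lines ] 𝟙 (Rich? L)

      incidences : ℕ
      incidences = ∑[ L ∈ lines ] (𝟙 (Rich? L) * size L)

      excess≡ : excess ν + suc ν * rich ≡ incidences
      excess≡ = trans (cong (excess ν +_) (sym (∑-*ˡ lines (suc ν) _)))
        (trans (sym (∑-+ lines _ _)) (∑-cong lines each))
        where
        each : ∀ L → (size L ∸ suc ν) + suc ν * 𝟙 (Rich? L) ≡ 𝟙 (Rich? L) * size L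
        each L = excess-split (Rich? L)

      rich-segments : List Segment
      rich-segments = filter (λ e → Rich? (proj₁ e)) (segments 𝒜)

      ∑-rich-segments : ∀ (g : Segment → ℕ) → ∑ rich-segments g ≡
        ∑[ L ∈ lines ] (∑[ i ∈ points ] (∑[ j ∈ points ] (𝟙 (Succ? L i j) * (𝟙 (Rich? L) * g (L , i , j)))))
      ∑-rich-segments g = trans (∑-filter (λ e → Rich? (proj₁ e)) (segments 𝒜) g) (∑-segments 𝒜 _)

      rich-segments-unique : Unique rich-segments
      rich-segments-unique = Uniqueₚ.filter⁺ _ (segments-unique 𝒜)

      rich-segment : ∀ {e} → e ∈ rich-segments → IsSegment e
      rich-segment p = ∈segments⇒Succ 𝒜 (proj₁ (∈-filter⁻ (λ e → Rich? (proj₁ e)) {xs = segments 𝒜} p))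

      private
        pull : ∀ L k (g : Fin n → Fin n → ℕ) →
               ∑[ i ∈ points ] (∑[ j ∈ points ] (𝟙 (Succ? L i j) * (k * g i j))) ≡
               k * (∑[ i ∈ points ] (∑[ j ∈ points ] (𝟙 (Succ? L i j) * g i j)))
        pull L k g = trans (∑-cong points (λ i → trans (∑-cong points (λ j → swap (𝟙 (Succ? L i j)) k (g i j)))
                         (∑-*ˡ points k _))) (∑-*ˡ points k _)
          where
          swap : ∀ a b c → a * (b * c) ≡ b * (a * c)
          swap = solve 3 (λ a b c → a :* (b :* c) := b :* (a :* c)) refl
            where open +-*-Solver using (solve; _:*_; _:=_)

      incidences≤ : incidences ≤ rich + length rich-segments
      incidences≤ = begin
        ∑[ L ∈ lines ] (𝟙 (Rich? L) * size L)
          ≤⟨ ∑-mono lines (λ L → *-monoʳ-≤ (𝟙 (Rich? L)) (size≤1+segments L)) ⟩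
        ∑[ L ∈ lines ] (𝟙 (Rich? L) * (1 + (∑[ i ∈ points ] (∑[ j ∈ points ] 𝟙 (Succ? L i j)))))
          ≡⟨ ∑-cong lines (λ L → trans (*-distribˡ-+ (𝟙 (Rich? L)) 1 _) (cong₂ _+_ (*-identityʳ (𝟙 (Rich? L)))
               (trans (cong (𝟙 (Rich? L) *_) (∑-cong points (λ i → ∑-cong points (λ j → sym (*-identityʳ _)))))
                 (sym (pull L (𝟙 (Rich? L)) (λ _ _ → 1)))))) ⟩
        _ ≡⟨ ∑-+ lines (λ L → 𝟙 (Rich? L)) _ ⟩
        _ ≡⟨ cong (rich +_) (trans (sym (∑-rich-segments (λ _ → 1)))
               (trans (∑-const rich-segments 1) (*-identityʳ _))) ⟩
        rich + length rich-segments ∎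
        where open ≤-Reasoning

      -- An ordered pair of rich lines carries at most one ordered pair of crossing segments, since
      -- on each line at most one segment is separated by the other. `row` uses this for the second
      -- line and `column` for the first.
      rich-crossings : 2 * crossings 𝒜 rich-segments-unique rich-segment ≤ rich * rich
      rich-crossings = begin
        2 * crossings 𝒜 rich-segments-unique rich-segment
          ≤⟨ ∑△-half rich-segments _ (λ e e′ → *-comm′ e e′) ⟩
        ∑[ e ∈ rich-segments ] (∑[ e′ ∈ rich-segments ] 𝟙 (Cross? 𝒜 e e′))
          ≤⟨ ∑-mono rich-segments (λ { (L , i , j) → row L i j }) ⟩
        ∑[ e ∈ rich-segments ] (∑[ M ∈ lines ] (𝟙 (Rich? M) * sep M e))
          ≡⟨ ∑-swap rich-segments lines _ ⟩
        ∑[ M ∈ lines ] (∑[ e ∈ rich-segments ] (𝟙 (Rich? M) * sep M e))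
          ≡⟨ ∑-cong lines (λ M → ∑-*ˡ rich-segments (𝟙 (Rich? M)) (sep M)) ⟩
        ∑[ M ∈ lines ] (𝟙 (Rich? M) * ∑ rich-segments (sep M))
          ≤⟨ ∑-mono lines (λ M → *-monoʳ-≤ (𝟙 (Rich? M)) (column M)) ⟩
        ∑[ M ∈ lines ] (𝟙 (Rich? M) * rich)
          ≡⟨ ∑-*ʳ lines rich _ ⟩
        rich * rich ∎
        where
        open ≤-Reasoning
        sep : Fin V → Segment → ℕ
        sep M (L , i , j) = 𝟙 (Separates? 𝒜 M i j)
        *-comm′ : ∀ e e′ → 𝟙 (Cross? 𝒜 e e′) ≡ 𝟙 (Cross? 𝒜 e′ e)
        *-comm′ e e′ = ≤-antisym (𝟙-mono (Cross? 𝒜 e e′) (Cross? 𝒜 e′ e) (Cross-sym 𝒜 e e′))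
                                 (𝟙-mono (Cross? 𝒜 e′ e) (Cross? 𝒜 e e′) (Cross-sym 𝒜 e′ e))
        row : ∀ L i j → ∑[ e′ ∈ rich-segments ] 𝟙 (Cross? 𝒜 (L , i , j) e′) ≤
                        ∑[ M ∈ lines ] (𝟙 (Rich? M) * 𝟙 (Separates? 𝒜 M i j))
        row L i j = begin
          ∑[ e′ ∈ rich-segments ] 𝟙 (Cross? 𝒜 (L , i , j) e′)
            ≡⟨ ∑-rich-segments _ ⟩
          ∑[ M ∈ lines ] (∑[ k ∈ points ] (∑[ l ∈ points ] (𝟙 (Succ? M k l) *
            (𝟙 (Rich? M) * 𝟙 (Cross? 𝒜 (L , i , j) (M , k , l))))))
            ≡⟨ ∑-cong lines (λ M → trans
                 (∑-cong points (λ k → ∑-cong points (λ l → cong (𝟙 (Succ? M k l) *_)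
                   (trans (cong (𝟙 (Rich? M) *_) (𝟙-× (Separates? 𝒜 M i j) (Separates? 𝒜 L k l)))
                     (sym (*-assoc (𝟙 (Rich? M)) _ _))))))
                 (pull M (𝟙 (Rich? M) * 𝟙 (Separates? 𝒜 M i j)) (λ k l → 𝟙 (Separates? 𝒜 L k l)))) ⟩
          ∑[ M ∈ lines ] (𝟙 (Rich? M) * 𝟙 (Separates? 𝒜 M i j) *
            (∑[ k ∈ points ] (∑[ l ∈ points ] (𝟙 (Succ? M k l) * 𝟙 (Separates? 𝒜 L k l)))))
            ≤⟨ ∑-mono lines (λ M → ≤-trans (*-monoʳ-≤ (𝟙 (Rich? M) * 𝟙 (Separates? 𝒜 M i j)) (one-crossing M L))
                 (≤-reflexive (*-identityʳ _))) ⟩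
          ∑[ M ∈ lines ] (𝟙 (Rich? M) * 𝟙 (Separates? 𝒜 M i j)) ∎
        column : ∀ M → ∑ rich-segments (sep M) ≤ rich
        column M = begin
          ∑ rich-segments (sep M)
            ≡⟨ ∑-rich-segments (sep M) ⟩
          _ ≡⟨ ∑-cong lines (λ L → pull L (𝟙 (Rich? L)) (λ i j → 𝟙 (Separates? 𝒜 M i j))) ⟩
          _ ≤⟨ ∑-mono lines (λ L → ≤-trans (*-monoʳ-≤ (𝟙 (Rich? L)) (one-crossing L M))
                 (≤-reflexive (*-identityʳ _))) ⟩
          rich ∎

      -- Let d be the number of rich lines through a point. From (d - 1)(d - 2) ≥ 0 comes 3d ≤ 2 +
      -- d², and the sum of d² over the points is at most I + m² - m, because different lines share
      -- at most one point.
      inclusion-exclusion : 2 * incidences + rich ≤ 2 * n + rich * rich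
      inclusion-exclusion = +-cancelʳ-≤ incidences _ _ (begin
        2 * incidences + rich + incidences
          ≡⟨ solve 2 (λ i r → con 2 :* i :+ r :+ i := con 3 :* i :+ r) refl incidences rich ⟩
        3 * incidences + rich
          ≡⟨ cong (λ k → 3 * k + rich) swapped ⟩
        3 * ∑ points d + rich
          ≡⟨ cong (_+ rich) (∑-*ˡ points 3 d) ⟨
        (∑[ i ∈ points ] (3 * d i)) + rich
          ≤⟨ +-monoˡ-≤ rich (∑-mono points (λ i → triple (d i))) ⟩
        (∑[ i ∈ points ] (2 + d i * d i)) + rich
          ≡⟨ cong (_+ rich) (trans (∑-+ points (λ _ → 2) _) (cong (_+ ∑ points (λ i → d i * d i))
               (trans (∑-const points 2) (trans (cong (_* 2) (length-tabulate (λ (i : Fin n) → i))) (*-comm n 2))))) ⟩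
        2 * n + (∑[ i ∈ points ] (d i * d i)) + rich
          ≡⟨ +-assoc (2 * n) _ rich ⟩
        2 * n + ((∑[ i ∈ points ] (d i * d i)) + rich)
          ≤⟨ +-monoʳ-≤ (2 * n) pairs ⟩
        2 * n + (incidences + rich * rich)
          ≡⟨ solve 3 (λ n i r → con 2 :* n :+ (i :+ r :* r) := con 2 :* n :+ r :* r :+ i) refl n incidences rich ⟩
        2 * n + rich * rich + incidences ∎)
        where
        open ≤-Reasoning
        open +-*-Solver using (solve; _:+_; _:*_; _:=_; con)
        ρ : Fin V → ℕ
        ρ L = 𝟙 (Rich? L)
        d : Fin n → ℕ
        d i = ∑[ L ∈ lines ] (ρ L * 𝟙 (On? L i))
        swapped : incidences ≡ ∑ points d
        swapped = trans (∑-cong lines (λ L → sym (∑-*ˡ points (ρ L) _))) (∑-swap lines points _)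
        triple : ∀ k → 3 * k ≤ 2 + k * k
        triple 0 = z≤n
        triple 1 = ≤-refl
        triple (suc (suc k)) = ≤-trans (m≤m+n _ (k + k * k)) (≤-reflexive
          (solve 1 (λ k → con 3 :* (con 2 :+ k) :+ (k :+ k :* k) := con 2 :+ (con 2 :+ k) :* (con 2 :+ k)) refl k))
        common : Fin V → Fin V → ℕ
        common L M = ∑[ i ∈ points ] (𝟙 (On? L i) * 𝟙 (On? M i))
        δ : Fin V → Fin V → ℕ
        δ L M = 𝟙 (L Fin.≟ M)
        diagonal : ∀ L (g : Fin V → ℕ) → ∑[ M ∈ lines ] (ρ M * (δ L M * g L)) ≡ ρ L * g L
        diagonal L g = trans (∑-cong lines same) (trans (∑-*ʳ lines (ρ L * g L) (δ L))
          (trans (cong (_* (ρ L * g L)) one) (*-identityˡ _)))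
          where
          same : ∀ M → ρ M * (δ L M * g L) ≡ δ L M * (ρ L * g L)
          same M with L Fin.≟ M
          ... | yes refl = trans (cong (ρ L *_) (*-identityˡ (g L))) (sym (*-identityˡ _))
          ... | no _ = *-zeroʳ (ρ M)
          one : ∑ lines (δ L) ≡ 1
          one = ≤-antisym (∑-at-most-one (L Fin.≟_) (Uniqueₚ.allFin⁺ V) (λ a b _ _ p q → trans (sym p) q))
            (≤-trans (≤-reflexive (sym (𝟙-yes (L Fin.≟ L) refl))) (∑-∈ (δ L) (∈-allFin L)))
        ρ-idem : ∀ L → ρ L * ρ L ≡ ρ L
        ρ-idem L = 𝟙-idem (Rich? L)
        squares : ∑[ i ∈ points ] (d i * d i) ≡ ∑[ L ∈ lines ] (ρ L * (∑[ M ∈ lines ] (ρ M * common L M)))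
        squares = trans (∑-cong points (λ i → trans (sym (∑-prod lines lines _ _))
            (∑-cong lines (λ L → trans (∑-cong lines (λ M →
               solve 4 (λ a b c e → (a :* b) :* (c :* e) := a :* (c :* (b :* e))) refl (ρ L) (𝟙 (On? L i)) (ρ M) (𝟙 (On? M i))))
               (∑-*ˡ lines (ρ L) _)))))
          (trans (∑-swap points lines _) (∑-cong lines (λ L → trans (∑-*ˡ points (ρ L) _)
            (cong (ρ L *_) (trans (∑-swap points lines _) (∑-cong lines (λ M → ∑-*ˡ points (ρ M) _)))))))
        pairs : (∑[ i ∈ points ] (d i * d i)) + rich ≤ incidences + rich * rich
        pairs = begin
          (∑[ i ∈ points ] (d i * d i)) + rich
            ≡⟨ cong₂ _+_ squares (∑-cong lines (λ L → trans (sym (ρ-idem L))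
                 (cong (ρ L *_) (trans (sym (*-identityʳ (ρ L))) (sym (diagonal L (λ _ → 1))))))) ⟩
          _ ≡⟨ ∑-+ lines _ _ ⟨
          ∑[ L ∈ lines ] (ρ L * (∑[ M ∈ lines ] (ρ M * common L M)) + ρ L * (∑[ M ∈ lines ] (ρ M * (δ L M * 1))))
            ≤⟨ ∑-mono lines (λ L → begin
                 ρ L * (∑[ M ∈ lines ] (ρ M * common L M)) + ρ L * (∑[ M ∈ lines ] (ρ M * (δ L M * 1)))
                   ≡⟨ *-distribˡ-+ (ρ L) _ _ ⟨
                 ρ L * ((∑[ M ∈ lines ] (ρ M * common L M)) + (∑[ M ∈ lines ] (ρ M * (δ L M * 1))))
                   ≡⟨ cong (ρ L *_) (sym (∑-+ lines _ _)) ⟩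
                 ρ L * (∑[ M ∈ lines ] (ρ M * common L M + ρ M * (δ L M * 1)))
                   ≤⟨ *-monoʳ-≤ (ρ L) (∑-mono lines (λ M → ≤-trans
                        (≤-reflexive (trans (cong (λ k → ρ M * common L M + ρ M * k) (*-identityʳ (δ L M)))
                          (sym (*-distribˡ-+ (ρ M) (common L M) (δ L M)))))
                        (≤-trans (*-monoʳ-≤ (ρ M) (common≤ L M))
                          (≤-reflexive (trans (*-distribˡ-+ (ρ M) (δ L M * size L) 1)
                            (cong (ρ M * (δ L M * size L) +_) (*-identityʳ (ρ M)))))))) ⟩
                 ρ L * (∑[ M ∈ lines ] (ρ M * (δ L M * size L) + ρ M))
                   ≡⟨ cong (ρ L *_) (trans (∑-+ lines _ ρ) (cong (_+ rich) (diagonal L size))) ⟩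
                 ρ L * (ρ L * size L + rich)
                   ≡⟨ trans (*-distribˡ-+ (ρ L) _ rich) (cong (_+ ρ L * rich)
                        (trans (sym (*-assoc (ρ L) (ρ L) _)) (cong (_* size L) (ρ-idem L)))) ⟩
                 ρ L * size L + ρ L * rich ∎) ⟩
          ∑[ L ∈ lines ] (ρ L * size L + ρ L * rich)
            ≡⟨ trans (∑-+ lines _ _) (cong (incidences +_) (∑-*ʳ lines rich ρ)) ⟩
          incidences + rich * rich ∎

      -- The probability of keeping a point is 3n / (ν · rich), or 1 if this exceeds 1.
      excess-bound : .{{_ : NonZero n}} → excess ν ≤ n ⊎ 2 * (ν * ν) * excess ν ≤ 9 * (n * n)
      -- Up to `2 * ν` rich lines, inclusion-exclusion alone is enough. Beyond that 2ν² is at most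
      -- `ν * rich`, which `unsampled` relies on.
      excess-bound with rich ≤? 2 * ν
      ... | yes few = inj₁ (few-lines {n = n} {ν = ν} excess≡ inclusion-exclusion few)
      ... | no many = inj₂ (go (≤-total (ν * rich) (3 * n)))
        where
        open +-*-Solver using (solve; _:+_; _:*_; _:=_; con)
        E X : ℕ
        E = length rich-segments
        X = crossings 𝒜 rich-segments-unique rich-segment
        instance
          rich≢0 : NonZero rich
          rich≢0 = >-nonZero (≤-<-trans z≤n (≰⇒> many))
          3n≢0 : NonZero (3 * n)
          3n≢0 = m*n≢0 3 n
        edges : excess ν + ν * rich ≤ E
        edges = +-cancelʳ-≤ rich _ _ (begin
          excess ν + ν * rich + rich     ≡⟨ solve 3 (λ e v r → e :+ v :* r :+ r := e :+ (con 1 :+ v) :* r) refl (excess ν) ν rich ⟩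
          excess ν + suc ν * rich        ≡⟨ excess≡ ⟩
          incidences                     ≤⟨ incidences≤ ⟩
          rich + E                       ≡⟨ +-comm rich E ⟩
          E + rich                       ∎)
          where open ≤-Reasoning
        go : ν * rich ≤ 3 * n ⊎ 3 * n ≤ ν * rich → 2 * (ν * ν) * excess ν ≤ 9 * (n * n)
        -- Weights 1 and 0: every point is kept.
        go (inj₁ small) = unsampled {n = n} {ν = ν} {E = E} {X} (≰⇒> many) small edges
          (≤-trans (≤-reflexive (solve 1 (λ e → e := e :* con 1 :* con 1) refl E))
            (≤-trans (crossing-inequality 𝒜 rich-segments-unique rich-segment 1 0)
              (≤-reflexive (solve 2 (λ n x → con 3 :* n :* con 1 :+ x :* con 1 := con 3 :* n :+ x) refl n X))))
          rich-crossings
        -- The second weight is chosen so that the two add up to `ν * rich`.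
        go (inj₂ large) = sampled {n = n} {m = rich} {ν} {E = E} {X} edges
          (subst (λ t → E * (3 * n) * (t * t) ≤ 3 * n * (t * t * t) + X * (3 * n * (3 * n) * (3 * n)))
            (m+[n∸m]≡n large) (crossing-inequality 𝒜 rich-segments-unique rich-segment (3 * n) (ν * rich ∸ 3 * n)))
          rich-crossings

-- Counting pairs of points and the choice of constants.

module Count (ℝ : RealNumbers) where

  open import Data.Nat
  open import Data.Nat.Properties
  open import Data.Nat.DivMod using (_/_; m/n*n≤m; /-monoˡ-≤; m*n/n≡m)
  open import Data.Nat.Solver using (module +-*-Solver)
  open import Data.Fin as Fin using (Fin)
  import Data.Fin.Properties as Finₚ
  open import Data.List using (List)
  open import Data.List.Properties using (length-tabulate)
  open import Data.List.Membership.Propositional using (_∈_)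
  open import Data.List.Membership.Propositional.Properties using (∈-allFin)
  import Data.List.Relation.Unary.Unique.Propositional.Properties as Uniqueₚ
  open import Data.Product using (∃; _×_; _,_)
  open import Data.Sum using (_⊎_; inj₁; inj₂)
  open import Data.Empty using (⊥-elim)
  open import Relation.Nullary using (¬_; Dec; yes; no)
  open import Relation.Nullary.Decidable using (_×-dec_; ¬?)
  open import Relation.Binary.PropositionalEquality
  open Sums
  open Geometry ℝ
  open Melchior ℝ
  open Crossing ℝ
  open Rich ℝ

  open +-*-Solver using (solve; _:+_; _:*_; _:=_; con)

  ∑< : ℕ → (ℕ → ℕ) → ℕ
  ∑< zero g = 0
  ∑< (suc N) g = ∑< N g + g N

  ∑<-∑ : ∀ {A : Set} (xs : List A) N (g : A → ℕ → ℕ) →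
         ∑[ x ∈ xs ] ∑< N (g x) ≡ ∑< N (λ k → ∑[ x ∈ xs ] g x k)
  ∑<-∑ xs zero g = ∑-zero xs (λ _ → refl)
  ∑<-∑ xs (suc N) g = trans (∑-+ xs _ _) (cong (_+ ∑ xs (λ x → g x N)) (∑<-∑ xs N g))

  ∑<-prefix : ∀ {N} g k → ∑< N g ≤ ∑< (k + N) g
  ∑<-prefix g zero = ≤-refl
  ∑<-prefix g (suc k) = ≤-trans (∑<-prefix g k) (m≤m+n _ _)

  staircase : ∀ r N → N ≤ r → 2 * ∑< N (λ k → r ∸ suc k) + (N * N + N) ≡ 2 * N * r
  staircase r zero _ = refl
  staircase r (suc N) N<r = begin
    2 * (s + h) + (suc N * suc N + suc N)
      ≡⟨ solve 3 (λ s h N → con 2 :* (s :+ h) :+ ((con 1 :+ N) :* (con 1 :+ N) :+ (con 1 :+ N))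
           := (con 2 :* s :+ (N :* N :+ N)) :+ con 2 :* (h :+ (con 1 :+ N))) refl s h N ⟩
    2 * s + (N * N + N) + 2 * (h + suc N)
      ≡⟨ cong₂ (λ u v → u + 2 * v) (staircase r N (<⇒≤ N<r)) (m∸n+n≡m N<r) ⟩
    2 * N * r + 2 * r
      ≡⟨ solve 2 (λ N r → con 2 :* N :* r :+ con 2 :* r := con 2 :* (con 1 :+ N) :* r) refl N r ⟩
    2 * suc N * r ∎
    where
    open ≡-Reasoning
    s h : ℕ
    s = ∑< N (λ k → r ∸ suc k)
    h = r ∸ suc N

  triangle : ∀ r → r * r ≤ 2 * ∑< r (λ k → r ∸ suc k) + r
  triangle r = +-cancelʳ-≤ (r * r) _ _ (≤-reflexive (trans
    (solve 1 (λ r → r :* r :+ r :* r := con 2 :* r :* r) refl r)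
    (trans (sym (staircase r r ≤-refl))
      (solve 2 (λ s r → con 2 :* s :+ (r :* r :+ r) := con 2 :* s :+ r :+ r :* r) refl (∑< r (λ k → r ∸ suc k)) r))))

  -- The constants: d (d − 1) / 2 = ∑_{μ ≥ 1} (d − μ)⁺; the terms with μ ≤ 28 are paid for by
  -- Melchior's inequality with multiplier 31 and by the lines with at most three points.
  pairs-weight : ∀ N d → 2 ≤ d → d ≤ 28 + N →
                 d * d + 186 ≤ 64 * 𝟙 (d ≤? 3) + 63 * d + 2 * ∑< N (λ k → d ∸ (29 + k))
  pairs-weight N (suc zero) (s≤s ()) _
  pairs-weight N (suc (suc zero)) _ _ = m≤m+n 190 _
  pairs-weight N (suc (suc (suc zero))) _ _ = ≤-trans (m≤m+n 195 58) (m≤m+n 253 _)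
  pairs-weight N (suc (suc (suc (suc e)))) _ le with ≤-total e 24
  ... | inj₁ small = ≤-trans (begin
      (4 + e) * (4 + e) + 186
        ≡⟨ solve 1 (λ e → (con 4 :+ e) :* (con 4 :+ e) :+ con 186 := e :* e :+ con 8 :* e :+ con 202) refl e ⟩
      e * e + 8 * e + 202
        ≤⟨ +-monoˡ-≤ 202 (+-monoˡ-≤ (8 * e) (*-monoˡ-≤ e small)) ⟩
      24 * e + 8 * e + 202
        ≤⟨ m≤m+n _ (50 + 31 * e) ⟩
      24 * e + 8 * e + 202 + (50 + 31 * e)
        ≡⟨ solve 1 (λ e → con 24 :* e :+ con 8 :* e :+ con 202 :+ (con 50 :+ con 31 :* e) := con 63 :* (con 4 :+ e)) refl e ⟩
      63 * (4 + e) ∎) (m≤m+n _ _)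
    where open ≤-Reasoning
  ... | inj₂ large = subst (λ d → d * d + 186 ≤ 63 * d + 2 * ∑< N (λ k → d ∸ (29 + k)))
      (cong (4 +_) (m+[n∸m]≡n large)) (begin
      (28 + r) * (28 + r) + 186
        ≡⟨ solve 1 (λ r → (con 28 :+ r) :* (con 28 :+ r) :+ con 186 := r :* r :+ (con 56 :* r :+ con 970)) refl r ⟩
      r * r + (56 * r + 970)
        ≤⟨ +-monoˡ-≤ _ (≤-trans (triangle r) (+-monoˡ-≤ r (*-monoʳ-≤ 2 longer))) ⟩
      2 * s + r + (56 * r + 970)
        ≤⟨ m≤m+n _ (6 * r + 794) ⟩
      2 * s + r + (56 * r + 970) + (6 * r + 794)
        ≡⟨ solve 2 (λ s r → con 2 :* s :+ r :+ (con 56 :* r :+ con 970) :+ (con 6 :* r :+ con 794)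
             := con 63 :* (con 28 :+ r) :+ con 2 :* s) refl s r ⟩
      63 * (28 + r) + 2 * s ∎)
    where
    open ≤-Reasoning
    r s : ℕ
    r = e ∸ 24
    s = ∑< N (λ k → r ∸ suc k)
    r≤N : r ≤ N
    r≤N = +-cancelˡ-≤ 28 r N (≤-trans (≤-reflexive (cong (4 +_) (m+[n∸m]≡n large))) le)
    longer : ∑< r (λ k → r ∸ suc k) ≤ s
    longer = subst (λ M → ∑< r (λ k → r ∸ suc k) ≤ ∑< M (λ k → r ∸ suc k)) (m∸n+n≡m r≤N)
               (∑<-prefix (λ k → r ∸ suc k) (N ∸ r))

  -- Telescoping of 1 / ν² ≤ 1 / (ν − 1) − 1 / ν.
  tail-sum : ∀ B (g : ℕ → ℕ) → (∀ k → 2 * ((28 + k) * (28 + k)) * g k ≤ 9 * B) → ∀ N → 6 * ∑< N g ≤ B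
  tail-sum B g h N = *-cancelˡ-≤ (9 * (27 + N)) (begin
    9 * (27 + N) * (6 * ∑< N g)     ≡⟨ solve 2 (λ N s → con 9 :* (con 27 :+ N) :* (con 6 :* s) := con 54 :* (con 27 :+ N) :* s) refl N (∑< N g) ⟩
    54 * (27 + N) * ∑< N g          ≤⟨ partial N ⟩
    9 * B * N                       ≤⟨ *-monoʳ-≤ (9 * B) (m≤n+m N 27) ⟩
    9 * B * (27 + N)                ≡⟨ solve 2 (λ B N → con 9 :* B :* (con 27 :+ N) := con 9 :* (con 27 :+ N) :* B) refl B N ⟩
    9 * (27 + N) * B                ∎)
    where
    open ≤-Reasoning
    partial : ∀ N → 54 * (27 + N) * ∑< N g ≤ 9 * B * N
    partial zero = ≤-reflexive (trans (*-zeroʳ (54 * 27)) (sym (*-zeroʳ (9 * B))))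
    partial (suc N) = *-cancelˡ-≤ (27 + N) (begin
      (27 + N) * (54 * (27 + suc N) * (s + e))
        ≡⟨ solve 3 (λ N s e → (con 27 :+ N) :* (con 54 :* (con 27 :+ (con 1 :+ N)) :* (s :+ e))
             := (con 28 :+ N) :* (con 54 :* (con 27 :+ N) :* s) :+ con 27 :* (con 2 :* ((con 27 :+ N) :* (con 28 :+ N)) :* e))
             refl N s e ⟩
      (28 + N) * (54 * (27 + N) * s) + 27 * (2 * ((27 + N) * (28 + N)) * e)
        ≤⟨ +-mono-≤ (*-monoʳ-≤ (28 + N) (partial N)) (*-monoʳ-≤ 27 (≤-trans
             (*-monoˡ-≤ e (*-monoʳ-≤ 2 (*-monoˡ-≤ (28 + N) (n≤1+n (27 + N))))) (h N))) ⟩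
      (28 + N) * (9 * B * N) + 27 * (9 * B)
        ≡⟨ solve 2 (λ B N → (con 28 :+ N) :* (con 9 :* B :* N) :+ con 27 :* (con 9 :* B)
             := (con 27 :+ N) :* (con 9 :* B :* (con 1 :+ N))) refl B N ⟩
      (27 + N) * (9 * B * suc N) ∎)
      where
      s e : ℕ
      s = ∑< N g
      e = g N

  -- After `c` is subtracted every term obeys the second bound, whichever alternative held, so
  -- `tail-sum` applies to all of them; the caps cost `N * c`. The 6 is 2 · 27 / 9.
  ∑<-capped : ∀ c B (g : ℕ → ℕ) → (∀ k → g k ≤ c ⊎ 2 * ((28 + k) * (28 + k)) * g k ≤ 9 * B) →
              ∀ N → 6 * ∑< N g ≤ 6 * (N * c) + B
  ∑<-capped c B g h N = begin
    6 * ∑< N g                               ≤⟨ *-monoʳ-≤ 6 (split N) ⟩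
    6 * (N * c + ∑< N (λ k → g k ∸ c))       ≡⟨ *-distribˡ-+ 6 (N * c) _ ⟩
    6 * (N * c) + 6 * ∑< N (λ k → g k ∸ c)   ≤⟨ +-monoʳ-≤ (6 * (N * c)) (tail-sum B _ small N) ⟩
    6 * (N * c) + B                          ∎
    where
    open ≤-Reasoning
    split : ∀ N → ∑< N g ≤ N * c + ∑< N (λ k → g k ∸ c)
    split zero = z≤n
    split (suc N) = ≤-trans (+-mono-≤ (split N) (m≤n+m∸n (g N) c))
      (≤-reflexive (solve 4 (λ a s c e → (a :+ s) :+ (c :+ e) := (c :+ a) :+ (s :+ e)) refl (N * c) _ c (g N ∸ c)))
    small : ∀ k → 2 * ((28 + k) * (28 + k)) * (g k ∸ c) ≤ 9 * B
    small k with h k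
    ... | inj₁ p = ≤-trans (≤-reflexive (trans (cong (2 * ((28 + k) * (28 + k)) *_) (m≤n⇒m∸n≡0 p))
                     (*-zeroʳ (2 * ((28 + k) * (28 + k)))))) z≤n
    ... | inj₂ p = ≤-trans (*-monoʳ-≤ (2 * ((28 + k) * (28 + k))) (m∸n≤m (g k) c)) p

  module _ (𝒜 : Arrangement) where
    open ArrangementProperties 𝒜

    small-lines : ℕ
    small-lines = ∑[ L ∈ lines ] 𝟙 (size L ≤? 3)

    size≥2 : ∀ L → 2 ≤ size L
    size≥2 L with two L
    ... | i , j , i≢j , p , q = begin
      2                                                      ≡⟨ cong₂ _+_ (sym (one i)) (sym (one j)) ⟩
      ∑ points (λ k → 𝟙 (i Fin.≟ k)) + ∑ points (λ k → 𝟙 (j Fin.≟ k))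
                                                             ≡⟨ ∑-+ points _ _ ⟨
      ∑[ k ∈ points ] (𝟙 (i Fin.≟ k) + 𝟙 (j Fin.≟ k))        ≤⟨ ∑-mono points each ⟩
      size L                                                 ∎
      where
      open ≤-Reasoning
      one : ∀ i → ∑ points (λ k → 𝟙 (i Fin.≟ k)) ≡ 1
      one i = ≤-antisym (∑-at-most-one (i Fin.≟_) (Uniqueₚ.allFin⁺ n) (λ a b _ _ p q → trans (sym p) q))
        (≤-trans (≤-reflexive (sym (𝟙-yes (i Fin.≟ i) refl))) (∑-∈ (λ k → 𝟙 (i Fin.≟ k)) (∈-allFin i)))
      each : ∀ k → 𝟙 (i Fin.≟ k) + 𝟙 (j Fin.≟ k) ≤ 𝟙 (On? L k)
      each k with i Fin.≟ k
      ... | yes refl = ≤-reflexive (trans (cong suc (𝟙-no (j Fin.≟ i) (λ e → i≢j (sym e)))) (sym (𝟙-yes (On? L i) p)))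
      ... | no _ = 𝟙-mono (j Fin.≟ k) (On? L k) (λ { refl → q })

    ∑points-const : ∀ k → ∑[ i ∈ points ] k ≡ n * k
    ∑points-const k = trans (∑-const points k) (cong (_* k) (length-tabulate (λ (i : Fin n) → i)))

    ∑lines-const : ∀ k → ∑[ L ∈ lines ] k ≡ V * k
    ∑lines-const k = trans (∑-const lines k) (cong (_* k) (length-tabulate (λ (L : Fin V) → L)))

    -- Two distinct points lie on a spanned line, so n(n - 1) is at most the sum of d(d - 1) over
    -- the lines; the negative terms are moved across.
    pairs-covered : n * n + ∑ lines size ≤ (∑[ L ∈ lines ] (size L * size L)) + n
    pairs-covered = begin
      n * n + ∑ lines size
        ≡⟨ cong₂ _+_ (trans (sym (∑points-const n)) (∑-cong points (λ i → trans (sym (*-identityʳ n)) (sym (∑points-const 1)))))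
                     (trans (∑-swap lines points _) (∑-cong points (λ i → sym (diagonal i (degree i))))) ⟩
      (∑[ i ∈ points ] (∑[ j ∈ points ] 1)) + (∑[ i ∈ points ] (∑[ j ∈ points ] (𝟙 (i Fin.≟ j) * degree i)))
        ≡⟨ trans (sym (∑-+ points _ _)) (∑-cong points (λ i → sym (∑-+ points _ _))) ⟩
      ∑[ i ∈ points ] (∑[ j ∈ points ] (1 + 𝟙 (i Fin.≟ j) * degree i))
        ≤⟨ ∑-mono points (λ i → ∑-mono points (each i)) ⟩
      ∑[ i ∈ points ] (∑[ j ∈ points ] (joint i j + 𝟙 (i Fin.≟ j) * 1))
        ≡⟨ trans (∑-cong points (λ i → ∑-+ points _ _)) (∑-+ points _ _) ⟩
      (∑[ i ∈ points ] (∑[ j ∈ points ] joint i j)) + (∑[ i ∈ points ] (∑[ j ∈ points ] (𝟙 (i Fin.≟ j) * 1)))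
        ≡⟨ cong₂ _+_ squares (trans (∑-cong points (λ i → diagonal i 1)) (trans (∑points-const 1) (*-identityʳ n))) ⟩
      (∑[ L ∈ lines ] (size L * size L)) + n ∎
      where
      open ≤-Reasoning
      degree : Fin n → ℕ
      degree i = ∑[ L ∈ lines ] 𝟙 (On? L i)
      joint : Fin n → Fin n → ℕ
      joint i j = ∑[ L ∈ lines ] (𝟙 (On? L i) * 𝟙 (On? L j))
      diagonal : ∀ i k → ∑[ j ∈ points ] (𝟙 (i Fin.≟ j) * k) ≡ k
      diagonal i k = trans (∑-*ʳ points k _) (trans (cong (_* k) (≤-antisym
        (∑-at-most-one (i Fin.≟_) (Uniqueₚ.allFin⁺ n) (λ a b _ _ p q → trans (sym p) q))
        (≤-trans (≤-reflexive (sym (𝟙-yes (i Fin.≟ i) refl))) (∑-∈ (λ j → 𝟙 (i Fin.≟ j)) (∈-allFin i)))))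
        (*-identityˡ k))
      each : ∀ i j → 1 + 𝟙 (i Fin.≟ j) * degree i ≤ joint i j + 𝟙 (i Fin.≟ j) * 1
      each i j with i Fin.≟ j
      ... | yes refl = ≤-reflexive (trans (cong suc (*-identityˡ (degree i)))
              (trans (+-comm 1 (degree i)) (cong (_+ 1) (∑-cong lines (λ L → sym (𝟙-idem (On? L i)))))))
      ... | no i≢j with join i j i≢j
      ...   | L , p , q = ≤-trans (≤-reflexive (sym (cong₂ _*_ (𝟙-yes (On? L i) p) (𝟙-yes (On? L j) q))))
                (≤-trans (∑-∈ (λ L → 𝟙 (On? L i) * 𝟙 (On? L j)) (∈-allFin L)) (m≤m+n _ 0))
      squares : ∑[ i ∈ points ] (∑[ j ∈ points ] joint i j) ≡ ∑[ L ∈ lines ] (size L * size L)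
      squares = trans (∑-cong points (λ i → ∑-swap points lines _)) (trans (∑-swap points lines _)
        (∑-cong lines (λ L → ∑-prod points points _ _)))

    off-points : Fin V → ℕ
    off-points L = ∑[ i ∈ points ] 𝟙 (¬? (On? L i))

    size+off : ∀ L → size L + off-points L ≡ n
    size+off L = trans (sym (∑-+ points _ _)) (trans (∑-cong points (λ i → each (On? L i)))
      (trans (∑points-const 1) (*-identityʳ n)))
      where
      each : ∀ {A : Set} (d : Dec A) → 𝟙 d + 𝟙 (¬? d) ≡ 1
      each (yes _) = refl
      each (no _) = refl

    lines-meeting : ∀ L → size L * off-points L ≤ ∑[ M ∈ lines ] (size M ∸ 1)
    lines-meeting L = begin
      size L * off-points L
        ≡⟨ ∑-prod points points _ _ ⟨
      ∑[ i ∈ points ] (∑[ j ∈ points ] (𝟙 (On? L i) * 𝟙 (¬? (On? L j))))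
        ≤⟨ ∑-mono points (λ i → ∑-mono points (λ j → each i j)) ⟩
      ∑[ i ∈ points ] (∑[ j ∈ points ] (∑[ M ∈ lines ] (a M i * b M j)))
        ≡⟨ trans (∑-cong points (λ i → ∑-swap points lines _)) (∑-swap points lines _) ⟩
      ∑[ M ∈ lines ] (∑[ i ∈ points ] (∑[ j ∈ points ] (a M i * b M j)))
        ≡⟨ ∑-cong lines (λ M → ∑-prod points points _ _) ⟩
      ∑[ M ∈ lines ] (∑ points (a M) * ∑ points (b M))
        ≤⟨ ∑-mono lines term ⟩
      ∑[ M ∈ lines ] (size M ∸ 1) ∎
      where
      open ≤-Reasoning
      a b : Fin V → Fin n → ℕ
      a M i = 𝟙 (On? L i ×-dec On? M i)
      b M j = 𝟙 (¬? (On? L j) ×-dec On? M j)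
      each : ∀ i j → 𝟙 (On? L i) * 𝟙 (¬? (On? L j)) ≤ ∑[ M ∈ lines ] (a M i * b M j)
      each i j = ≤-trans (≤-reflexive (sym (𝟙-× (On? L i) (¬? (On? L j)))))
        (𝟙-bound (On? L i ×-dec ¬? (On? L j)) found)
        where
        found : On L i × ¬ On L j → 1 ≤ ∑[ M ∈ lines ] (a M i * b M j)
        found (p , q) with join i j (λ { refl → q p })
        ... | M , Mi , Mj = ≤-trans (≤-reflexive (sym (cong₂ _*_ (𝟙-yes (On? L i ×-dec On? M i) (p , Mi))
                (𝟙-yes (¬? (On? L j) ×-dec On? M j) (q , Mj))))) (∑-∈ (λ M → a M i * b M j) (∈-allFin M))
      parts : ∀ M → ∑ points (a M) + ∑ points (b M) ≡ size M
      parts M = trans (sym (∑-+ points _ _)) (∑-cong points (λ i → split (On? L i) (On? M i)))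
        where
        split : ∀ {A B : Set} (d : Dec A) (e : Dec B) → 𝟙 (d ×-dec e) + 𝟙 (¬? d ×-dec e) ≡ 𝟙 e
        split (yes _) e = +-identityʳ (𝟙 e)
        split (no _) e = refl
      -- For a line with `u` points on `L` and `v` off it: `u ≤ 1` if it differs from `L`, and
      -- `v ≡ 0` if it is `L`.
      product : ∀ u v → (u ≤ 1) ⊎ (v ≡ 0) → u * v ≤ (u + v) ∸ 1
      product zero v _ = z≤n
      product (suc zero) v _ = ≤-reflexive (*-identityˡ v)
      product (suc (suc u)) _ (inj₁ (s≤s ()))
      product u _ (inj₂ refl) = ≤-trans (≤-reflexive (*-zeroʳ u)) z≤n
      term : ∀ M → ∑ points (a M) * ∑ points (b M) ≤ size M ∸ 1
      term M = ≤-trans (product _ _ (single M)) (≤-reflexive (cong (_∸ 1) (parts M)))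
        where
        single : ∀ M → ∑ points (a M) ≤ 1 ⊎ ∑ points (b M) ≡ 0
        single M with L Fin.≟ M
        ... | yes refl = inj₂ (∑-zero points (λ j → 𝟙-no (¬? (On? L j) ×-dec On? L j) (λ { (q , p) → q p })))
        ... | no ne = inj₁ (∑-at-most-one (λ i → On? L i ×-dec On? M i) (Uniqueₚ.allFin⁺ n) same)
          where
          same : ∀ i j → i ∈ points → j ∈ points → On L i × On M i → On L j × On M j → i ≡ j
          same i j _ _ (p , q) (p′ , q′) with i Fin.≟ j
          ... | yes e = e
          ... | no i≢j = ⊥-elim (ne (unique-join i≢j p p′ q q′))

    module _ (noncollinear : ∀ L → ∃ λ k → ¬ On L k) where

      private
        -- In other words d - 1 ≤ 4 [d ≤ 3] + 3(d - 3). The multiplier 3 of Melchior's inequality is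
        -- forced by d = 4, and then the 4 by d = 2.
        few-weight : ∀ d → 2 ≤ d → (d ∸ 1) + 9 ≤ 4 * 𝟙 (d ≤? 3) + 3 * d
        few-weight (suc zero) (s≤s ())
        few-weight (suc (suc zero)) _ = ≤-refl
        few-weight (suc (suc (suc zero))) _ = m≤m+n 11 2
        few-weight (suc (suc (suc (suc e)))) _ = begin
          3 + e + 9                    ≤⟨ m≤m+n _ (2 * e) ⟩
          3 + e + 9 + 2 * e            ≡⟨ solve 1 (λ e → con 3 :+ e :+ con 9 :+ con 2 :* e := con 3 :* (con 4 :+ e)) refl e ⟩
          3 * (4 + e)                  ∎
          where open ≤-Reasoning

      rich-line-case : ∀ L → 2 * n ≤ 61 * size L → n * off-points L ≤ 122 * small-lines
      rich-line-case L big = *-cancelˡ-≤ 2 (begin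
        2 * (n * o)                  ≡⟨ *-assoc 2 n o ⟨
        2 * n * o                    ≤⟨ *-monoˡ-≤ o big ⟩
        61 * size L * o              ≡⟨ *-assoc 61 (size L) o ⟩
        61 * (size L * o)            ≤⟨ *-monoʳ-≤ 61 (≤-trans (lines-meeting L) four) ⟩
        61 * (4 * small-lines)       ≡⟨ solve 1 (λ s → con 61 :* (con 4 :* s) := con 2 :* (con 122 :* s)) refl small-lines ⟩
        2 * (122 * small-lines)      ∎)
        where
        open ≤-Reasoning
        o : ℕ
        o = off-points L
        four : ∑[ M ∈ lines ] (size M ∸ 1) ≤ 4 * small-lines
        four = +-cancelʳ-≤ (V * 9) _ _ (begin
          (∑[ M ∈ lines ] (size M ∸ 1)) + V * 9
            ≡⟨ cong ((∑[ M ∈ lines ] (size M ∸ 1)) +_) (∑lines-const 9) ⟨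
          _ ≡⟨ ∑-+ lines _ _ ⟨
          ∑[ M ∈ lines ] ((size M ∸ 1) + 9)
            ≤⟨ ∑-mono lines (λ M → few-weight (size M) (size≥2 M)) ⟩
          ∑[ M ∈ lines ] (4 * 𝟙 (size M ≤? 3) + 3 * size M)
            ≡⟨ trans (∑-+ lines _ _) (cong₂ _+_ (∑-*ˡ lines 4 _) (∑-*ˡ lines 3 size)) ⟩
          4 * small-lines + 3 * ∑ lines size
            ≤⟨ +-monoʳ-≤ (4 * small-lines) (*-monoʳ-≤ 3 (melchior 𝒜 noncollinear)) ⟩
          4 * small-lines + 3 * (3 * V)
            ≡⟨ cong (4 * small-lines +_) (solve 1 (λ v → con 3 :* (con 3 :* v) := v :* con 9) refl V) ⟩
          4 * small-lines + V * 9 ∎)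

      -- The sum of `pairs-weight` over the lines: since 186 = 62 · 3, the constant per line cancels
      -- against 62 times Melchior's inequality.
      pairs-bound : ∀ N → (∀ L → size L ≤ 28 + N) →
                    n * n ≤ n + (64 * small-lines + 2 * ∑< N (λ k → excess 𝒜 (28 + k)))
      pairs-bound N le = +-cancelʳ-≤ (σ + V * 186) _ _ (begin
        n * n + (σ + V * 186)
          ≡⟨ +-assoc (n * n) σ _ ⟨
        n * n + σ + V * 186
          ≤⟨ +-monoˡ-≤ _ pairs-covered ⟩
        sq + n + V * 186
          ≡⟨ solve 3 (λ s n v → s :+ n :+ v := n :+ (s :+ v)) refl sq n (V * 186) ⟩
        n + (sq + V * 186)
          ≡⟨ cong (n +_) (trans (cong (sq +_) (sym (∑lines-const 186))) (sym (∑-+ lines _ _))) ⟩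
        n + (∑[ L ∈ lines ] (size L * size L + 186))
          ≤⟨ +-monoʳ-≤ n (∑-mono lines (λ L → pairs-weight N (size L) (size≥2 L) (le L))) ⟩
        n + (∑[ L ∈ lines ] (64 * 𝟙 (size L ≤? 3) + 63 * size L + 2 * ∑< N (λ k → size L ∸ (29 + k))))
          ≡⟨ cong (n +_) (trans (∑-+ lines _ _) (cong₂ _+_
               (trans (∑-+ lines _ _) (cong₂ _+_ (∑-*ˡ lines 64 _) (∑-*ˡ lines 63 size)))
               (trans (∑-*ˡ lines 2 _) (cong (2 *_) (∑<-∑ lines N (λ L k → size L ∸ (29 + k))))))) ⟩
        n + (64 * small-lines + 63 * σ + 2 * ex)
          ≡⟨ solve 4 (λ n s σ e → n :+ (con 64 :* s :+ con 63 :* σ :+ con 2 :* e)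
               := n :+ (con 64 :* s :+ con 2 :* e) :+ σ :+ con 62 :* σ) refl n small-lines σ ex ⟩
        n + (64 * small-lines + 2 * ex) + σ + 62 * σ
          ≤⟨ +-monoʳ-≤ (n + (64 * small-lines + 2 * ex) + σ) (*-monoʳ-≤ 62 (melchior 𝒜 noncollinear)) ⟩
        n + (64 * small-lines + 2 * ex) + σ + 62 * (3 * V)
          ≡⟨ solve 3 (λ a σ v → a :+ σ :+ con 62 :* (con 3 :* v) := a :+ (σ :+ v :* con 186)) refl
               (n + (64 * small-lines + 2 * ex)) σ V ⟩
        n + (64 * small-lines + 2 * ex) + (σ + V * 186) ∎)
        where
        open ≤-Reasoning
        σ sq ex : ℕ
        σ = ∑ lines size
        sq = ∑[ L ∈ lines ] (size L * size L)
        ex = ∑< N (λ k → excess 𝒜 (28 + k))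

      -- Multiplied by 122, `twice` has 244n² on the left. Of these 192n² are claimed, and the other
      -- 52n² must pay for the terms in n and Nn.
      poor-lines-case : 8 ≤ n → (∀ L → 61 * size L ≤ 2 * n) → n * n ≤ 122 * small-lines
      poor-lines-case 8≤n poor = *-cancelˡ-≤ 192 (+-cancelʳ-≤ (366 * n + 732 * (N * n)) _ _ (begin
        192 * (n * n) + (366 * n + 732 * (N * n))
          ≡⟨ solve 2 (λ n N → con 192 :* (n :* n) :+ (con 366 :* n :+ con 732 :* (N :* n))
               := con 192 :* (n :* n) :+ (con 366 :+ con 732 :* N) :* n) refl n N ⟩
        192 * (n * n) + (366 + 732 * N) * n
          ≤⟨ +-monoʳ-≤ (192 * (n * n)) (*-monoˡ-≤ n N-small) ⟩
        192 * (n * n) + 52 * n * n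
          ≡⟨ solve 1 (λ n → con 192 :* (n :* n) :+ con 52 :* n :* n := con 122 :* (con 2 :* (n :* n))) refl n ⟩
        122 * (2 * (n * n))
          ≤⟨ *-monoʳ-≤ 122 twice ⟩
        122 * (3 * n + 192 * small-lines + 6 * (N * n))
          ≡⟨ solve 3 (λ n s t → con 122 :* (con 3 :* n :+ con 192 :* s :+ con 6 :* t)
               := con 192 :* (con 122 :* s) :+ (con 366 :* n :+ con 732 :* t)) refl n small-lines (N * n) ⟩
        192 * (122 * small-lines) + (366 * n + 732 * (N * n)) ∎))
        where
        open ≤-Reasoning
        l N : ℕ
        l = (2 * n) / 61
        N = l ∸ 28
        instance
          n≢0 : NonZero n
          n≢0 = >-nonZero (≤-trans (s≤s z≤n) 8≤n)
        size≤ : ∀ L → size L ≤ 28 + N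
        size≤ L = ≤-trans (subst (_≤ l) (m*n/n≡m (size L) 61)
          (/-monoˡ-≤ 61 (≤-trans (≤-reflexive (*-comm (size L) 61)) (poor L)))) (m≤n+m∸n l 28)
        -- If `l` is at least 28, the 28 levels missing from `N` absorb the 366, and 732 ≤ 26 · 61.
        -- If not, then `N` is zero and 366 ≤ 52 · 8.
        N-small : 366 + 732 * N ≤ 52 * n
        N-small with ≤-total l 28
        ... | inj₁ p = ≤-trans (≤-reflexive (cong (λ k → 366 + 732 * k) (m≤n⇒m∸n≡0 p)))
                (≤-trans (m≤m+n 366 50) (*-monoʳ-≤ 52 8≤n))
        ... | inj₂ p = begin
          366 + 732 * N                 ≤⟨ +-monoˡ-≤ (732 * N) (m≤m+n 366 (732 * 28 ∸ 366)) ⟩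
          732 * 28 + 732 * N            ≡⟨ *-distribˡ-+ 732 28 N ⟨
          732 * (28 + N)                ≡⟨ cong (732 *_) (m+[n∸m]≡n p) ⟩
          732 * l                       ≤⟨ *-monoˡ-≤ l (m≤m+n 732 (26 * 61 ∸ 732)) ⟩
          26 * 61 * l                   ≡⟨ solve 1 (λ l → con (26 * 61) :* l := con 26 :* (l :* con 61)) refl l ⟩
          26 * (l * 61)                 ≤⟨ *-monoʳ-≤ 26 (m/n*n≤m (2 * n) 61) ⟩
          26 * (2 * n)                  ≡⟨ solve 1 (λ n → con 26 :* (con 2 :* n) := con 52 :* n) refl n ⟩
          52 * n                        ∎
        twice : 2 * (n * n) ≤ 3 * n + 192 * small-lines + 6 * (N * n)
        twice = +-cancelʳ-≤ (n * n) _ _ (begin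
          2 * (n * n) + n * n
            ≡⟨ solve 1 (λ a → con 2 :* a :+ a := con 3 :* a) refl (n * n) ⟩
          3 * (n * n)
            ≤⟨ *-monoʳ-≤ 3 (pairs-bound N size≤) ⟩
          3 * (n + (64 * small-lines + 2 * ex))
            ≡⟨ solve 3 (λ n s e → con 3 :* (n :+ (con 64 :* s :+ con 2 :* e)) := con 3 :* n :+ con 192 :* s :+ con 6 :* e)
                 refl n small-lines ex ⟩
          3 * n + 192 * small-lines + 6 * ex
            ≤⟨ +-monoʳ-≤ (3 * n + 192 * small-lines) (∑<-capped n (n * n) _ (λ k → excess-bound 𝒜 (28 + k)) N) ⟩
          3 * n + 192 * small-lines + (6 * (N * n) + n * n)
            ≡⟨ +-assoc (3 * n + 192 * small-lines) _ _ ⟨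
          3 * n + 192 * small-lines + 6 * (N * n) + n * n ∎)
          where
          ex : ℕ
          ex = ∑< N (λ k → excess 𝒜 (28 + k))

    many-small-lines : ∀ l → Fin V → (∀ L → size L ≤ l) → n * (n ∸ l) ≤ 122 * small-lines
    many-small-lines l L₀ bounded with Finₚ.any? (λ L → Finₚ.all? (On? L))
    -- All points collinear: then `n ≤ l`, and the left side vanishes.
    ... | yes (L , all) = ≤-trans (≤-reflexive (trans (cong (n *_) (m≤n⇒m∸n≡0 n≤l)) (*-zeroʳ n))) z≤n
      where
      n≤l : n ≤ l
      n≤l = ≤-trans (≤-reflexive (trans (sym (trans (∑points-const 1) (*-identityʳ n)))
              (∑-cong points (λ i → sym (𝟙-yes (On? L i) (all i)))))) (bounded L)
    ... | no ¬collinear with Finₚ.any? (λ L → 2 * n ≤? 61 * size L)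
    ...   | yes (L , big) = ≤-trans (*-monoʳ-≤ n n∸l≤off) (rich-line-case noncollinear L big)
      where
      noncollinear : ∀ L → ∃ λ k → ¬ On L k
      noncollinear L = Finₚ.¬∀⟶∃¬ n (On L) (On? L) (λ h → ¬collinear (L , h))
      n∸l≤off : n ∸ l ≤ off-points L
      n∸l≤off = ≤-trans (∸-monoʳ-≤ n (bounded L))
        (≤-reflexive (trans (cong (_∸ size L) (sym (size+off L))) (m+n∸m≡n (size L) _)))
    ...   | no ¬big = ≤-trans (*-monoʳ-≤ n (m∸n≤m n l)) (poor-lines-case noncollinear 8≤n (λ L → <⇒≤ (poor L)))
      where
      noncollinear : ∀ L → ∃ λ k → ¬ On L k
      noncollinear L = Finₚ.¬∀⟶∃¬ n (On L) (On? L) (λ h → ¬collinear (L , h))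
      poor : ∀ L → 61 * size L < 2 * n
      poor L = ≰⇒> (λ h → ¬big (L , h))
      -- A spanned line has two points, so 122 ≤ 61 · `size L₀` < 2n.
      8≤n : 8 ≤ n
      8≤n = *-cancelˡ-≤ 2 (≤-trans (m≤m+n 16 106) (≤-trans (*-monoʳ-≤ 61 (size≥2 L₀)) (<⇒≤ (poor L₀))))

-- From points in the plane to an arrangement and back.

module Final where

  open import Data.Nat as ℕ using (ℕ; _*_; _∸_; _≤_)
  import Data.Nat.Properties as ℕₚ
  open import Data.Bool using (true; false)
  open import Data.Fin as Fin using (Fin; zero; suc)
  open import Data.Fin.Subset as Subset using (Subset; ∣_∣; ⁅_⁆)
  open import Data.Fin.Subset.Properties as Subsetₚ using (_∈?_)
  open import Data.Integer using (+_)
  open import Data.List as List using (List; []; _∷_; length; map; filter; allFin; cartesianProduct; deduplicate; lookup)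
  open import Data.List.Properties using (length-map; map-tabulate)
  open import Data.List.Membership.Propositional using (_∈_)
  open import Data.List.Membership.Propositional.Properties using (∈-allFin; ∈-filter⁺; ∈-filter⁻; ∈-map⁺; ∈-map⁻; ∈-lookup; ∈-cartesianProduct⁺; ∈-deduplicate⁻)
  open import Data.List.Relation.Unary.All as All using (All; []; _∷_)
  import Data.List.Relation.Unary.All.Properties as Allₚ
  open import Data.List.Relation.Unary.AllPairs as AllPairs using (AllPairs; []; _∷_)
  import Data.List.Relation.Unary.AllPairs.Properties as AllPairsₚ
  open import Data.List.Relation.Unary.Any as Any using (Any; here; there)
  import Data.List.Relation.Unary.Any.Properties as Anyₚ
  import Data.List.Relation.Unary.Unique.Propositional.Properties as Uniqueₚ
  import Data.List.Relation.Unary.Unique.DecSetoid.Properties as DecUniqueₚ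
  open import Data.Product using (Σ; ∃; _×_; _,_; proj₁; proj₂)
  open import Data.Product.Relation.Binary.Pointwise.NonDependent using (×-decSetoid)
  open import Data.Sum using (inj₁; inj₂)
  open import Data.Empty using (⊥-elim)
  open import Data.Vec as Vec using ([]; _∷_; here; there)
  import Data.Vec.Properties as Vecₚ
  open import Relation.Nullary using (¬_; yes; no; does)
  open import Relation.Nullary.Decidable using (¬?; dec-true)
  open import Relation.Binary.Bundles using (DecSetoid)
  open import Relation.Binary.PropositionalEquality as ≡ using (_≡_; _≢_)
  open Sums

  ∣_∣≡∑ : ∀ {n} (S : Subset n) → ∣ S ∣ ≡ ∑[ i ∈ allFin n ] 𝟙 (i ∈? S)
  ∣ [] ∣≡∑ = ≡.refl
  ∣_∣≡∑ {ℕ.suc n} (s ∷ S) = ≡.trans (head s) (≡.cong (𝟙 (zero ∈? (s ∷ S)) ℕ.+_) (≡.trans ∣ S ∣≡∑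
    (≡.trans (≡.sym (∑-map suc (allFin n) _)) (≡.cong (λ is → ∑ is (λ i → 𝟙 (i ∈? (s ∷ S)))) (map-tabulate (λ i → i) suc)))))
    where
    head : ∀ s → ∣ s ∷ S ∣ ≡ 𝟙 (zero ∈? (s ∷ S)) ℕ.+ ∣ S ∣
    head true = ≡.refl
    head false = ≡.refl

  lookup-injective : ∀ {A : Set} {R : A → A → Set} → (∀ {a b} → R a b → R b a) → ∀ {xs} →
                     AllPairs (λ a b → ¬ R a b) xs → ∀ i j → R (lookup xs i) (lookup xs j) → i ≡ j
  lookup-injective s (_ ∷ _) zero zero _ = ≡.refl
  lookup-injective s {xs = _ ∷ xs} (h ∷ _) zero (suc j) r = ⊥-elim (All.lookup h (∈-lookup {xs = xs} j) r)
  lookup-injective s {xs = _ ∷ xs} (h ∷ _) (suc i) zero r = ⊥-elim (All.lookup h (∈-lookup {xs = xs} i) (s r))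
  lookup-injective s (_ ∷ hs) (suc i) (suc j) r = ≡.cong suc (lookup-injective s hs i j r)

  module _ (ℝ : RealNumbers) where
    open Field ℝ renaming (_≤_ to _≤ᴿ_; _*_ to _·_)
    open Plane ℝ
    open Geometry ℝ
    open Solver using (solve; _:=_; _:+_; _:*_; _:-_; :-_; con)

    private
      root : ∀ {p q t} → ¬ (q ≈ 0#) → p + t · q ≈ 0# → t ≈ - (p · inv q)
      root {p} {q} {t} q≉0 z = begin
        t                                 ≈⟨ sym (*-identityʳ t) ⟩
        t · 1#                            ≈⟨ *-congˡ (sym (inv-inverse q≉0)) ⟩
        t · (q · inv q)
          ≈⟨ solve 4 (λ t p q r → t :* (q :* r) := (p :+ t :* q) :* r :- p :* r) refl t p q (inv q) ⟩
        (p + t · q) · inv q - p · inv q   ≈⟨ +-congʳ (trans (*-congʳ z) (zeroˡ _)) ⟩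
        0# - p · inv q                    ≈⟨ +-identityˡ _ ⟩
        - (p · inv q)                     ∎
        where open import Relation.Binary.Reasoning.Setoid setoid

    -- Each `a` excludes at most one value of `t`, the root of an affine function; `T` is the
    -- largest of these roots and zero.
    avoid-roots : ∀ {A : Set} (as : List A) (p q : A → Carrier) → ∃ λ T → ∀ t → T < t →
                  ∀ a → a ∈ as → ¬ ((p a ≈ 0#) × (q a ≈ 0#)) → ¬ (p a + t · q a ≈ 0#)
    avoid-roots [] p q = 0# , λ _ _ _ ()
    avoid-roots (a ∷ as) p q with avoid-roots as p q | q a ≈? 0#
    ... | T , h | yes e = T , λ
      { t T<t _ (here ≡.refl) nz z → nz (trans (sym (trans (+-congˡ (trans (*-congˡ e) (zeroʳ t))) (+-identityʳ _))) z , e)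
      ; t T<t b (there m) → h t T<t b m }
    ... | T , h | no q≉0 with ≤-total T (- (p a · inv (q a)))
    ...   | inj₁ T≤r = - (p a · inv (q a)) , λ
      { t r<t _ (here ≡.refl) _ z → <-irrefl (sym (root q≉0 z)) r<t
      ; t r<t b (there m) → h t (≤-<-trans T≤r r<t) b m }
    ...   | inj₂ r≤T = T , λ
      { t T<t _ (here ≡.refl) _ z → <-irrefl (sym (root q≉0 z)) (≤-<-trans r≤T T<t)
      ; t T<t b (there m) → h t T<t b m }

    a-b≈0⇒a≈b : ∀ {a b} → a - b ≈ 0# → a ≈ b
    a-b≈0⇒a≈b {a} {b} e = trans (solve 2 (λ a b → a := (a :- b) :+ b) refl a b) (trans (+-congʳ e) (+-identityˡ b))

    module _ (𝒜 : Arrangement) (P : Fin (Arrangement.n 𝒜) → Point) (τ : Carrier)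
             (x≈ : ∀ i → Arrangement.x 𝒜 i ≈ proj₁ (P i) + τ · proj₂ (P i))
             (y≈ : ∀ i → Arrangement.y 𝒜 i ≈ proj₂ (P i)) where
      open ArrangementProperties 𝒜

      private
        -- y = m (x + τ y) + c
        toLine : Fin V → Line
        toLine L = line (m L) (m L · τ - 1#) (- c L) λ { (u , v) → <-irrefl (sym (1≈0 u v)) 0<1 }
          where
          1≈0 : m L ≈ 0# → m L · τ - 1# ≈ 0# → 1# ≈ 0#
          1≈0 u v = trans (sym (a-b≈0⇒a≈b v)) (trans (*-congʳ u) (zeroˡ τ))

        px py : Fin n → Carrier
        px i = proj₁ (P i)
        py i = proj₂ (P i)

        rearrange : ∀ L i → (m L · px i + (m L · τ - 1#) · py i) - - c L ≈ f L (x i) - y i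
        rearrange L i = trans (rearrange′ L i) (+-cong (+-congʳ (*-congˡ (sym (x≈ i)))) (-‿cong (sym (y≈ i))))
          where
          rearrange′ : ∀ L i → (m L · px i + (m L · τ - 1#) · py i) - - c L ≈ f L (px i + τ · py i) - py i
          rearrange′ L i = trans (+-congʳ (+-congˡ (trans (solve 3 (λ s o y → (s :- o) :* y := s :* y :- o :* y) refl (m L · τ) 1# (py i))
              (+-congˡ (-‿cong (*-identityˡ (py i)))))))
            (solve 5 (λ m t x y c → (m :* x :+ (m :* t :* y :- y)) :- (:- c) := (m :* (x :+ t :* y) :+ c) :- y)
              refl (m L) τ (px i) (py i) (c L))

        on⇒OnLine : ∀ {L i} → On L i → OnLine (P i) (toLine L)
        on⇒OnLine {L} {i} p = a-b≈0⇒a≈b (trans (rearrange L i) (trans (+-congˡ (-‿cong p)) (-‿inverseʳ _)))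

        OnLine⇒on : ∀ {L i} → OnLine (P i) (toLine L) → On L i
        OnLine⇒on {L} {i} p = sym (a-b≈0⇒a≈b (trans (sym (rearrange L i)) (trans (+-congʳ p) (-‿inverseʳ _))))

        different : ∀ {L M} → L ≢ M → DifferentLines (toLine L) (toLine M)
        different {L} {M} ne h with two L
        ... | i , j , i≢j , p , q = ne (unique-join i≢j p q (transfer i p) (transfer j q))
          where
          transfer : ∀ k → On L k → On M k
          transfer k r = OnLine⇒on {M} (proj₁ (h (P k)) (on⇒OnLine {L} r))

        determined : ∀ L → Determined P (toLine L)
        determined L with two L
        ... | i , j , i≢j , p , q = i , j , i≢j , on⇒OnLine {L} p , on⇒OnLine {L} q

        subset≤size : ∀ {L} (S : Subset n) → (∀ i → i Subset.∈ S → OnLine (P i) (toLine L)) → ∣ S ∣ ≤ size L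
        subset≤size {L} S h = ℕₚ.≤-trans (ℕₚ.≤-reflexive ∣ S ∣≡∑)
          (∑-mono points (λ i → 𝟙-mono (i ∈? S) (On? L i) (λ p → OnLine⇒on {L} (h i p))))

        size≤ : ∀ {l} → AtMostCollinear P l → ∀ L → size L ≤ l
        size≤ bounded L = ℕₚ.≤-trans (∑-mono points (λ i → 𝟙-mono (On? L i) (i ∈? S) (into i)))
          (ℕₚ.≤-trans (ℕₚ.≤-reflexive (≡.sym ∣ S ∣≡∑)) (bounded (toLine L) S out))
          where
          S : Subset n
          S = Vec.tabulate (λ i → does (On? L i))
          into : ∀ i → On L i → i Subset.∈ S
          into i p = Vecₚ.lookup⇒[]= i S (≡.trans (Vecₚ.lookup∘tabulate _ i) (dec-true (On? L i) p))
          out : ∀ i → i Subset.∈ S → OnLine (P i) (toLine L)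
          out i p with On? L i | ≡.trans (≡.sym (Vecₚ.lookup∘tabulate (λ i → does (On? L i)) i)) (Vecₚ.[]=⇒lookup p)
          ... | yes q | _ = on⇒OnLine {L} q
          ... | no _ | ()

      small-lines-determined : ∀ l → AtMostCollinear P l → Fin V → Σ (List Line) λ Ls →
        AllPairs DifferentLines Ls × All (λ L → Determined P L × AtMostOn P L 3) Ls ×
        n * (n ∸ l) ≤ 122 * length Ls
      small-lines-determined l bounded L₀ =
        map toLine small ,
        AllPairsₚ.map⁺ (AllPairs.map different (Uniqueₚ.filter⁺ _ (Uniqueₚ.allFin⁺ V))) ,
        Allₚ.map⁺ (All.map (λ {L} le → determined L , λ S h → ℕₚ.≤-trans (subset≤size {L} S h) le)
          (Allₚ.all-filter (λ L → size L ℕ.≤? 3) lines)) ,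
        ℕₚ.≤-trans (Count.many-small-lines ℝ 𝒜 l L₀ (size≤ bounded))
          (ℕₚ.≤-reflexive (≡.cong (122 *_) (≡.trans count (≡.sym (length-map toLine small)))))
        where
        small : List (Fin V)
        small = filter (λ L → size L ℕ.≤? 3) lines
        count : ∑[ L ∈ lines ] 𝟙 (size L ℕ.≤? 3) ≡ length small
        count = ≡.trans (∑-cong lines (λ L → ≡.sym (ℕₚ.*-identityʳ _)))
          (≡.trans (≡.sym (∑-filter (λ L → size L ℕ.≤? 3) lines (λ _ → 1)))
            (≡.trans (∑-const small 1) (ℕₚ.*-identityʳ _)))

    module _ {n : ℕ} (P : Fin n → Point) (distinct : Distinct P) where

      private
        px py : Fin n → Carrier
        px i = proj₁ (P i)
        py i = proj₂ (P i)

        pairs : List (Fin n × Fin n)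
        pairs = cartesianProduct (allFin n) (allFin n)

        dx dy : Fin n × Fin n → Carrier
        dx (i , j) = px i - px j
        dy (i , j) = py i - py j

        shear : ∃ λ T → ∀ t → T < t → ∀ a → a ∈ pairs → ¬ ((dx a ≈ 0#) × (dy a ≈ 0#)) → ¬ (dx a + t · dy a ≈ 0#)
        shear = avoid-roots pairs dx dy

      -- Parameter of the shear (x, y) ↦ (x + τy, y). It lies beyond every value at which two
      -- distinct points get the same first coordinate, so no spanned line becomes vertical.
      τ : Carrier
      τ = proj₁ shear + 1#

      private

        X : Fin n → Carrier
        X i = px i + τ · py i

        X-inj : ∀ {i j} → X i ≈ X j → i ≡ j
        X-inj {i} {j} e with i Fin.≟ j
        ... | yes eq = eq
        ... | no i≢j = ⊥-elim (proj₂ shear τ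
          (0<⇒< (<-respʳ-≈ (solve 2 (λ t o → o := (t :+ o) :- t) refl (proj₁ shear) 1#) 0<1))
          (i , j) (∈-cartesianProduct⁺ (∈-allFin i) (∈-allFin j))
          (λ { (u , v) → i≢j (distinct i j (a-b≈0⇒a≈b u , a-b≈0⇒a≈b v)) })
          (trans (solve 5 (λ a b t c d → (a :- b) :+ t :* (c :- d) := (a :+ t :* c) :- (b :+ t :* d))
            refl (px i) (px j) τ (py i) (py j)) (trans (+-congʳ e) (-‿inverseʳ _))))

        through : Fin n × Fin n → Carrier × Carrier
        through (i , j) = σ , py i - σ · X i
          where
          σ : Carrier
          σ = (py j - py i) · inv (X j - X i)

        through-left : ∀ i j → py i ≈ proj₁ (through (i , j)) · X i + proj₂ (through (i , j))
        through-left i j = solve 3 (λ y s x → y := s :* x :+ (y :- s :* x)) refl (py i) (proj₁ (through (i , j))) (X i)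

        through-right : ∀ {i j} → i ≢ j → py j ≈ proj₁ (through (i , j)) · X j + proj₂ (through (i , j))
        through-right {i} {j} i≢j = sym (begin
          (py j - py i) · r · X j + (py i - (py j - py i) · r · X i)
            ≈⟨ solve 5 (λ y y′ r x x′ → (y′ :- y) :* r :* x′ :+ (y :- (y′ :- y) :* r :* x)
                 := (y′ :- y) :* ((x′ :- x) :* r) :+ y) refl (py i) (py j) r (X i) (X j) ⟩
          (py j - py i) · ((X j - X i) · r) + py i
            ≈⟨ +-congʳ (trans (*-congˡ (inv-inverse (λ e → i≢j (≡.sym (X-inj (a-b≈0⇒a≈b e)))))) (*-identityʳ _)) ⟩
          (py j - py i) + py i
            ≈⟨ solve 2 (λ a b → (a :- b) :+ b := a) refl (py j) (py i) ⟩
          py j ∎)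
          where
          open import Relation.Binary.Reasoning.Setoid setoid
          r : Carrier
          r = inv (X j - X i)

        carrierDecSetoid : DecSetoid _ _
        carrierDecSetoid = record { isDecEquivalence = record { isEquivalence = isEquivalence ; _≟_ = _≈?_ } }

        lineDecSetoid : DecSetoid _ _
        lineDecSetoid = ×-decSetoid carrierDecSetoid carrierDecSetoid

        module 𝓛 = DecSetoid lineDecSetoid

        raw spanned : List (Carrier × Carrier)
        raw = map through (filter (λ { (i , j) → ¬? (i Fin.≟ j) }) pairs)
        -- Many pairs span the same line, with slope and intercept equal only up to `≈`; removing
        -- duplicates for that relation yields `line-inj`.
        spanned = deduplicate 𝓛._≟_ raw

        on-resp : ∀ {l l′ x y} → l 𝓛.≈ l′ → y ≈ proj₁ l · x + proj₂ l → y ≈ proj₁ l′ · x + proj₂ l′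
        on-resp (e , d) p = trans p (+-cong (*-congʳ e) d)

        join′ : ∀ i j → i ≢ j → ∃ λ L → (py i ≈ proj₁ (lookup spanned L) · X i + proj₂ (lookup spanned L)) ×
                                          (py j ≈ proj₁ (lookup spanned L) · X j + proj₂ (lookup spanned L))
        join′ i j i≢j = Any.index found , on-resp at (through-left i j) , on-resp at (through-right i≢j)
          where
          found : Any (through (i , j) 𝓛.≈_) spanned
          found = Anyₚ.deduplicate⁺ 𝓛._≟_ (λ p q → 𝓛.trans q (𝓛.sym p))
            (Any.map (λ { ≡.refl → 𝓛.refl }) (∈-map⁺ through (∈-filter⁺ (λ { (i , j) → ¬? (i Fin.≟ j) })
              (∈-cartesianProduct⁺ (∈-allFin i) (∈-allFin j)) i≢j)))
          at : through (i , j) 𝓛.≈ lookup spanned (Any.index found)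
          at = Anyₚ.lookup-index found

        two′ : ∀ L → ∃ λ i → ∃ λ j → i ≢ j × (py i ≈ proj₁ (lookup spanned L) · X i + proj₂ (lookup spanned L)) ×
                                             (py j ≈ proj₁ (lookup spanned L) · X j + proj₂ (lookup spanned L))
        two′ L with ∈-map⁻ through (∈-deduplicate⁻ 𝓛._≟_ raw (∈-lookup {xs = spanned} L))
        ... | (i , j) , m , e with ∈-filter⁻ (λ { (i , j) → ¬? (i Fin.≟ j) }) {xs = pairs} m
        ...   | _ , i≢j = i , j , i≢j , ≡.subst (λ l → py i ≈ proj₁ l · X i + proj₂ l) (≡.sym e) (through-left i j)
                                      , ≡.subst (λ l → py j ≈ proj₁ l · X j + proj₂ l) (≡.sym e) (through-right i≢j)

      arrangement : Arrangement
      arrangement = record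
        { n = n ; V = length spanned ; x = X ; y = py ; x-inj = X-inj
        ; m = λ L → proj₁ (lookup spanned L) ; c = λ L → proj₂ (lookup spanned L)
        ; line-inj = λ {L} {M} e d → lookup-injective 𝓛.sym (DecUniqueₚ.deduplicate-! lineDecSetoid raw) L M (e , d)
        ; join = join′ ; two = two′ }

    -- A single point spans no line; this one through it serves to derive `1 ≤ l` from the
    -- collinearity bound.
    vertical : Carrier → Line
    vertical a = line 1# 0# a λ { (e , _) → <-irrefl (sym e) 0<1 }

open import Data.Nat using (ℕ; _*_; _∸_; _≤_)
open import Data.Fin using (Fin)
open import Data.List using (List; length)
open import Data.List.Relation.Unary.All using (All)
open import Data.List.Relation.Unary.AllPairs using (AllPairs)
open import Data.Product using (Σ; _×_)
open import Data.Nat using (zero; suc; z≤n)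
open import Data.Nat.Properties using (≤-reflexive; *-identityˡ; m≤n⇒m∸n≡0)
open import Data.Fin using (zero; suc)
open import Data.Fin.Subset using (⁅_⁆)
open import Data.List using ([])
open import Data.List.Relation.Unary.All using ([])
open import Data.List.Relation.Unary.AllPairs using ([])
open import Data.Product using (_,_; proj₁; proj₂)
open import Relation.Binary.PropositionalEquality using (trans)
open Final

theorem3 : (ℝ : RealNumbers) → let open Plane ℝ in
    (n l : ℕ) (P : Fin n → Point) → Distinct P → AtMostCollinear P l →
    Σ (List Line) λ Ls →
    AllPairs DifferentLines Ls ×
    All (λ L → Determined P L × AtMostOn P L 3) Ls ×
    n * (n ∸ l) ≤ 122 * length Ls
theorem3 ℝ 0 l P distinct bounded = [] , [] , [] , z≤n
-- The empty list suffices, since `1 ≤ l` makes `1 ∸ l` vanish.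
theorem3 ℝ 1 l P distinct bounded = [] , [] , [] ,
  ≤-reflexive (trans (*-identityˡ (1 ∸ l)) (m≤n⇒m∸n≡0 1≤l))
  where
  module R = RealNumbers ℝ
  1≤l : 1 ≤ l
  1≤l = bounded (vertical ℝ (proj₁ (P zero))) ⁅ zero ⁆
    (λ { zero _ → R.trans (R.+-cong (R.*-identityˡ _) (R.zeroˡ _)) (R.+-identityʳ _) })
-- The first two points span the line `L₀` from which the count starts.
theorem3 ℝ n@(suc (suc _)) l P distinct bounded =
  small-lines-determined ℝ (arrangement ℝ P distinct) P (τ ℝ P distinct)
    (λ _ → RealNumbers.refl ℝ) (λ _ → RealNumbers.refl ℝ) l bounded
    (proj₁ (Geometry.Arrangement.join (arrangement ℝ P distinct) zero (suc zero) (λ ())))
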